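{- Let $p$ be a prime with $p\ge 5$. Every positive integer $n$ is a sum of $k$ squares not divisible by $p$ for some positive integer $k\le 4$, except in the case $p=5$ and $n=79$. In the exceptional case, $79$ is a sum of $5$ squares not divisible by $5$.
   Context: For a prime $p$, an integer $n$ is a sum of $k$ squares not divisible by $p$ if there are integers $x_1,\dots,x_k$ with $n=x_1^2+\cdots+x_k^2$ and $\gcd(p,x_1x_2\cdots x_k)=1$. -}

module Defs where

open import Data.Nat using (ℕ)
open import Data.Integer using (ℤ; +_; _+_; _*_)
open import Data.Integer.GCD using (gcd)
open import Data.Vec using (Vec; foldr)
open import Data.Product using (∃)
open import Relation.Binary.PropositionalEquality using (_≡_)

sumSq : ∀ {k} → Vec ℤ k → ℤ
sumSq = foldr _ (λ x s → x * x + s) (+ 0)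

prod : ∀ {k} → Vec ℤ k → ℤ
prod = foldr _ _*_ (+ 1)

SumSqNotDiv : ℕ → ℕ → ℤ → Set
SumSqNotDiv p k n = ∃ λ (xs : Vec ℤ k) → (n ≡ sumSq xs) Data.Product.× (gcd (+ p) (prod xs) ≡ + 1)

{-# OPTIONS --safe #-}
-- Three squares.  Let Q = ab + ac + bc.  Cutting the positive solutions of Q = V along x₀ > x₁, x₀ < x₁, x₀ = x₁ and along
-- parities gives linear relations between weighted counts of solutions of quadratic forms.  Suitable combinations of them
-- (certificates verified by evaluation) are recurrences Σ_t g(t) D(n − t²) = 0 for the numbers D of solutions of
-- ab + ac + bc = n with prescribed parities.  The number R₃ of representations by three squares satisfies the same
-- recurrences, because g(t) + g(x) + g(y) + g(z) = 0 whenever t² + x² + y² + z² = n.  Hence R₃(n) equals an evidently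
-- positive count for n ≡ 1, 2 (mod 4) and n ≡ 3 (mod 8), and every n not divisible by 4 is a sum of four squares.
--
-- Avoiding p.  If n < p², a nonzero x with x² ≤ n is prime to p.  Otherwise write n = t²E + tpl + p²j with E, t, j odd,
-- p ∤ t, 4E < p² and l² < 4jE.  By the three squares theorem jE (4jE if n is odd) is the norm of an integral quaternion
-- with real part l/2 (l if n is odd), and this quaternion factors as a q with N(a) = E.  Then t a + p q̄ has norm n
-- (2 t a + p q̄ has norm 4n), and a rotation by the 4 × 4 matrix of signs gives coordinates x ≡ t s (mod p) up to powers
-- of 2, where s, a signed sum of the coordinates of a, is odd with s² ≤ 4E < p²; so p ∤ x.  Such E, t, l, j exist by an
-- explicit choice for p ≥ 17 and by a finite search for p ≤ 13.  Multiples of 4 are reduced to n/4 by doubling, except 316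
-- for p = 5.
module Submission where

open import Defs
open import Level using (0ℓ)
open import Algebra using (CommutativeSemiring)
open import Data.Nat as ℕ using (ℕ; zero; suc; z≤n; s≤s; NonZero; _≤_)
import Data.Nat.Properties as ℕ
import Data.Nat.DivMod as ℕ
import Data.Nat.GCD as ℕ
open import Data.Nat.Induction using (<-rec)
open import Data.Nat.Divisibility using (divides; ∣⇒≤; ∣-refl; ∣m⇒∣m*n; ∣n⇒∣m*n; ∣m+n∣m⇒∣n; m∣m*n; n∣m⇒m%n≡0; m%n≡0⇒n∣m; ∣1⇒≡1; _∣?_) renaming (_∣_ to _∣ℕ_)
open import Data.Nat.Primality using (Prime; prime?; euclidsLemma; prime⇒irreducible; prime⇒nonZero)
import Data.Nat.Tactic.RingSolver as ℕ-Solver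
open import Data.Bool as Bool using (Bool; true; false; not; _xor_; _∧_; _∨_; if_then_else_)
import Data.Bool.Properties as Bool
open import Data.Fin as Fin using (Fin)
import Data.Fin.Properties as Fin
open import Data.List as List using (List; []; _∷_)
open import Data.List.Membership.Propositional using (_∈_)
open import Data.List.Relation.Unary.Any using (here; there)
open import Data.Vec as Vec using (Vec; []; _∷_; zipWith)
import Data.Vec.Properties as Vec
open import Data.Vec.Relation.Unary.All using (All; []; _∷_)
open import Data.Product using (Σ; ∃; _×_; _,_; proj₁; proj₂)
open import Data.Sum using (_⊎_; inj₁; inj₂)
open import Data.Empty using (⊥; ⊥-elim)
open import Function.Bundles using (module Equivalence)
open import Relation.Nullary using (¬_; Dec; yes; no)
open import Relation.Nullary.Decidable using (True; toWitness; from-yes; from-no; _→-dec_; _⊎-dec_)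
open import Relation.Binary.PropositionalEquality

-- The form ab + ac + bc enters because a nonnegative solution of ab + ac + bc = n yields the
-- reduced binary form (a + c)x² + 2cxy + (b + c)y² of determinant n. The counts D are thus class
-- numbers, and the certified identities are of the kind found by Kronecker and Liouville. A
-- recurrence determines its sequence because t = ±1 isolates the argument n - 1, while every other
-- t reaches a smaller argument of the same class or an argument of a class already settled. The
-- parities of E, t and j put the norm left for the imaginary part, 4jE - l² or jE - (l/2)², into
-- the classes 3 mod 8 or 1, 2 mod 4, where three squares are available. E odd also makes s odd,
-- hence nonzero, so that s² < p² really excludes p | s. Quaternions with integer coordinates admit
-- no Euclidean algorithm, since a remainder modulo an even number need not have smaller norm. The
-- factor of norm E therefore comes from a descent on E in which factors of norm 2 are split off
-- separately.

-- Quadratic forms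

-- Upper triangular coefficient array of a quadratic form in k variables.
data Form (A : Set) : ℕ → Set where
  []  : Form A 0
  _∷_ : ∀ {k} → Vec A (suc k) → Form A k → Form A (suc k)

mapForm : ∀ {A B : Set} {k} → (A → B) → Form A k → Form B k
mapForm f []      = []
mapForm f (r ∷ q) = Vec.map f r ∷ mapForm f q

swapVec : ∀ {A : Set} {k} → ℕ → Vec A k → Vec A k
swapVec zero    (x ∷ y ∷ xs) = y ∷ x ∷ xs
swapVec (suc i) (x ∷ xs)     = x ∷ swapVec i xs
swapVec _       xs           = xs

swapForm : ∀ {A : Set} {k} → ℕ → Form A k → Form A k
swapForm zero    ((a ∷ b ∷ r) ∷ (d ∷ s) ∷ q) = (d ∷ b ∷ s) ∷ (a ∷ r) ∷ q
swapForm (suc i) ((a ∷ r) ∷ q)               = (a ∷ swapVec i r) ∷ swapForm i q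
swapForm _       q                           = q

-- Forms have coefficients in ℕ and weights in ℤ, and both undergo the same substitutions. These
-- involve no subtraction, so one development over a commutative semiring serves for both.
module Eval (R : CommutativeSemiring 0ℓ 0ℓ) where
  open CommutativeSemiring R renaming (Carrier to C; refl to ≈-refl; sym to ≈-sym; trans to ≈-trans)
  open import Algebra.Solver.Ring.NaturalCoefficients.Default R using (solve; _:=_; _:+_; _:*_)

  dot : ∀ {k} → Vec C k → Vec C k → C
  dot []       []       = 0#
  dot (a ∷ as) (x ∷ xs) = a * x + dot as xs

  eval : ∀ {k} → Form C k → Vec C k → C
  eval []      []       = 0#
  eval (r ∷ q) (x ∷ xs) = x * dot r (x ∷ xs) + eval q xs

  dot-zip : ∀ {k} (a b x : Vec C k) → dot (zipWith _+_ a b) x ≈ dot a x + dot b x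
  dot-zip []       []       []       = ≈-sym (+-identityˡ 0#)
  dot-zip (a ∷ as) (b ∷ bs) (x ∷ xs) = ≈-trans (+-congˡ (dot-zip as bs xs))
    (solve 5 (λ a b x s t → (a :+ b) :* x :+ (s :+ t) := (a :* x :+ s) :+ (b :* x :+ t)) ≈-refl a b x (dot as xs) (dot bs xs))

  dot-swap : ∀ {k} i (a x : Vec C k) → dot (swapVec i a) x ≈ dot a (swapVec i x)
  dot-swap zero    []           []           = ≈-refl
  dot-swap zero    (a ∷ [])     (x ∷ [])     = ≈-refl
  dot-swap zero    (a ∷ b ∷ as) (x ∷ y ∷ xs) =
    solve 5 (λ a b x y s → b :* x :+ (a :* y :+ s) := a :* y :+ (b :* x :+ s)) ≈-refl a b x y (dot as xs)
  dot-swap (suc i) []           []           = ≈-refl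
  dot-swap (suc i) (a ∷ as)     (x ∷ xs)     = +-congˡ (dot-swap i as xs)

  eval-swap : ∀ {k} i (q : Form C k) x → eval (swapForm i q) x ≈ eval q (swapVec i x)
  eval-swap zero    []                            []           = ≈-refl
  eval-swap zero    ((a ∷ []) ∷ [])                (x ∷ [])     = ≈-refl
  eval-swap zero    ((a ∷ b ∷ r) ∷ (d ∷ s) ∷ q)   (x ∷ y ∷ xs) =
    solve 8 (λ a b d x y r s q → x :* (d :* x :+ (b :* y :+ s)) :+ (y :* (a :* y :+ r) :+ q)
                              := y :* (a :* y :+ (b :* x :+ r)) :+ (x :* (d :* x :+ s) :+ q))
      ≈-refl a b d x y (dot r xs) (dot s xs) (eval q xs)
  eval-swap (suc i) []                            []           = ≈-refl
  eval-swap (suc i) ((a ∷ r) ∷ q)                 (x ∷ xs)     =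
    +-cong (*-congˡ (+-congˡ (dot-swap i r xs))) (eval-swap i q xs)

  -- q(x + y, y, …), q(x, x, …) and q(2x, …) as forms in the remaining variables.
  addForm : ∀ {k} → Form C (2 ℕ.+ k) → Form C (2 ℕ.+ k)
  addForm ((a ∷ b ∷ r) ∷ (d ∷ s) ∷ q) = (a ∷ (a + a) + b ∷ r) ∷ ((a + b) + d ∷ zipWith _+_ r s) ∷ q

  wallForm : ∀ {k} → Form C (2 ℕ.+ k) → Form C (1 ℕ.+ k)
  wallForm ((a ∷ b ∷ r) ∷ (d ∷ s) ∷ q) = ((a + b) + d ∷ zipWith _+_ r s) ∷ q

  doubleForm : ∀ {k} → Form C (1 ℕ.+ k) → Form C (1 ℕ.+ k)
  doubleForm ((a ∷ r) ∷ q) = ((a + a) + (a + a) ∷ zipWith _+_ r r) ∷ q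

  eval-add : ∀ {k} (q : Form C (2 ℕ.+ k)) x y zs → eval (addForm q) (x ∷ y ∷ zs) ≈ eval q (x + y ∷ y ∷ zs)
  eval-add ((a ∷ b ∷ r) ∷ (d ∷ s) ∷ q) x y zs = ≈-trans
    (+-congˡ (+-congʳ (*-congˡ (+-congˡ (dot-zip r s zs)))))
    (solve 8 (λ a b d x y r s q →
         x :* (a :* x :+ (((a :+ a) :+ b) :* y :+ r)) :+ (y :* (((a :+ b) :+ d) :* y :+ (r :+ s)) :+ q)
      := (x :+ y) :* (a :* (x :+ y) :+ (b :* y :+ r)) :+ (y :* (d :* y :+ s) :+ q))
      ≈-refl a b d x y (dot r zs) (dot s zs) (eval q zs))

  eval-wall : ∀ {k} (q : Form C (2 ℕ.+ k)) x zs → eval (wallForm q) (x ∷ zs) ≈ eval q (x ∷ x ∷ zs)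
  eval-wall ((a ∷ b ∷ r) ∷ (d ∷ s) ∷ q) x zs = ≈-trans
    (+-congʳ (*-congˡ (+-congˡ (dot-zip r s zs))))
    (solve 7 (λ a b d x r s q →
         x :* (((a :+ b) :+ d) :* x :+ (r :+ s)) :+ q
      := x :* (a :* x :+ (b :* x :+ r)) :+ (x :* (d :* x :+ s) :+ q))
      ≈-refl a b d x (dot r zs) (dot s zs) (eval q zs))

  eval-double : ∀ {k} (q : Form C (1 ℕ.+ k)) x zs → eval (doubleForm q) (x ∷ zs) ≈ eval q (x + x ∷ zs)
  eval-double ((a ∷ r) ∷ q) x zs = ≈-trans
    (+-congʳ (*-congˡ (+-congˡ (dot-zip r r zs))))
    (solve 4 (λ a x r q → x :* (((a :+ a) :+ (a :+ a)) :* x :+ (r :+ r)) :+ q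
                       := (x :+ x) :* (a :* (x :+ x) :+ r) :+ q)
      ≈-refl a x (dot r zs) (eval q zs))

  plusForm : ∀ {k} → Form C k → Form C k → Form C k
  plusForm []      []      = []
  plusForm (r ∷ p) (s ∷ q) = zipWith _+_ r s ∷ plusForm p q

  eval-plus : ∀ {k} (p q : Form C k) x → eval (plusForm p q) x ≈ eval p x + eval q x
  eval-plus []      []      []       = ≈-sym (+-identityˡ 0#)
  eval-plus (r ∷ p) (s ∷ q) (x ∷ xs) = ≈-trans (+-cong (*-congˡ (dot-zip r s (x ∷ xs))) (eval-plus p q xs))
    (solve 5 (λ x r s p q → x :* (r :+ s) :+ (p :+ q) := (x :* r :+ p) :+ (x :* s :+ q)) ≈-refl x (dot r (x ∷ xs)) (dot s (x ∷ xs)) (eval p xs) (eval q xs))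

  scaleForm : ∀ {k} → C → Form C k → Form C k
  scaleForm c = mapForm (c *_)

  dot-scale : ∀ {k} c (a x : Vec C k) → dot (Vec.map (c *_) a) x ≈ c * dot a x
  dot-scale c []       []       = ≈-sym (zeroʳ c)
  dot-scale c (a ∷ as) (x ∷ xs) = ≈-trans (+-congˡ (dot-scale c as xs))
    (solve 4 (λ c a x s → (c :* a) :* x :+ c :* s := c :* (a :* x :+ s)) ≈-refl c a x (dot as xs))

  eval-scale : ∀ {k} c (q : Form C k) x → eval (scaleForm c q) x ≈ c * eval q x
  eval-scale c []      []       = ≈-sym (zeroʳ c)
  eval-scale c (r ∷ q) (x ∷ xs) = ≈-trans (+-cong (*-congˡ (dot-scale c r (x ∷ xs))) (eval-scale c q xs))
    (solve 4 (λ c x r q → x :* (c :* r) :+ c :* q := c :* (x :* r :+ q)) ≈-refl c x (dot r (x ∷ xs)) (eval q xs))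

open import Data.Integer as ℤ using (ℤ; +_; -[1+_]; _+_; _*_; -_; _-_; 0ℤ; 1ℤ; ∣_∣)
import Data.Integer.Properties as ℤ
import Data.Integer.DivMod as ℤ
open import Data.Integer.Tactic.RingSolver using (solve-∀)

-- Finite sums

∧ˡ : ∀ a {b} → a ∧ b ≡ true → a ≡ true
∧ˡ true _ = refl

∧ʳ : ∀ a {b} → a ∧ b ≡ true → b ≡ true
∧ʳ true h = h

-- Indices start at 1, since the counted solutions are positive; the contribution of 0 is added
-- separately in `S`.
sumTo : ℕ → (ℕ → ℤ) → ℤ
sumTo zero    f = 0ℤ
sumTo (suc n) f = sumTo n f + f (suc n)

sumTo-cong : ∀ n {f g} → (∀ i → f (suc i) ≡ g (suc i)) → sumTo n f ≡ sumTo n g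
sumTo-cong zero    h = refl
sumTo-cong (suc n) h = cong₂ _+_ (sumTo-cong n h) (h n)

sumTo-0 : ∀ n → sumTo n (λ _ → 0ℤ) ≡ 0ℤ
sumTo-0 zero    = refl
sumTo-0 (suc n) = cong (_+ 0ℤ) (sumTo-0 n)

sumTo-zero : ∀ n {f} → (∀ i → f (suc i) ≡ 0ℤ) → sumTo n f ≡ 0ℤ
sumTo-zero n h = trans (sumTo-cong n h) (sumTo-0 n)

interchange : ∀ a b c d → (a + b) + (c + d) ≡ (a + c) + (b + d)
interchange = solve-∀

sumTo-+ : ∀ n f g → sumTo n (λ i → f i + g i) ≡ sumTo n f + sumTo n g
sumTo-+ zero    f g = refl
sumTo-+ (suc n) f g = trans (cong (_+ (f (suc n) + g (suc n))) (sumTo-+ n f g)) (interchange (sumTo n f) (sumTo n g) (f (suc n)) (g (suc n)))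

sumTo-* : ∀ n c f → sumTo n (λ i → c * f i) ≡ c * sumTo n f
sumTo-* zero    c f = sym (ℤ.*-zeroʳ c)
sumTo-* (suc n) c f = trans (cong (_+ c * f (suc n)) (sumTo-* n c f)) (sym (ℤ.*-distribˡ-+ c (sumTo n f) (f (suc n))))

sumTo-swap : ∀ m n (F : ℕ → ℕ → ℤ) → sumTo m (λ a → sumTo n (F a)) ≡ sumTo n (λ b → sumTo m (λ a → F a b))
sumTo-swap zero    n F = sym (sumTo-0 n)
sumTo-swap (suc m) n F = trans (cong (_+ sumTo n (F (suc m))) (sumTo-swap m n F)) (sym (sumTo-+ n (λ b → sumTo m (λ a → F a b)) (F (suc m))))

sumTo-shift : ∀ m n f → sumTo (m ℕ.+ n) f ≡ sumTo m f + sumTo n (λ i → f (m ℕ.+ i))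
sumTo-shift m zero    f rewrite ℕ.+-identityʳ m = sym (ℤ.+-identityʳ _)
sumTo-shift m (suc n) f rewrite ℕ.+-suc m n =
  trans (cong (_+ f (suc (m ℕ.+ n))) (sumTo-shift m n f)) (ℤ.+-assoc (sumTo m f) _ _)

sumTo-beyond : ∀ n m f → (∀ i → n ℕ.< i → f i ≡ 0ℤ) → sumTo (n ℕ.+ m) f ≡ sumTo n f
sumTo-beyond n m f h = trans (sumTo-shift n m f)
  (trans (cong (_+_ (sumTo n f)) (sumTo-zero m (λ i → h _ (ℕ.m<m+n n (s≤s z≤n))))) (ℤ.+-identityʳ _))

-- As `f` vanishes beyond `n`, the range may be lengthened to n + a and cut at `a`. The tail keeps
-- the full length `n`, so the range of summation never depends on `a`.
sumTo-from : ∀ n a f → (∀ i → n ℕ.< i → f i ≡ 0ℤ) → sumTo n f ≡ sumTo a f + sumTo n (λ i → f (a ℕ.+ i))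
sumTo-from n a f h = trans (sym (sumTo-beyond n a f h)) (trans (cong (λ k → sumTo k f) (ℕ.+-comm n a)) (sumTo-shift a n f))

sum² : ℕ → (ℕ → ℕ → ℤ) → ℤ
sum² n F = sumTo n (λ a → sumTo n (F a))

triangles : ∀ n F → sumTo n (λ a → sumTo a (F a)) + sumTo n (λ b → sumTo b (λ a → F a b))
                  ≡ sum² n F + sumTo n (λ a → F a a)
triangles zero    F = refl
triangles (suc n) F = begin
  (U + (R + d)) + (L + (C + d))                    ≡⟨ shuffle₁ U R d L C ⟩
  ((U + L) + C) + ((R + d) + d)                    ≡⟨ cong (λ z → (z + C) + ((R + d) + d)) (triangles n F) ⟩
  ((sum² n F + D) + C) + ((R + d) + d)             ≡⟨ shuffle₂ (sum² n F) D C R d ⟩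
  ((sum² n F + C) + (R + d)) + (D + d)             ≡⟨ cong (λ z → (z + (R + d)) + (D + d)) (sym (sumTo-+ n (λ a → sumTo n (F a)) (λ a → F a (suc n)))) ⟩
  (sumTo n (λ a → sumTo (suc n) (F a)) + (R + d)) + (D + d) ∎
  where
  open ≡-Reasoning
  U = sumTo n (λ a → sumTo a (F a))
  L = sumTo n (λ b → sumTo b (λ a → F a b))
  R = sumTo n (F (suc n))
  C = sumTo n (λ a → F a (suc n))
  D = sumTo n (λ a → F a a)
  d = F (suc n) (suc n)
  shuffle₁ : ∀ U R d L C → (U + (R + d)) + (L + (C + d)) ≡ ((U + L) + C) + ((R + d) + d)
  shuffle₁ = solve-∀
  shuffle₂ : ∀ S D C R d → ((S + D) + C) + ((R + d) + d) ≡ ((S + C) + (R + d)) + (D + d)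
  shuffle₂ = solve-∀

-- Cutting every row at the diagonal gives T = U + B, cutting every column there gives T = L + A,
-- where U and L are the two closed triangles. By `triangles` U + L = T + D, so the sum of the two
-- equations is 2T = T + (A + (B + D)), and T cancels. The vanishing hypotheses allow both shifted
-- sums to run over the full square.
sum²-split : ∀ n F → (∀ a b → n ℕ.< a → F a (suc b) ≡ 0ℤ) → (∀ a b → n ℕ.< b → F (suc a) b ≡ 0ℤ) →
  sum² n F ≡ sum² n (λ a b → F (a ℕ.+ b) b) + (sum² n (λ a b → F a (b ℕ.+ a)) + sumTo n (λ a → F a a))
sum²-split n F va vb = finish T _ _ U L _ byRow byCol (triangles n F)
  where
  T = sum² n F
  U = sumTo n (λ a → sumTo a (F a))
  L = sumTo n (λ b → sumTo b (λ a → F a b))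
  byRow : T ≡ U + sum² n (λ a b → F a (b ℕ.+ a))
  byRow = trans
    (sumTo-cong n (λ a → trans (sumTo-from n (suc a) (F (suc a)) (λ b → vb a b))
       (cong (_+_ (sumTo (suc a) (F (suc a)))) (sumTo-cong n (λ b → cong (F (suc a)) (ℕ.+-comm (suc a) (suc b)))))))
    (sumTo-+ n _ _)
  byCol : T ≡ L + sum² n (λ a b → F (a ℕ.+ b) b)
  byCol = begin
    T ≡⟨ sumTo-swap n n F ⟩
    sumTo n (λ b → sumTo n (λ a → F a b)) ≡⟨ sumTo-cong n (λ b → trans (sumTo-from n (suc b) (λ a → F a (suc b)) (λ a → va a b))
       (cong (_+_ (sumTo (suc b) (λ a → F a (suc b)))) (sumTo-cong n (λ a → cong (λ z → F z (suc b)) (ℕ.+-comm (suc b) (suc a)))))) ⟩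
    sumTo n (λ b → sumTo b (λ a → F a b) + sumTo n (λ a → F (a ℕ.+ b) b)) ≡⟨ sumTo-+ n _ _ ⟩
    L + sumTo n (λ b → sumTo n (λ a → F (a ℕ.+ b) b)) ≡⟨ cong (_+_ L) (sumTo-swap n n (λ b a → F (a ℕ.+ b) b)) ⟩
    L + sum² n (λ a b → F (a ℕ.+ b) b) ∎
    where open ≡-Reasoning
  finish : ∀ T A B U L D → T ≡ U + B → T ≡ L + A → U + L ≡ T + D → T ≡ A + (B + D)
  finish T A B U L D p q r = cancel (begin
    T + T ≡⟨ cong₂ _+_ p q ⟩
    (U + B) + (L + A) ≡⟨ e₁ U B L A ⟩
    (U + L) + (A + B) ≡⟨ cong (_+ (A + B)) r ⟩
    (T + D) + (A + B) ≡⟨ e₂ T D A B ⟩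
    T + (A + (B + D)) ∎)
    where
    open ≡-Reasoning
    cancel : ∀ {X Y} → T + X ≡ T + Y → X ≡ Y
    cancel {X} {Y} eq = trans (e₀ T X) (trans (cong (_+_ (- T)) eq) (sym (e₀ T Y)))
      where
      e₀ : ∀ T X → X ≡ - T + (T + X)
      e₀ = solve-∀
    e₁ : ∀ U B L A → (U + B) + (L + A) ≡ (U + L) + (A + B)
    e₁ = solve-∀
    e₂ : ∀ T D A B → (T + D) + (A + B) ≡ T + (A + (B + D))
    e₂ = solve-∀

odd : ℕ → Bool
odd zero    = false
odd (suc n) = not (odd n)

odd-+ : ∀ m n → odd (m ℕ.+ n) ≡ odd m xor odd n
odd-+ zero    n = refl
odd-+ (suc m) n rewrite odd-+ m n with odd m
... | true  = notnot (odd n)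
  where
  notnot : ∀ b → not (not b) ≡ b
  notnot true  = refl
  notnot false = refl
... | false = refl

xor-self : ∀ b → b xor b ≡ false
xor-self true  = refl
xor-self false = refl

odd-%8 : ∀ n → odd n ≡ odd (n ℕ.% 8)
odd-%8 n = trans (cong odd (ℕ.m≡m%n+[m/n]*n n 8)) (trans (odd-+ (n ℕ.% 8) (n ℕ./ 8 ℕ.* 8)) (trans (cong (odd (n ℕ.% 8) xor_) (odd-*8 (n ℕ./ 8))) (Bool.xor-identityʳ _)))
  where
  odd-*8 : ∀ n → odd (n ℕ.* 8) ≡ false
  odd-*8 zero    = refl
  odd-*8 (suc n) = trans (notnot₈ (odd (n ℕ.* 8))) (odd-*8 n)
    where
    notnot₈ : ∀ b → not (not (not (not (not (not (not (not b))))))) ≡ b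
    notnot₈ true  = refl
    notnot₈ false = refl

par : Bool → ℕ → ℤ
par b n = if b xor odd n then 0ℤ else 1ℤ

δ : ℕ → ℕ → ℤ
δ m n = ⟦ m ℕ.≟ n ⟧?
  where
  ⟦_⟧? : ∀ {A : Set} → Dec A → ℤ
  ⟦ yes _ ⟧? = 1ℤ
  ⟦ no  _ ⟧? = 0ℤ

δ-≢ : ∀ {m n} → m ≢ n → δ m n ≡ 0ℤ
δ-≢ {m} {n} m≢n with m ℕ.≟ n
... | yes m≡n = ⊥-elim (m≢n m≡n)
... | no _    = refl

δ-refl : ∀ n → δ n n ≡ 1ℤ
δ-refl n with n ℕ.≟ n
... | yes _   = refl
... | no n≢n = ⊥-elim (n≢n refl)

-- On the right 2i runs up to 2n; the left side is first extended to 2n, which only adds zeros, and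
-- then an induction pairs each even index with the odd one before it.
sumTo-even : ∀ n (f : ℕ → ℤ) → (∀ i → n ℕ.< i → f i ≡ 0ℤ) →
  sumTo n (λ i → par false i * f i) ≡ sumTo n (λ i → f (i ℕ.+ i))
sumTo-even n f h = trans (sym (sumTo-beyond n n _ (λ i n<i → trans (cong (_*_ (par false i)) (h i n<i)) (ℤ.*-zeroʳ (par false i))))) (go n)
  where
  go : ∀ m → sumTo (m ℕ.+ m) (λ i → par false i * f i) ≡ sumTo m (λ i → f (i ℕ.+ i))
  go zero    = refl
  go (suc m) rewrite ℕ.+-suc m m | odd-+ m m | xor-self (odd m) =
    trans (e (sumTo (m ℕ.+ m) (λ i → par false i * f i)) (f (2 ℕ.+ (m ℕ.+ m)))) (cong (_+ f (2 ℕ.+ (m ℕ.+ m))) (go m))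
    where
    e : ∀ x y → x + 0ℤ + 1ℤ * y ≡ x + y
    e = solve-∀

-- Linear relations between weighted counts

module N = Eval ℕ.+-*-commutativeSemiring
module Z = Eval ℤ.+-*-commutativeSemiring

Pos : ∀ {k} → Vec ℕ k → Set
Pos = All (1 ℕ.≤_)

sumVec : ℕ → (k : ℕ) → (Vec ℕ k → ℤ) → ℤ
sumVec B zero    f = f []
sumVec B (suc k) f = sumTo B (λ x → sumVec B k (λ xs → f (x ∷ xs)))

sumVec-cong : ∀ B k {f g} → (∀ xs → Pos xs → f xs ≡ g xs) → sumVec B k f ≡ sumVec B k g
sumVec-cong B zero    h = h [] []
sumVec-cong B (suc k) h = sumTo-cong B (λ i → sumVec-cong B k (λ xs p → h (suc i ∷ xs) (s≤s z≤n ∷ p)))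

sumVec-zero : ∀ B k {f} → (∀ xs → Pos xs → f xs ≡ 0ℤ) → sumVec B k f ≡ 0ℤ
sumVec-zero B zero    h = h [] []
sumVec-zero B (suc k) h = sumTo-zero B (λ i → sumVec-zero B k (λ xs p → h (suc i ∷ xs) (s≤s z≤n ∷ p)))

sumVec-+ : ∀ B k (f g : Vec ℕ k → ℤ) → sumVec B k (λ x → f x + g x) ≡ sumVec B k f + sumVec B k g
sumVec-+ B zero    f g = refl
sumVec-+ B (suc k) f g = trans (sumTo-cong B (λ i → sumVec-+ B k _ _)) (sumTo-+ B _ _)

sumVec-* : ∀ B k c (f : Vec ℕ k → ℤ) → sumVec B k (λ x → c * f x) ≡ c * sumVec B k f
sumVec-* B zero    c f = refl
sumVec-* B (suc k) c f = trans (sumTo-cong B (λ i → sumVec-* B k c _)) (sumTo-* B c _)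

sumVec-swap : ∀ B {k} i (f : Vec ℕ k → ℤ) → sumVec B k (λ x → f (swapVec i x)) ≡ sumVec B k f
sumVec-swap B {zero}        zero    f = refl
sumVec-swap B {suc zero}    zero    f = refl
sumVec-swap B {suc (suc k)} zero    f = sumTo-swap B B _
sumVec-swap B {zero}        (suc i) f = refl
sumVec-swap B {suc k}       (suc i) f = sumTo-cong B (λ a → sumVec-swap B i (λ xs → f (suc a ∷ xs)))

-- A term stands for the sum of constant + weight(x) over the positive x with form(x) = V and x ≡ parity (mod 2), for a fixed V.
record Term (k : ℕ) : Set where
  constructor term
  field
    form     : Form ℕ k
    parity   : Vec Bool k
    constant : ℤ
    weight   : Form ℤ k

open Term

pars : ∀ {k} → Vec Bool k → Vec ℕ k → ℤ
pars []       []       = 1ℤ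
pars (b ∷ bs) (x ∷ xs) = par b x * pars bs xs

weigh : ∀ {k} → Term k → Vec ℕ k → ℤ
weigh t x = constant t + Z.eval (weight t) (Vec.map +_ x)

-- Linear relations between terms that hold for every V of a given class modulo 8:
--   bisection    splits the range by x₀ > x₁, x₀ < x₁ or x₀ = x₁ and substitutes x₀ − x₁ (x₁ − x₀) for the larger variable;
--   halving      substitutes x₀ = 2y for even x₀;
--   obstruction  says that the form does not take the value V for reasons of congruence modulo 8;
--   permutation  renames the variables.
-- The lists are adjacent transpositions applied to the terms, so that equal terms meet in the same shape.
data Relation : Set where
  bisection : ∀ {k} → Term (2 ℕ.+ k) → (s₀ s₁ s₂ s₃ : List ℕ) → Relation
  halving : ∀ {k} → Term (1 ℕ.+ k) → (s₀ s₁ s₂ : List ℕ) → Relation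
  obstruction : ∀ {k} → Term k → Relation
  permutation : ∀ {k} → Term k → List ℕ → Relation

swapT : ∀ {k} → ℕ → Term k → Term k
swapT i (term q p c w) = term (swapForm i q) (swapVec i p) c (swapForm i w)

swapsT : ∀ {k} → List ℕ → Term k → Term k
swapsT []       t = t
swapsT (i ∷ is) t = swapsT is (swapT i t)

negT : ∀ {k} → Term k → Term k
negT (term q p c w) = term q p (- c) (Z.scaleForm (- 1ℤ) w)

addT : ∀ {k} → Term (2 ℕ.+ k) → Term (2 ℕ.+ k)
addT (term q (a ∷ b ∷ p) c w) = term (N.addForm q) ((a xor b) ∷ b ∷ p) c (Z.addForm w)

-- When the parities of the two merged variables differ there is nothing to count; the term then
-- stays in the list with constant and weight multiplied by 0.
wallT : ∀ {k} → Term (2 ℕ.+ k) → Term (1 ℕ.+ k)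
wallT (term q (a ∷ b ∷ p) c w) = let e = if a xor b then 0ℤ else 1ℤ in
  term (N.wallForm q) (a ∷ p) (e * c) (Z.scaleForm e (Z.wallForm w))

-- The Boolean is the parity of the half. Every variable of a term carries a parity, so `halving`
-- produces one term for each value.
doubleT : ∀ {k} → Bool → Term (1 ℕ.+ k) → Term (1 ℕ.+ k)
doubleT b (term q (_ ∷ p) c w) = term (N.doubleForm q) (b ∷ p) c (Z.doubleForm w)

-- A nonzero coefficient in the first row makes the form at least x₀ on positive vectors (`eval-≥`).
-- Hence no solution has x₀ > B, and substitutions that enlarge x₀ do not leave the summation box
-- with anything but zeros.
positive : ∀ {k} → Vec ℕ k → Bool
positive []           = false
positive (zero ∷ r)   = positive r
positive (suc a ∷ r)  = true

firstRow : ∀ {A : Set} {k} → Form A (suc k) → Vec A (suc k)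
firstRow (r ∷ q) = r

evens odds : List ℕ
evens = 0 ∷ 2 ∷ 4 ∷ 6 ∷ []
odds  = 1 ∷ 3 ∷ 5 ∷ 7 ∷ []

allResidues : ∀ {k} → Vec Bool k → (Vec ℕ k → Bool) → Bool
allResidues []       f = f []
allResidues (b ∷ bs) f = List.foldr _∧_ true (List.map (λ x → allResidues bs (λ xs → f (x ∷ xs))) (if b then odds else evens))

unattained : ∀ {k} → ℕ → Term k → Bool
unattained v t = allResidues (parity t) (λ x → not (N.eval (form t) x ℕ.% 8 ℕ.≡ᵇ v))

Terms : Set
Terms = List (Σ ℕ Term)

[_]T : ∀ {k} → Term k → Σ ℕ Term
[ t ]T = _ , t

-- The combination that the relation asserts to vanish for V ≡ v (mod 8), or the empty one if its side condition fails.
expand : ℕ → Relation → Terms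
expand v (bisection t s₀ s₁ s₂ s₃) =
  if positive (firstRow (form t)) ∧ positive (firstRow (swapForm 0 (form t)))
  then [ swapsT s₀ t ]T ∷ [ negT (swapsT s₁ (addT t)) ]T ∷ [ negT (swapsT s₂ (addT (swapT 0 t))) ]T ∷ [ negT (swapsT s₃ (wallT t)) ]T ∷ []
  else []
expand v (halving t s₀ s₁ s₂) with parity t
... | true ∷ _ = []
... | false ∷ _ =
  if positive (firstRow (form t))
  then [ swapsT s₀ t ]T ∷ [ negT (swapsT s₁ (doubleT true t)) ]T ∷ [ negT (swapsT s₂ (doubleT false t)) ]T ∷ []
  else []
expand v (obstruction t) = if unattained v t then [ t ]T ∷ [] else []
expand v (permutation t s) = [ t ]T ∷ [ negT (swapsT s t) ]T ∷ []

_≟F_ : ∀ {k} (p q : Form ℕ k) → Dec (p ≡ q)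
[]      ≟F []      = yes refl
(r ∷ p) ≟F (s ∷ q) with Vec.≡-dec ℕ._≟_ r s
... | no r≢s = no λ { refl → r≢s refl }
... | yes refl with p ≟F q
...   | yes refl = yes refl
...   | no p≢q   = no λ { refl → p≢q refl }

insert : ∀ {k} → Term k → Terms → Terms
insert t [] = [ t ]T ∷ []
insert {k} t ((l , u) ∷ us) with k ℕ.≟ l
... | no _ = (l , u) ∷ insert t us
... | yes refl with form t ≟F form u | Vec.≡-dec Bool._≟_ (parity t) (parity u)
...   | yes _ | yes _ = (k , term (form u) (parity u) (constant t + constant u) (Z.plusForm (weight t) (weight u))) ∷ us
...   | yes _ | no _  = (k , u) ∷ insert t us
...   | no _  | _     = (k , u) ∷ insert t us

collect : Terms → Terms → Terms
collect []             acc = acc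
collect ((_ , t) ∷ ts) acc = collect ts (insert t acc)

collectAll : ℕ → List Relation → Terms → Terms
collectAll v []       acc = acc
collectAll v (r ∷ rs) acc = collectAll v rs (collect (expand v r) acc)

zeroℤ : ℤ → Bool
zeroℤ (+ 0) = true
zeroℤ _     = false

zeroRow : ∀ {k} → Vec ℤ k → Bool
zeroRow []      = true
zeroRow (a ∷ r) = zeroℤ a ∧ zeroRow r

zeroForm : ∀ {k} → Form ℤ k → Bool
zeroForm []      = true
zeroForm (r ∷ q) = zeroRow r ∧ zeroForm q

vanishing : Terms → Bool
vanishing []             = true
vanishing ((_ , t) ∷ ts) = zeroℤ (constant t) ∧ (zeroForm (weight t) ∧ vanishing ts)

-- The multipliers found for the relations are built into their weights, with signs such that target
-- plus relations collects to zero formally. As each relation has value 0, so has the target.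
check : ℕ → Terms → List Relation → Bool
check v ts rs = vanishing (collectAll v rs (collect ts []))

-- Soundness of the certificate checker.

module Value (B V : ℕ) where

  value : ∀ {k} → Term k → Vec ℕ k → ℤ
  value t x = δ (N.eval (form t) x) V * (pars (parity t) x * weigh t x)

  -- The sum is finite: positivity of the form confines its solutions to x ≤ V ≤ B.
  ⟦_⟧ : ∀ {k} → Term k → ℤ
  ⟦_⟧ {k} t = sumVec B k (value t)

  ⟦_⟧* : Terms → ℤ
  ⟦ [] ⟧*           = 0ℤ
  ⟦ (_ , t) ∷ ts ⟧* = ⟦ t ⟧ + ⟦ ts ⟧*

  pars-swap : ∀ {k} i (p : Vec Bool k) x → pars (swapVec i p) x ≡ pars p (swapVec i x)
  pars-swap zero    []           []           = refl
  pars-swap zero    (a ∷ [])     (x ∷ [])     = refl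
  pars-swap zero    (a ∷ b ∷ p)  (x ∷ y ∷ xs) = e (par b x) (par a y) (pars p xs)
    where
    e : ∀ x y p → x * (y * p) ≡ y * (x * p)
    e = solve-∀
  pars-swap (suc i) []           []           = refl
  pars-swap (suc i) (a ∷ p)      (x ∷ xs)     = cong (_*_ (par a x)) (pars-swap i p xs)

  map-swap : ∀ {k} i (x : Vec ℕ k) → Vec.map +_ (swapVec i x) ≡ swapVec i (Vec.map +_ x)
  map-swap zero    []           = refl
  map-swap zero    (x ∷ [])     = refl
  map-swap zero    (x ∷ y ∷ xs) = refl
  map-swap (suc i) []           = refl
  map-swap (suc i) (x ∷ xs)     = cong (+ x ∷_) (map-swap i xs)

  value-cong : ∀ {n n' p p' w w'} → n ≡ n' → p ≡ p' → w ≡ w' → δ n V * (p * w) ≡ δ n' V * (p' * w')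
  value-cong refl refl refl = refl

  ⟦swapT⟧ : ∀ {k} i (t : Term k) → ⟦ swapT i t ⟧ ≡ ⟦ t ⟧
  ⟦swapT⟧ {k} i t@(term q p c w) = trans
    (sumVec-cong B k (λ x _ → value-cong (N.eval-swap i q x) (pars-swap i p x)
      (cong (_+_ c) (trans (Z.eval-swap i w (Vec.map +_ x)) (cong (Z.eval w) (sym (map-swap i x)))))))
    (sumVec-swap B i (value t))

  ⟦swapsT⟧ : ∀ {k} is (t : Term k) → ⟦ swapsT is t ⟧ ≡ ⟦ t ⟧
  ⟦swapsT⟧ []       t = refl
  ⟦swapsT⟧ (i ∷ is) t = trans (⟦swapsT⟧ is (swapT i t)) (⟦swapT⟧ i t)

  ⟦negT⟧ : ∀ {k} (t : Term k) → ⟦ negT t ⟧ ≡ - 1ℤ * ⟦ t ⟧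
  ⟦negT⟧ {k} (term q p c w) = trans
    (sumVec-cong B k (λ x _ → trans (value-cong {n = N.eval q x} {p = pars p x} refl refl (cong (_+_ (- c)) (Z.eval-scale (- 1ℤ) w (Vec.map +_ x))))
                       (e (δ (N.eval q x) V) (pars p x) c (Z.eval w (Vec.map +_ x)))))
    (sumVec-* B k (- 1ℤ) _)
    where
    e : ∀ d p c w → d * (p * (- c + - 1ℤ * w)) ≡ - 1ℤ * (d * (p * (c + w)))
    e = solve-∀

  ⟦negT-swapsT⟧ : ∀ {k} s (t : Term k) → ⟦ negT (swapsT s t) ⟧ ≡ - 1ℤ * ⟦ t ⟧
  ⟦negT-swapsT⟧ s t = trans (⟦negT⟧ (swapsT s t)) (cong (_*_ (- 1ℤ)) (⟦swapsT⟧ s t))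

  module _ (V≤B : V ℕ.≤ B) where

    dot-pos : ∀ {k} (r x : Vec ℕ k) → positive r ≡ true → Pos x → 1 ℕ.≤ N.dot r x
    dot-pos (zero ∷ r)  (x ∷ xs) h (_ ∷ ps) = dot-pos r xs h ps
    dot-pos (suc a ∷ r) (x ∷ xs) h (p ∷ ps) = ℕ.≤-trans p (ℕ.≤-trans (ℕ.m≤m+n x _) (ℕ.m≤m+n (x ℕ.+ a ℕ.* x) _))

    eval-≥ : ∀ {k} (q : Form ℕ (suc k)) x xs → positive (firstRow q) ≡ true → Pos (x ∷ xs) → x ℕ.≤ N.eval q (x ∷ xs)
    eval-≥ (r ∷ q) x xs h ps = ℕ.≤-trans
      (subst (ℕ._≤ x ℕ.* N.dot r (x ∷ xs)) (ℕ.*-identityʳ x) (ℕ.*-monoʳ-≤ x (dot-pos r (x ∷ xs) h ps)))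
      (ℕ.m≤m+n _ _)

    value-beyond : ∀ {k} (t : Term (suc k)) x xs → positive (firstRow (form t)) ≡ true → Pos (x ∷ xs) → B ℕ.< x → value t (x ∷ xs) ≡ 0ℤ
    value-beyond t x xs h ps B<x = cong (_* (pars (parity t) (x ∷ xs) * weigh t (x ∷ xs)))
      (δ-≢ (λ eq → ℕ.<⇒≱ B<x (ℕ.≤-trans (eval-≥ (form t) x xs h ps) (subst (ℕ._≤ B) (sym eq) V≤B))))

    par-+ : ∀ a b x y → par a (x ℕ.+ y) * par b y ≡ par (a xor b) x * par b y
    par-+ a b x y rewrite odd-+ x y with a | b | odd x | odd y
    ... | true  | true  | true  | true  = refl
    ... | true  | true  | true  | false = refl
    ... | true  | true  | false | true  = refl
    ... | true  | true  | false | false = refl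
    ... | true  | false | true  | true  = refl
    ... | true  | false | true  | false = refl
    ... | true  | false | false | true  = refl
    ... | true  | false | false | false = refl
    ... | false | true  | true  | true  = refl
    ... | false | true  | true  | false = refl
    ... | false | true  | false | true  = refl
    ... | false | true  | false | false = refl
    ... | false | false | true  | true  = refl
    ... | false | false | true  | false = refl
    ... | false | false | false | true  = refl
    ... | false | false | false | false = refl

    value-addT : ∀ {k} (t : Term (2 ℕ.+ k)) x y zs → value (addT t) (x ∷ y ∷ zs) ≡ value t (x ℕ.+ y ∷ y ∷ zs)
    value-addT (term q (a ∷ b ∷ p) c w) x y zs = value-cong (N.eval-add q x y zs)
      (trans (sym (ℤ.*-assoc (par (a xor b) x) (par b y) (pars p zs))) (trans (cong (_* pars p zs) (sym (par-+ a b x y))) (ℤ.*-assoc (par a (x ℕ.+ y)) (par b y) (pars p zs))))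
      (cong (_+_ c) (Z.eval-add w (+ x) (+ y) (Vec.map +_ zs)))

    par-wall : ∀ a b x → par a x * par b x ≡ (if a xor b then 0ℤ else 1ℤ) * par a x
    par-wall a b x with a | b | odd x
    ... | true  | true  | true  = refl
    ... | true  | true  | false = refl
    ... | true  | false | true  = refl
    ... | true  | false | false = refl
    ... | false | true  | true  = refl
    ... | false | true  | false = refl
    ... | false | false | true  = refl
    ... | false | false | false = refl

    value-wallT : ∀ {k} (t : Term (2 ℕ.+ k)) x zs → value (wallT t) (x ∷ zs) ≡ value t (x ∷ x ∷ zs)
    value-wallT (term q (a ∷ b ∷ p) c w) x zs = trans
      (value-cong {p = par a x * pars p zs} (N.eval-wall q x zs) refl (cong (_+_ (e * c)) (trans (Z.eval-scale e (Z.wallForm w) (+ x ∷ Vec.map +_ zs)) (cong (_*_ e) (Z.eval-wall w (+ x) (Vec.map +_ zs))))))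
      (trans (rearrange (δ (N.eval q (x ∷ x ∷ zs)) V) e (par a x) (pars p zs) c (Z.eval w (+ x ∷ + x ∷ Vec.map +_ zs)))
      (trans (cong (λ z → δ (N.eval q (x ∷ x ∷ zs)) V * ((z * pars p zs) * (c + Z.eval w (+ x ∷ + x ∷ Vec.map +_ zs)))) (sym (par-wall a b x)))
             (cong (λ z → δ (N.eval q (x ∷ x ∷ zs)) V * (z * (c + Z.eval w (+ x ∷ + x ∷ Vec.map +_ zs)))) (ℤ.*-assoc (par a x) (par b x) (pars p zs)))))
      where
      e = if a xor b then 0ℤ else 1ℤ
      rearrange : ∀ d e s p c w → d * ((s * p) * (e * c + e * w)) ≡ d * (((e * s) * p) * (c + w))
      rearrange = solve-∀

    value-swap₀ : ∀ {k} (t : Term (2 ℕ.+ k)) x y zs → value (swapT 0 t) (x ∷ y ∷ zs) ≡ value t (y ∷ x ∷ zs)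
    value-swap₀ (term q p c w) x y zs = value-cong (N.eval-swap 0 q (x ∷ y ∷ zs)) (pars-swap 0 p (x ∷ y ∷ zs))
      (cong (_+_ c) (Z.eval-swap 0 w (Vec.map +_ (x ∷ y ∷ zs))))

    -- Each of the first two variables is in turn the larger one and exceeds B after the
    -- substitution, so positivity is required of both of their rows.
    ⟦split⟧ : ∀ {k} (t : Term (2 ℕ.+ k)) → positive (firstRow (form t)) ≡ true → positive (firstRow (swapForm 0 (form t))) ≡ true →
      ⟦ t ⟧ ≡ ⟦ addT t ⟧ + (⟦ addT (swapT 0 t) ⟧ + ⟦ wallT t ⟧)
    ⟦split⟧ {k} t h₀ h₁ = trans (sum²-split B F va vb) (cong₂ _+_ eq₁ (cong₂ _+_ eq₂ eq₃))
      where
      F : ℕ → ℕ → ℤ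
      F a b = sumVec B k (λ zs → value t (a ∷ b ∷ zs))
      va : ∀ a b → B ℕ.< a → F a (suc b) ≡ 0ℤ
      va a b B<a = sumVec-zero B k (λ zs ps → value-beyond t a (suc b ∷ zs) h₀ (ℕ.≤-trans (s≤s z≤n) B<a ∷ s≤s z≤n ∷ ps) B<a)
      vb : ∀ a b → B ℕ.< b → F (suc a) b ≡ 0ℤ
      vb a b B<b = sumVec-zero B k (λ zs ps → trans (sym (value-swap₀ t b (suc a) zs))
        (value-beyond (swapT 0 t) b (suc a ∷ zs) h₁ (ℕ.≤-trans (s≤s z≤n) B<b ∷ s≤s z≤n ∷ ps) B<b))
      eq₁ : sum² B (λ a b → F (a ℕ.+ b) b) ≡ ⟦ addT t ⟧
      eq₁ = sumTo-cong B (λ a → sumTo-cong B (λ b → sumVec-cong B k (λ zs _ → sym (value-addT t (suc a) (suc b) zs))))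
      eq₂ : sum² B (λ a b → F a (b ℕ.+ a)) ≡ ⟦ addT (swapT 0 t) ⟧
      eq₂ = trans (sumTo-swap B B (λ a b → F a (b ℕ.+ a)))
        (sumTo-cong B (λ b → sumTo-cong B (λ a → sumVec-cong B k (λ zs _ →
          sym (trans (value-addT (swapT 0 t) (suc b) (suc a) zs) (value-swap₀ t (suc b ℕ.+ suc a) (suc a) zs))))))
      eq₃ : sumTo B (λ a → F a a) ≡ ⟦ wallT t ⟧
      eq₃ = sumTo-cong B (λ a → sumVec-cong B k (λ zs _ → sym (value-wallT t (suc a) zs)))

    ⟦halve⟧ : ∀ {k} q p c w → positive (firstRow q) ≡ true →
      let t = term {1 ℕ.+ k} q (false ∷ p) c w in ⟦ t ⟧ ≡ ⟦ doubleT true t ⟧ + ⟦ doubleT false t ⟧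
    ⟦halve⟧ {k} q p c w h = begin
      ⟦ t ⟧ ≡⟨ sumTo-cong B (λ x → trans (sumVec-cong B k (λ xs _ → e₁ (δ (N.eval q (suc x ∷ xs)) V) (par false (suc x)) (pars p xs) (weigh t (suc x ∷ xs)))) (sumVec-* B k (par false (suc x)) _)) ⟩
      sumTo B (λ x → par false x * G x) ≡⟨ sumTo-even B G (λ x B<x → sumVec-zero B k (λ xs ps → beyond x xs B<x ps)) ⟩
      sumTo B (λ x → G (x ℕ.+ x)) ≡⟨ sumTo-cong B (λ x → trans (sumVec-cong B k (λ xs _ → pointwise (suc x) xs)) (sumVec-+ B k _ _)) ⟩
      sumTo B (λ x → sumVec B k (λ xs → value (doubleT true t) (x ∷ xs)) + sumVec B k (λ xs → value (doubleT false t) (x ∷ xs))) ≡⟨ sumTo-+ B _ _ ⟩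
      ⟦ doubleT true t ⟧ + ⟦ doubleT false t ⟧ ∎
      where
      open ≡-Reasoning
      t = term q (false ∷ p) c w
      G : ℕ → ℤ
      G x = sumVec B k (λ xs → δ (N.eval q (x ∷ xs)) V * (pars p xs * weigh t (x ∷ xs)))
      e₁ : ∀ d s p w → d * ((s * p) * w) ≡ s * (d * (p * w))
      e₁ = solve-∀
      beyond : ∀ x xs → B ℕ.< x → Pos xs → δ (N.eval q (x ∷ xs)) V * (pars p xs * weigh t (x ∷ xs)) ≡ 0ℤ
      beyond x xs B<x ps = cong (_* (pars p xs * weigh t (x ∷ xs)))
        (δ-≢ (λ eq → ℕ.<⇒≱ B<x (ℕ.≤-trans (eval-≥ q x xs h (ℕ.≤-trans (s≤s z≤n) B<x ∷ ps)) (subst (ℕ._≤ B) (sym eq) V≤B))))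
      par-both : ∀ x → par true x + par false x ≡ 1ℤ
      par-both x with odd x
      ... | true  = refl
      ... | false = refl
      pointwise : ∀ x xs → δ (N.eval q (x ℕ.+ x ∷ xs)) V * (pars p xs * weigh t (x ℕ.+ x ∷ xs))
                         ≡ value (doubleT true t) (x ∷ xs) + value (doubleT false t) (x ∷ xs)
      pointwise x xs rewrite N.eval-double q x xs | Z.eval-double w (+ x) (Vec.map +_ xs) =
        trans (sym (trans (cong (_* (d * (pars p xs * W))) (par-both x)) (ℤ.*-identityˡ _))) (e₂ (par true x) (par false x) d (pars p xs) W)
        where
        d = δ (N.eval q (x ℕ.+ x ∷ xs)) V
        W = c + Z.eval w (+ x + + x ∷ Vec.map +_ xs)
        e₂ : ∀ s s' d p w → (s + s') * (d * (p * w)) ≡ d * ((s * p) * w) + d * ((s' * p) * w)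
        e₂ = solve-∀

    ∧-pick : ∀ (g : ℕ → Bool) l {r} → List.foldr _∧_ true (List.map g l) ≡ true → r ∈ l → g r ≡ true
    ∧-pick g (x ∷ l) h (here refl) = ∧ˡ (g x) h
    ∧-pick g (x ∷ l) h (there r∈l) = ∧-pick g l (∧ʳ (g x) h) r∈l

    residue-∈ : ∀ b r → r ℕ.< 8 → b ≡ odd r → r ∈ (if b then odds else evens)
    residue-∈ true  1 _ _ = here refl
    residue-∈ true  3 _ _ = there (here refl)
    residue-∈ true  5 _ _ = there (there (here refl))
    residue-∈ true  7 _ _ = there (there (there (here refl)))
    residue-∈ false 0 _ _ = here refl
    residue-∈ false 2 _ _ = there (here refl)
    residue-∈ false 4 _ _ = there (there (here refl))
    residue-∈ false 6 _ _ = there (there (there (here refl)))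
    residue-∈ _ (suc (suc (suc (suc (suc (suc (suc (suc r)))))))) (s≤s (s≤s (s≤s (s≤s (s≤s (s≤s (s≤s (s≤s ())))))))) _

    -- If every coordinate had the prescribed parity, the vector of residues would be among those
    -- tested, where `f` holds. So a failure of `f` means that some parity factor is 0.
    residues-sound : ∀ {k} (p : Vec Bool k) (f : Vec ℕ k → Bool) → allResidues p f ≡ true →
      ∀ x → f (Vec.map (ℕ._% 8) x) ≡ false → pars p x ≡ 0ℤ
    residues-sound []      f h []       hf = contradictory h hf
      where
      contradictory : ∀ {b} {A : Set} → b ≡ true → b ≡ false → A
      contradictory refl ()
    residues-sound (b ∷ p) f h (x ∷ xs) hf with par b x ℤ.≟ 0ℤ
    ... | yes e = cong (_* pars p xs) e
    ... | no ne = trans (cong (_*_ (par b x)) (residues-sound p _ (∧-pick _ (if b then odds else evens) h (residue-∈ b (x ℕ.% 8) (ℕ.m%n<n x 8) parity-8)) xs hf)) (ℤ.*-zeroʳ (par b x))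
      where
      parity-8 : b ≡ odd (x ℕ.% 8)
      parity-8 = trans (agree b (odd x) ne) (odd-%8 x)
        where
        agree : ∀ b o → (if b xor o then 0ℤ else 1ℤ) ≢ 0ℤ → b ≡ o
        agree true  true  _ = refl
        agree true  false n = ⊥-elim (n refl)
        agree false true  n = ⊥-elim (n refl)
        agree false false _ = refl

    +-%-cong : ∀ a a' b b' → a ℕ.% 8 ≡ a' ℕ.% 8 → b ℕ.% 8 ≡ b' ℕ.% 8 → (a ℕ.+ b) ℕ.% 8 ≡ (a' ℕ.+ b') ℕ.% 8
    +-%-cong a a' b b' p q = trans (ℕ.%-distribˡ-+ a b 8) (trans (cong₂ (λ u v → (u ℕ.+ v) ℕ.% 8) p q) (sym (ℕ.%-distribˡ-+ a' b' 8)))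

    *-%-cong : ∀ a a' b b' → a ℕ.% 8 ≡ a' ℕ.% 8 → b ℕ.% 8 ≡ b' ℕ.% 8 → (a ℕ.* b) ℕ.% 8 ≡ (a' ℕ.* b') ℕ.% 8
    *-%-cong a a' b b' p q = trans (ℕ.%-distribˡ-* a b 8) (trans (cong₂ (λ u v → (u ℕ.* v) ℕ.% 8) p q) (sym (ℕ.%-distribˡ-* a' b' 8)))

    dot-% : ∀ {k} (r x : Vec ℕ k) → N.dot r (Vec.map (ℕ._% 8) x) ℕ.% 8 ≡ N.dot r x ℕ.% 8
    dot-% []      []       = refl
    dot-% (a ∷ r) (x ∷ xs) = +-%-cong (a ℕ.* (x ℕ.% 8)) (a ℕ.* x) (N.dot r (Vec.map (ℕ._% 8) xs)) (N.dot r xs)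
      (*-%-cong a a (x ℕ.% 8) x refl (ℕ.m%n%n≡m%n x 8)) (dot-% r xs)

    eval-% : ∀ {k} (q : Form ℕ k) x → N.eval q (Vec.map (ℕ._% 8) x) ℕ.% 8 ≡ N.eval q x ℕ.% 8
    eval-% []      []       = refl
    eval-% (r ∷ q) (x ∷ xs) = +-%-cong (x ℕ.% 8 ℕ.* N.dot r (Vec.map (ℕ._% 8) (x ∷ xs))) (x ℕ.* N.dot r (x ∷ xs)) (N.eval q (Vec.map (ℕ._% 8) xs)) (N.eval q xs)
      (*-%-cong (x ℕ.% 8) x (N.dot r (Vec.map (ℕ._% 8) (x ∷ xs))) (N.dot r (x ∷ xs)) (ℕ.m%n%n≡m%n x 8) (dot-% r (x ∷ xs)))
      (eval-% q xs)

    -- Off the solutions the factor `δ` vanishes. At a solution the residues modulo 8 give the form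
    -- the value V modulo 8, which the test excludes for the prescribed parities, so the parity
    -- factor vanishes.
    ⟦dead⟧ : ∀ {k} (t : Term k) → unattained (V ℕ.% 8) t ≡ true → ⟦ t ⟧ ≡ 0ℤ
    ⟦dead⟧ {k} t h = sumVec-zero B k pointwise
      where
      pointwise : ∀ x → Pos x → value t x ≡ 0ℤ
      pointwise x _ with N.eval (form t) x ℕ.≟ V
      ... | no  _  = refl
      ... | yes eq = trans (cong (λ z → 1ℤ * (z * weigh t x)) (residues-sound (parity t) _ h x attained)) refl
        where
        attained : not (N.eval (form t) (Vec.map (ℕ._% 8) x) ℕ.% 8 ℕ.≡ᵇ V ℕ.% 8) ≡ false
        attained rewrite eval-% (form t) x | eq = cong not (Bool.T-≡ .Equivalence.to (ℕ.≡⇒≡ᵇ (V ℕ.% 8) (V ℕ.% 8) refl))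

    cancel₁ : ∀ x → x + (- 1ℤ * x + 0ℤ) ≡ 0ℤ
    cancel₁ = solve-∀
    cancel₂ : ∀ x y → x + y + (- 1ℤ * x + (- 1ℤ * y + 0ℤ)) ≡ 0ℤ
    cancel₂ = solve-∀
    cancel₃ : ∀ x y z → x + (y + z) + (- 1ℤ * x + (- 1ℤ * y + (- 1ℤ * z + 0ℤ))) ≡ 0ℤ
    cancel₃ = solve-∀

    ⟦expand⟧ : ∀ r → ⟦ expand (V ℕ.% 8) r ⟧* ≡ 0ℤ
    ⟦expand⟧ (bisection t s₀ s₁ s₂ s₃) with positive (firstRow (form t)) in h₀ | positive (firstRow (swapForm 0 (form t))) in h₁
    ... | false | _     = refl
    ... | true  | false = refl
    ... | true  | true  = trans
      (cong₂ _+_ (trans (⟦swapsT⟧ s₀ t) (⟦split⟧ t h₀ h₁)) (cong₂ _+_ (⟦negT-swapsT⟧ s₁ (addT t)) (cong₂ _+_ (⟦negT-swapsT⟧ s₂ (addT (swapT 0 t))) (cong (_+ 0ℤ) (⟦negT-swapsT⟧ s₃ (wallT t))))))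
      (cancel₃ ⟦ addT t ⟧ ⟦ addT (swapT 0 t) ⟧ ⟦ wallT t ⟧)
    ⟦expand⟧ (halving (term q (true ∷ p) c w) s₀ s₁ s₂) = refl
    ⟦expand⟧ (halving (term q (false ∷ p) c w) s₀ s₁ s₂) with positive (firstRow q) in h
    ... | false = refl
    ... | true  = trans
      (cong₂ _+_ (trans (⟦swapsT⟧ s₀ t) (⟦halve⟧ q p c w h)) (cong₂ _+_ (⟦negT-swapsT⟧ s₁ (doubleT true t)) (cong (_+ 0ℤ) (⟦negT-swapsT⟧ s₂ (doubleT false t)))))
      (cancel₂ ⟦ doubleT true t ⟧ ⟦ doubleT false t ⟧)
      where t = term q (false ∷ p) c w
    ⟦expand⟧ (obstruction t) with unattained (V ℕ.% 8) t in h
    ... | true  = trans (ℤ.+-identityʳ ⟦ t ⟧) (⟦dead⟧ t h)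
    ... | false = refl
    ⟦expand⟧ (permutation t s) = trans (cong (_+_ ⟦ t ⟧) (cong (_+ 0ℤ) (⟦negT-swapsT⟧ s t))) (cancel₁ ⟦ t ⟧)

    ⟦insert⟧ : ∀ {k} (t : Term k) us → ⟦ insert t us ⟧* ≡ ⟦ t ⟧ + ⟦ us ⟧*
    ⟦insert⟧ t [] = refl
    ⟦insert⟧ {k} t ((l , u) ∷ us) with k ℕ.≟ l
    ... | no _ = trans (cong (_+_ ⟦ u ⟧) (⟦insert⟧ t us)) (left-comm ⟦ u ⟧ ⟦ t ⟧ ⟦ us ⟧*)
      where
      left-comm : ∀ x y z → x + (y + z) ≡ y + (x + z)
      left-comm = solve-∀
    ... | yes refl with form t ≟F form u | Vec.≡-dec Bool._≟_ (parity t) (parity u)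
    ...   | yes refl | yes refl = trans (cong (_+ ⟦ us ⟧*) (trans
              (sumVec-cong B k (λ x _ → trans (cong (λ z → δ (N.eval (form u) x) V * (pars (parity u) x * (constant t + constant u + z))) (Z.eval-plus (weight t) (weight u) (Vec.map +_ x)))
                 (distrib (δ (N.eval (form u) x) V) (pars (parity u) x) (constant t) (constant u) (Z.eval (weight t) (Vec.map +_ x)) (Z.eval (weight u) (Vec.map +_ x)))))
              (sumVec-+ B k _ _)))
            (ℤ.+-assoc ⟦ t ⟧ ⟦ u ⟧ ⟦ us ⟧*)
      where
      distrib : ∀ d p c c' w w' → d * (p * (c + c' + (w + w'))) ≡ d * (p * (c + w)) + d * (p * (c' + w'))
      distrib = solve-∀
    ...   | yes _ | no _  = trans (cong (_+_ ⟦ u ⟧) (⟦insert⟧ t us)) (left-comm ⟦ u ⟧ ⟦ t ⟧ ⟦ us ⟧*)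
      where
      left-comm : ∀ x y z → x + (y + z) ≡ y + (x + z)
      left-comm = solve-∀
    ...   | no _  | _     = trans (cong (_+_ ⟦ u ⟧) (⟦insert⟧ t us)) (left-comm ⟦ u ⟧ ⟦ t ⟧ ⟦ us ⟧*)
      where
      left-comm : ∀ x y z → x + (y + z) ≡ y + (x + z)
      left-comm = solve-∀

    ⟦collect⟧ : ∀ ts acc → ⟦ collect ts acc ⟧* ≡ ⟦ ts ⟧* + ⟦ acc ⟧*
    ⟦collect⟧ []             acc = sym (ℤ.+-identityˡ _)
    ⟦collect⟧ ((_ , t) ∷ ts) acc = trans (⟦collect⟧ ts (insert t acc)) (trans (cong (_+_ ⟦ ts ⟧*) (⟦insert⟧ t acc)) (shuffle ⟦ ts ⟧* ⟦ t ⟧ ⟦ acc ⟧*))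
      where
      shuffle : ∀ x y z → x + (y + z) ≡ y + x + z
      shuffle = solve-∀

    ⟦collectAll⟧ : ∀ rs acc → ⟦ collectAll (V ℕ.% 8) rs acc ⟧* ≡ ⟦ acc ⟧*
    ⟦collectAll⟧ []       acc = refl
    ⟦collectAll⟧ (r ∷ rs) acc = trans (⟦collectAll⟧ rs _) (trans (⟦collect⟧ (expand (V ℕ.% 8) r) acc) (trans (cong (_+ ⟦ acc ⟧*) (⟦expand⟧ r)) (ℤ.+-identityˡ _)))

    zeroℤ-sound : ∀ z → zeroℤ z ≡ true → z ≡ 0ℤ
    zeroℤ-sound (+ 0) _ = refl

    zeroForm-sound : ∀ {k} (q : Form ℤ k) → zeroForm q ≡ true → ∀ x → Z.eval q x ≡ 0ℤ
    zeroForm-sound []      h []       = refl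
    zeroForm-sound (r ∷ q) h (x ∷ xs) = let h₁ = ∧ˡ (zeroRow r) h; h₂ = ∧ʳ (zeroRow r) h in
      cong₂ _+_ (trans (cong (_*_ x) (row r (x ∷ xs) h₁)) (ℤ.*-zeroʳ x)) (zeroForm-sound q h₂ xs)
      where
      row : ∀ {k} (r x : Vec ℤ k) → zeroRow r ≡ true → Z.dot r x ≡ 0ℤ
      row []      []       _ = refl
      row (a ∷ r) (x ∷ xs) h = let h₁ = ∧ˡ (zeroℤ a) h; h₂ = ∧ʳ (zeroℤ a) h in cong₂ _+_ (cong (_* x) (zeroℤ-sound a h₁)) (row r xs h₂)

    ⟦vanishing⟧ : ∀ ts → vanishing ts ≡ true → ⟦ ts ⟧* ≡ 0ℤ
    ⟦vanishing⟧ []             h = refl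
    ⟦vanishing⟧ ((k , t) ∷ ts) h = let h₃ = ∧ˡ (zeroℤ (constant t)) h; h₁ = ∧ʳ (zeroℤ (constant t)) h; h₄ = ∧ˡ (zeroForm (weight t)) h₁; h₂ = ∧ʳ (zeroForm (weight t)) h₁ in
      cong₂ _+_ (sumVec-zero B k (λ x _ → trans (cong₂ (λ c w → δ (N.eval (form t) x) V * (pars (parity t) x * (c + w))) (zeroℤ-sound (constant t) h₃) (zeroForm-sound (weight t) h₄ (Vec.map +_ x)))
                                    (annihilate (δ (N.eval (form t) x) V) (pars (parity t) x)))) (⟦vanishing⟧ ts h₂)
      where
      annihilate : ∀ d p → d * (p * (0ℤ + 0ℤ)) ≡ 0ℤ
      annihilate = solve-∀

    certified : ∀ v ts rs → V ℕ.% 8 ≡ v → check v ts rs ≡ true → ⟦ ts ⟧* ≡ 0ℤ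
    certified _ ts rs refl h = begin
      ⟦ ts ⟧* ≡⟨ sym (ℤ.+-identityʳ _) ⟩
      ⟦ ts ⟧* + 0ℤ ≡⟨ sym (⟦collect⟧ ts []) ⟩
      ⟦ collect ts [] ⟧* ≡⟨ sym (⟦collectAll⟧ rs (collect ts [])) ⟩
      ⟦ collectAll (V ℕ.% 8) rs (collect ts []) ⟧* ≡⟨ ⟦vanishing⟧ (collectAll (V ℕ.% 8) rs (collect ts [])) h ⟩
      0ℤ ∎
      where open ≡-Reasoning

-- Certificates

-- Coefficient arrays are packed into numbers, least significant digit first.
digits : (b : ℕ) .{{_ : NonZero b}} (k n : ℕ) → Vec ℕ k × ℕ
digits b zero    n = [] , n
digits b (suc k) n with digits b k (n ℕ./ b)
... | ds , r = (n ℕ.% b ∷ ds) , r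

digitForm : (b : ℕ) .{{_ : NonZero b}} (k n : ℕ) → Form ℕ k
digitForm b zero    n = []
digitForm b (suc k) n with digits b (suc k) n
... | row , r = row ∷ digitForm b k r

-- 0, −1, 1, −2, 2, … are coded by 0, 1, 2, 3, 4, …
signed : ℕ → ℤ
signed zero          = + 0
signed (suc zero)    = -[1+ 0 ]
signed (suc (suc n)) with signed n
... | + m      = + suc m
... | -[1+ m ] = -[1+ suc m ]

-- Digit i + 1 codes the transposition of positions i and i + 1, digit 0 ends the list, and the
-- least significant digit is applied first: 312 is 1, 0, 2. The codes in use have at most five
-- digits, so fuel 9 is ample.
swapList : (fuel n : ℕ) → List ℕ
swapList zero    n = []
swapList (suc f) n with n ℕ.% 10
... | zero  = []
... | suc i = i ∷ swapList f (n ℕ./ 10)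

packed : (k q p c w : ℕ) → Term k
packed k q p c w = term (digitForm 10 k q) (Vec.map (ℕ._≡ᵇ 1) (proj₁ (digits 2 k p))) (signed c) (mapForm signed (digitForm 1000 k w))

sp : (k q p c w s₀ s₁ s₂ s₃ : ℕ) → Relation
sp k q p c w s₀ s₁ s₂ s₃ = bisection (packed (2 ℕ.+ k) q p c w) (swapList 9 s₀) (swapList 9 s₁) (swapList 9 s₂) (swapList 9 s₃)

ha : (k q p c w s₀ s₁ s₂ : ℕ) → Relation
ha k q p c w s₀ s₁ s₂ = halving (packed (1 ℕ.+ k) q p c w) (swapList 9 s₀) (swapList 9 s₁) (swapList 9 s₂)

de : (k q p c w : ℕ) → Relation
de k q p c w = obstruction (packed k q p c w)

pe : (k q p c w s : ℕ) → Relation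
pe k q p c w s = permutation (packed k q p c w) (swapList 9 s)

-- The certificates were found by linear programming over the relations above.
cert-star : List Relation
cert-star =
    pe 4 101100001 15 0 11000011011000000000000036 1
  ∷ sp 2 100011100 15 0 36000036000035035000 0 0 312 21
  ∷ sp 2 12012020 15 0 72071072000071000000000 32 32 12312 121
  ∷ ha 3 3014004021 14 0 72072143000000000072071000 21 321 321
  ∷ de 4 4830014400 7 0 144072072143143000000
  ∷ de 4 4830014400 15 0 144072072143143000000
  ∷ ha 3 3400012200 14 0 143000072000072000071000000 0 0 0
  ∷ de 4 3400014400 14 0 143000072000072000143000000
  ∷ de 4 3400014400 15 0 72000072143143000000
  ∷ sp 2 4000404000 15 0 287143000288144000431143144143 0 2 3 21
  ∷ sp 2 4408000040 7 0 288000000144000000144000000000 12 32 12 1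
  ∷ sp 2 4004404000 14 0 288288000000000000144144000000 2 2 0 21
  ∷ sp 2 4400408040 6 0 288144000144000000144000000000 12 12 232 1
  ∷ sp 2 4004404040 6 0 287143000143000000143000000000 312 312 2312 21
  ∷ sp 2 4004404000 6 0 288144000144000000000000000000 2 2 0 21
  ∷ sp 2 4400404000 6 0 287143000143000000000000000000 0 0 3 0
  ∷ sp 2 4404400040 11 0 144000000144000000143000143000 32 32 2 1
  ∷ sp 2 4400404000 14 0 287000000431143000432000287288 0 0 3 0
  ∷ sp 2 444000 15 0 144000288143000000000 312 312 12312 21
  ∷ sp 2 444000 15 0 144000000143287000 312 312 12312 21
  ∷ sp 2 4444000 14 0 143143287000 312 312 2312 21
  ∷ sp 2 4004210221 3 0 288144000144000000144000000000 2312 2312 2312 21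
  ∷ ha 3 4444004421 8 0 288288000144000000144000000 21 321 321
  ∷ de 4 4848444400 12 0 288288288000000144000
  ∷ sp 2 4004444000 2 0 287143000287000000000000000000 312 312 2312 21
  ∷ sp 2 4404004 5 0 143000000000000287000 2312 2312 2312 21
  ∷ sp 2 4000444000 3 0 287143000287000000000000000000 312 312 2312 21
  ∷ ha 3 4444004021 8 0 288288000144000000144000000 21 21 21
  ∷ de 4 4844044400 12 0 288288288000000144000
  ∷ ha 3 1214041100 12 0 144144288000000072000 0 0 0
  ∷ sp 2 402412021 7 0 143000000143000000143000000 312 312 1232 121
  ∷ ha 3 4404404421 12 0 287000000143000000143000000 1 321 321
  ∷ sp 2 4404404440 15 0 144000000144000000000000000 0 32 32 21
  ∷ de 4 4848404440 6 0 287287000000000143000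
  ∷ sp 2 4000404040 11 0 287288000143144000143144000000 312 312 232 21
  ∷ ha 3 4444004421 12 0 288288000144000000144000000 21 321 321
  ∷ sp 2 4404404004 9 0 144000000143288287 1 312 0 1
  ∷ de 4 4848444400 14 0 288288288000000144000
  ∷ ha 3 4404404201 10 0 287143000000000143000 1 1 1
  ∷ de 4 4408444400 9 0 287143287000
  ∷ sp 2 4004210221 11 0 288144000144000000144000000000 2312 2312 2312 21
  ∷ sp 2 4000444000 11 0 287143000287000000000000000000 312 2 2312 21
  ∷ ha 3 4444004021 12 0 288288000144000000144000000 21 21 21
  ∷ de 4 4844044400 14 0 288288288000000144000
  ∷ sp 2 4404044400 10 0 287000000288000000000 0 0 312 1
  ∷ sp 2 4404000040 11 0 144143000000143000288000144000 12 12 12 1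
  ∷ sp 2 404400040 13 0 144000000000000000 32 32 32 21
  ∷ sp 2 4400000040 15 0 143000000143000000000000000000 12 32 32 1
  ∷ ha 3 1214041100 14 0 144144288000000072000 0 0 0
  ∷ sp 2 404000040 15 0 144288000000000000432 12 32 12 1
  ∷ ha 3 1212202001 14 0 71071071071 1 1 1
  ∷ ha 3 1214001120 14 0 143143000000000071000 21 21 21
  ∷ sp 2 400444000 3 0 144000288000000000000000000 2 2 1232 21
  ∷ ha 3 4404404201 8 0 287143000000000143000 1 1 1
  ∷ de 4 4408444400 10 0 287143287000
  ∷ sp 2 402412021 3 0 143000000143000000143000000 312 312 1232 21
  ∷ ha 3 4404404421 8 0 287000000143000000143000000 1 321 321
  ∷ sp 2 404444000 2 0 144000288000000000000000000 2 2 2312 21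
  ∷ de 4 4848404440 12 0 287287000000000143000
  ∷ sp 2 404004040 7 0 143000000000 12 12 12 1
  ∷ ha 3 1214001120 12 0 143143000000000071000 21 21 21
  ∷ ha 3 1202212200 14 0 72072072000 0 0 0
  ∷ sp 2 404040 14 0 144287143000288144431000000 2312 312 1232 21
  ∷ sp 2 4400000040 7 0 143000000143000000000000000000 12 32 32 1
  ∷ sp 2 1441001010 11 0 72144000072000000000000000 2 2 2 0
  ∷ sp 2 1441001010 15 0 72144000000000000072000000 2 2 2 0
  ∷ sp 2 400000040 14 0 143000143 32 32 32 1
  ∷ sp 2 1001201210 11 0 71000000000000000071000000 2312 2312 2312 21
  ∷ sp 2 1001201210 15 0 71000000000000000071000000 2312 2312 2312 21
  ∷ sp 2 404000 14 0 143288144000287000000144144 0 2 23 21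
  ∷ ha 3 1101102001 14 0 36000036036 1 1 1
  ∷ sp 2 1202200001 15 0 72072000071071072071 1 312 0 1
  ∷ ha 3 101111100 14 0 35035000 0 0 0
  ∷ ha 2 440441 6 0 143000000071000 1 21 21
  ∷ de 3 484840 3 0 143143000
  ∷ sp 1 444400 2 0 143143000000000000 0 0 12 0
  ∷ ha 2 444441 4 0 144144000072000 0 21 21
  ∷ de 3 484844 6 0 144144144
  ∷ sp 1 441021 3 0 144072000072000000 2 2 2 1
  ∷ sp 1 41021 7 0 71000071000000 12 12 12 1
  ∷ sp 1 404400 3 0 143143000000000000 0 0 12 1
  ∷ ha 2 444401 4 0 144144000072000 0 1 1
  ∷ de 3 484404 6 0 144144144
  ∷ de 3 440440 6 0 287000000143000
  ∷ sp 1 41021 3 0 71000071000000 12 12 12 1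
  ∷ sp 1 44400 2 0 144000000000000 0 0 12 1
  ∷ ha 2 440441 4 0 143000000071000 1 21 21
  ∷ de 3 484840 6 0 143143000
  ∷ sp 1 40004 3 0 144000000 12 12 0 1
  ∷ ha 2 440401 4 0 143000000071000 1 1 1
  ∷ de 3 484400 6 0 143143000
  ∷ sp 1 444400 6 0 143143144144000 0 0 2 0
  ∷ ha 2 440401 6 0 143000000071000 1 1 1
  ∷ de 3 484400 5 0 143143000
  ∷ ha 2 444401 6 0 144144000072000 0 1 1
  ∷ de 3 484404 7 0 144144144
  ∷ sp 1 441021 7 0 144072000072000000 2 2 0 0
  ∷ ha 2 444441 6 0 144144072000000 0 21 21
  ∷ de 3 484844 7 0 144144144
  ∷ sp 1 404400 7 0 143143000000000000 0 0 12 0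
  ∷ sp 1 4400 6 0 143000 0 0 12 1
  ∷ de 3 301400 7 0 72072143000000
  ∷ de 2 440 3 0 143000
  ∷ pe 4 100011100 15 0 1000005000000001004006000 3
  ∷ pe 4 100011100 15 0 1000005000000001004006000 121
  ∷ pe 4 100011100 15 0 1000005000000001004006000 3121
  ∷ pe 4 100011100 15 0 1000005000000001004006000 1231
  ∷ pe 4 100011100 15 0 1000005000000001004006000 12321
  ∷ pe 4 101111100 14 0 18017000000000000000 3
  ∷ pe 4 1102011100 13 0 18000000018000017000017000 121
  ∷ pe 3 110110 7 0 18000017000000 1
  ∷ pe 4 1200012200 15 0 36000000036000035000035000 121
  ∷ pe 4 3400014400 15 0 71000000000000072000000000 121
  ∷ pe 4 4000404000 15 0 72000071000000000072071000 2
  ∷ pe 4 4404404000 7 0 287143288000144000072071000 2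
  ∷ pe 4 4444404440 12 0 36000035000000000036035000000 1
  ∷ pe 4 4444404440 12 0 36000035000000000036035000000 3
  ∷ pe 4 4444404440 12 0 36000035000000000036035000000 31
  ∷ pe 3 444440 6 0 72000071000000000 2
  ∷ pe 4 4404404000 15 0 72071000 2
  ∷ pe 4 4404404440 15 0 23000024023000000000024000 1
  ∷ pe 4 4404404440 15 0 23000024023000000000024000 2
  ∷ pe 4 4404404440 15 0 23000024023000000000024000 21
  ∷ pe 4 4404404440 15 0 23000024023000000000024000 12
  ∷ pe 4 4404404440 15 0 23000024023000000000024000 121
  ∷ pe 4 4404044400 10 0 144000000216000143000215000 121
  ∷ pe 4 4440404000 12 0 71000072072072000071071000000 31
  ∷ pe 4 400404000 15 0 71000071000072000072 31
  ∷ pe 3 440440 4 0 144000143000000 1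
  ∷ pe 4 4000404000 7 0 72000071000000000000000000 2
  ∷ pe 4 1104041100 13 0 35000000000036000 121
  ∷ pe 4 404000 14 0 72143071000144000000000000 2
  ∷ pe 3 484844 3 0 72000071000000 1
  ∷ pe 3 444441 6 0 72000071000000000 2
  ∷ pe 3 484844 7 0 72000071000000 1
  ∷ []

cert-J : List Relation
cert-J =
    pe 4 101100001 3 47 0 312
  ∷ pe 3 10001 3 47 0 12
  ∷ pe 4 101100001 6 144 0 123
  ∷ pe 4 101100001 14 47 0 1
  ∷ pe 3 10001 6 72 0 1
  ∷ pe 3 10110 3 72 0 12
  ∷ sp 2 1202212001 12 95 0 12 312 312 21
  ∷ sp 2 1212202020 10 96 0 2 32 32 21
  ∷ ha 3 2412211100 12 95 0 0 0 0
  ∷ ha 3 2412211110 12 95 0 0 0 0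
  ∷ sp 2 1212202020 9 96 0 2 32 32 21
  ∷ sp 2 1102112001 11 95 0 12 312 312 21
  ∷ ha 3 1212001110 10 95 0 21 21 21
  ∷ ha 3 1212001110 8 96 0 21 21 21
  ∷ de 4 1202212200 8 96 0
  ∷ sp 2 1212202020 11 95 0 2 32 32 21
  ∷ ha 3 1212011100 8 95 0 0 0 0
  ∷ de 4 1212012200 8 95 0
  ∷ sp 2 1102100001 10 95 0 12 312 0 1
  ∷ sp 2 1202200001 10 192 0 12 312 0 1
  ∷ sp 2 1202212001 11 192 0 12 312 312 21
  ∷ sp 2 1211001010 8 47 0 2 2 2 0
  ∷ ha 3 1200011100 8 192 0 0 121 0
  ∷ de 4 1200012200 8 192 0
  ∷ sp 2 101100001 3 47 0 312 312 0 21
  ∷ sp 2 1000100110 3 96 0 2312 232 232 21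
  ∷ ha 3 1212001110 4 95 0 21 21 21
  ∷ sp 2 1212202020 6 95 0 2 32 32 21
  ∷ sp 2 1202212001 6 96 0 12 312 312 21
  ∷ de 4 1202212200 2 95 0
  ∷ ha 3 1212011100 4 96 0 0 0 0
  ∷ de 4 1212012200 4 96 0
  ∷ sp 2 1001101110 8 47 0 2312 2312 2312 21
  ∷ sp 2 1000100110 7 47 0 23 232 232 21
  ∷ sp 1 121201 7 48 0 0 2 2 1
  ∷ sp 1 120220 6 96 0 0 2 2 1
  ∷ sp 1 120220 7 47 0 0 2 2 1
  ∷ ha 2 241110 6 95 0 0 0 0
  ∷ de 3 121201 4 47 0
  ∷ ha 2 120110 6 47 0 0 0 0
  ∷ sp 1 101200 5 48 0 0 0 2 0
  ∷ ha 2 120110 4 144 0 0 1 0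
  ∷ de 3 120220 4 144 0
  ∷ ha 2 121100 4 47 0 0 0 0
  ∷ sp 2 100011100 12 48 0 0 0 312 21
  ∷ sp 2 1211001010 3 48 0 2 2 2 1
  ∷ sp 2 1001101110 3 48 0 2312 2312 2312 21
  ∷ de 3 121201 2 48 0
  ∷ de 3 121200 2 47 0
  ∷ sp 1 10110 7 23 0 0 2 2 1
  ∷ sp 1 10001 3 47 0 12 12 0 1
  ∷ sp 1 10110 3 72 0 12 2 2 1
  ∷ de 3 101200 4 240 0
  ∷ sp 1 110110 4 47 0 0 0 0 0
  ∷ sp 1 110110 3 48 0 0 2 2 1
  ∷ ha 2 101100 4 144 0 0 0 0
  ∷ sp 1 100010 3 72 0 2 2 2 1
  ∷ sp 1 21001 6 48 0 12 12 12 1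
  ∷ sp 1 120020 6 47 0 2 2 2 1
  ∷ ha 2 100110 4 47 0 21 21 21
  ∷ de 3 21200 2 47 0
  ∷ de 2 120 2 96 0
  ∷ ha 1 110 2 24 0 0 0 0
  ∷ sp 0 10 3 36 0 0 0 0 0
  ∷ de 2 101 2 72 0
  ∷ de 1 1 1 36 0
  ∷ []

cert-ev : List Relation
cert-ev =
    pe 4 101100001 2 23 0 312
  ∷ pe 3 10001 2 23 0 12
  ∷ pe 4 101100001 7 24 0 123
  ∷ pe 3 10001 7 12 0 1
  ∷ pe 3 10110 1 11 0 21
  ∷ pe 2 10 1 11 0 1
  ∷ sp 2 1212202020 3 47 0 2 32 32 21
  ∷ sp 2 1202212001 3 48 0 12 312 312 21
  ∷ sp 2 1200012200 5 47 0 0 0 312 21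
  ∷ sp 2 1212202020 13 48 0 2 32 32 21
  ∷ sp 2 1202212001 13 47 0 12 312 312 21
  ∷ sp 2 1200012200 10 48 0 0 0 312 1
  ∷ ha 3 1200011100 4 47 0 0 0 0
  ∷ de 4 1200012200 4 47 0
  ∷ ha 3 1200011100 10 48 0 0 121 0
  ∷ de 4 1200012200 14 48 0
  ∷ sp 2 11001010 8 23 0 2 32 32 121
  ∷ sp 2 1000100110 11 24 0 2312 232 232 21
  ∷ sp 1 121201 3 24 0 0 2 2 1
  ∷ sp 1 120220 3 23 0 0 2 2 1
  ∷ ha 2 120110 2 23 0 0 0 0
  ∷ de 3 120220 2 23 0
  ∷ sp 1 101200 6 36 0 0 0 2 0
  ∷ sp 1 1200 5 35 0 0 0 12 1
  ∷ ha 2 100110 2 12 0 21 21 21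
  ∷ de 3 21200 1 12 0
  ∷ sp 1 10110 4 11 0 0 2 2 1
  ∷ de 3 101200 1 23 0
  ∷ ha 2 1100 4 35 0 0 0 0
  ∷ de 3 1200 4 35 0
  ∷ sp 1 110010 1 11 0 2 2 2 1
  ∷ sp 1 110010 6 12 0 2 2 0 0
  ∷ ha 2 121211 6 11 0 0 21 21
  ∷ de 3 441221 3 11 0
  ∷ sp 1 121021 5 12 0 2 12 12 1
  ∷ ha 2 101211 6 11 0 21 21 21
  ∷ de 3 441201 7 11 0
  ∷ sp 1 111100 1 11 0 0 0 12 1
  ∷ sp 1 101100 6 11 0 0 0 12 0
  ∷ sp 1 1100 4 12 0 0 0 12 1
  ∷ ha 2 101100 6 12 0 0 0 0
  ∷ de 3 101200 7 12 0
  ∷ sp 1 11100 4 12 0 0 0 12 1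
  ∷ sp 1 120010 2 11 0 2 2 0 0
  ∷ sp 1 1100 7 12 0 0 0 12 1
  ∷ ha 2 21100 4 24 0 0 0 0
  ∷ de 3 21200 4 24 0
  ∷ sp 0 10 2 11 0 0 0 0 0
  ∷ []

cert-cls3 : List Relation
cert-cls3 =
    pe 3 10110 3 11 0 12
  ∷ ha 2 241220 6 48 0 0 0 0
  ∷ de 3 241440 7 48 0
  ∷ de 3 241440 6 48 0
  ∷ sp 1 120220 7 24 0 0 2 2 1
  ∷ ha 2 120110 6 24 0 0 0 0
  ∷ ha 2 120110 4 23 0 0 1 0
  ∷ de 3 120220 4 23 0
  ∷ sp 1 10110 7 12 0 0 2 2 1
  ∷ sp 1 10110 3 11 0 12 2 2 1
  ∷ de 2 241 3 24 0
  ∷ ha 1 110 2 11 0 0 0 0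
  ∷ de 2 120 2 23 0
  ∷ sp 0 10 3 5 0 0 0 0 0
  ∷ de 1 1 1 5 0
  ∷ []

cert-cls7 : List Relation
cert-cls7 =
    pe 3 10110 3 11 0 12
  ∷ sp 1 21220 3 23 0 12 2 12 1
  ∷ sp 1 340440 6 23 0 0 2 2 1
  ∷ ha 2 340421 6 24 0 1 21 21
  ∷ ha 2 340220 4 23 0 0 1 0
  ∷ de 3 340440 4 23 0
  ∷ ha 2 341210 4 24 0 0 0 0
  ∷ sp 1 320210 4 8 0 0 0 0 0
  ∷ sp 1 11120 3 8 0 12 2 12 1
  ∷ ha 2 120110 4 23 0 0 1 0
  ∷ de 3 120220 4 23 0
  ∷ sp 1 10110 7 4 0 0 2 2 1
  ∷ sp 1 10110 3 11 0 12 2 2 1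
  ∷ sp 0 120 3 7 0 0 0 0 0
  ∷ de 2 340 2 23 0
  ∷ ha 1 110 2 11 0 0 0 0
  ∷ de 2 120 2 23 0
  ∷ sp 0 10 3 5 0 0 0 0 0
  ∷ de 1 3 1 7 0
  ∷ de 1 1 1 5 0
  ∷ []

-- The identities to be certified.

q₂ : Form ℕ 2
q₂ = (0 ∷ 1 ∷ []) ∷ (0 ∷ []) ∷ []

q₃ : Form ℕ 3
q₃ = (0 ∷ 1 ∷ 1 ∷ []) ∷ (0 ∷ 1 ∷ []) ∷ (0 ∷ []) ∷ []

zeros : ∀ k → Form ℤ k
zeros zero    = []
zeros (suc k) = Vec.replicate (suc k) (+ 0) ∷ zeros k

count : ∀ {k} → Form ℕ k → Vec Bool k → ℤ → Term k
count q p c = term q p c (zeros _)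

-- t² added to the form, t being the new first variable of parity b.
lift : ∀ {k} → Bool → Term k → Term (suc k)
lift {k} b (term q p c w) = term ((1 ∷ Vec.replicate k 0) ∷ q) (b ∷ p) c (Vec.replicate (suc k) (+ 0) ∷ w)

pattern ○ = false
pattern ● = true

T111 T110 T100 : ℤ → Term 3
T111 = count q₃ (● ∷ ● ∷ ● ∷ [])
T110 = count q₃ (● ∷ ● ∷ ○ ∷ [])
T100 = count q₃ (● ∷ ○ ∷ ○ ∷ [])

T11 T10 : ℤ → Term 2
T11 = count q₂ (● ∷ ● ∷ [])
T10 = count q₂ (● ∷ ○ ∷ [])

-- t² + ab + ac + bc over odd t, a, b, c, with weight 6 (ab + ac + bc − 3t²).
starTerm : Term 4
starTerm = term ((1 ∷ 0 ∷ 0 ∷ 0 ∷ []) ∷ q₃) (● ∷ ● ∷ ● ∷ ● ∷ []) (+ 0)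
  ((-[1+ 17 ] ∷ + 0 ∷ + 0 ∷ + 0 ∷ []) ∷ (+ 0 ∷ + 6 ∷ + 6 ∷ []) ∷ (+ 0 ∷ + 6 ∷ []) ∷ (+ 0 ∷ []) ∷ [])

-- `target-J` is the sum of g(t) D(n - t²) over all integers t, with g = 1 and D = `G₂` at odd t, g
-- = -3 and D = `G₃` at even t. Lifted terms carry a factor 2 for ±t, the terms without `lift` come
-- from t = 0. `target-ev` is half of the analogous sum with g = 1 and `G₂` at even t, g = -1 and
-- `G₁` at odd t. The last two evaluate `G₃` on the classes 3 and 7 modulo 8.
target-star target-J target-ev target-cls3 target-cls7 : Terms
target-star = [ starTerm ]T ∷ []
target-J    = [ lift ● (T100 (+ 24)) ]T ∷ [ lift ● (T10 (+ 24)) ]T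
            ∷ [ lift ○ (T110 (-[1+ 71 ])) ]T ∷ [ lift ○ (T111 (+ 24)) ]T ∷ [ lift ○ (T11 (-[1+ 35 ])) ]T
            ∷ [ T110 (-[1+ 35 ]) ]T ∷ [ T111 (+ 12) ]T ∷ [ T11 (-[1+ 17 ]) ]T ∷ []
target-ev   = [ lift ○ (T100 (+ 12)) ]T ∷ [ lift ○ (T10 (+ 12)) ]T
            ∷ [ lift ● (T110 (-[1+ 11 ])) ]T ∷ [ lift ● (T11 (-[1+ 5 ])) ]T
            ∷ [ T100 (+ 6) ]T ∷ [ T10 (+ 6) ]T ∷ []
target-cls3 = [ T110 (+ 6) ]T ∷ [ T11 (+ 3) ]T ∷ [ T111 (-[1+ 5 ]) ]T ∷ []
target-cls7 = [ T110 (+ 6) ]T ∷ [ T11 (+ 3) ]T ∷ [ T111 (-[1+ 1 ]) ]T ∷ []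

-- All checks hold by evaluation. `cert-J` and `cert-ev` are run for two residues each, because
-- obstructions are tested modulo 8 whereas their recurrences are used on a whole class modulo 4.
check-cls3 : check 3 target-cls3 cert-cls3 ≡ true
check-cls3 = refl

check-cls7 : check 7 target-cls7 cert-cls7 ≡ true
check-cls7 = refl

check-J₃ : check 3 target-J cert-J ≡ true
check-J₃ = refl

check-J₇ : check 7 target-J cert-J ≡ true
check-J₇ = refl

check-ev₂ : check 2 target-ev cert-ev ≡ true
check-ev₂ = refl

check-ev₆ : check 6 target-ev cert-ev ≡ true
check-ev₆ = refl

check-star : check 4 target-star cert-star ≡ true
check-star = refl

open Value using (⟦_⟧; ⟦_⟧*; certified)

-- Three squares

-- Sum of an even function over |t| ≤ B; abstract, since its unfolding makes unification explode.
abstract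
  S : ℕ → (ℕ → ℤ) → ℤ
  S B f = f 0 + + 2 * sumTo B f

  S-cong : ∀ B {f g} → (∀ t → f t ≡ g t) → S B f ≡ S B g
  S-cong B h = cong₂ (λ a b → a + + 2 * b) (h 0) (sumTo-cong B (λ i → h (suc i)))

  S-0 : ∀ B → S B (λ _ → 0ℤ) ≡ 0ℤ
  S-0 B = cong (λ z → 0ℤ + + 2 * z) (sumTo-0 B)

  S-zero : ∀ B {f} → (∀ t → f t ≡ 0ℤ) → S B f ≡ 0ℤ
  S-zero B h = trans (S-cong B h) (S-0 B)

  S-+ : ∀ B f g → S B (λ t → f t + g t) ≡ S B f + S B g
  S-+ B f g = trans (cong (λ z → f 0 + g 0 + + 2 * z) (sumTo-+ B f g)) (e (f 0) (g 0) (sumTo B f) (sumTo B g))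
    where
    e : ∀ a b x y → a + b + + 2 * (x + y) ≡ a + + 2 * x + (b + + 2 * y)
    e = solve-∀

  S-* : ∀ B c f → S B (λ t → c * f t) ≡ c * S B f
  S-* B c f = trans (cong (λ z → c * f 0 + + 2 * z) (sumTo-* B c f)) (e c (f 0) (sumTo B f))
    where
    e : ∀ c a x → c * a + + 2 * (c * x) ≡ c * (a + + 2 * x)
    e = solve-∀

  S-swap : ∀ B (F : ℕ → ℕ → ℤ) → S B (λ a → S B (F a)) ≡ S B (λ b → S B (λ a → F a b))
  S-swap B F = begin
    F 0 0 + + 2 * R + + 2 * sumTo B (λ a → F a 0 + + 2 * sumTo B (F a))
      ≡⟨ cong (λ z → F 0 0 + + 2 * R + + 2 * z) (trans (sumTo-+ B _ _) (cong (_+_ C) (sumTo-* B (+ 2) _))) ⟩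
    F 0 0 + + 2 * R + + 2 * (C + + 2 * sumTo B (λ a → sumTo B (F a)))
      ≡⟨ cong (λ z → F 0 0 + + 2 * R + + 2 * (C + + 2 * z)) (sumTo-swap B B F) ⟩
    F 0 0 + + 2 * R + + 2 * (C + + 2 * D)
      ≡⟨ e (F 0 0) R C D ⟩
    F 0 0 + + 2 * C + + 2 * (R + + 2 * D)
      ≡⟨ cong (λ z → F 0 0 + + 2 * C + + 2 * z) (sym (trans (sumTo-+ B _ _) (cong (_+_ R) (sumTo-* B (+ 2) _)))) ⟩
    F 0 0 + + 2 * C + + 2 * sumTo B (λ b → F 0 b + + 2 * sumTo B (λ a → F a b)) ∎
    where
    open ≡-Reasoning
    R C D : ℤ
    R = sumTo B (F 0)
    C = sumTo B (λ a → F a 0)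
    D = sumTo B (λ b → sumTo B (λ a → F a b))
    e : ∀ x r c d → x + + 2 * r + + 2 * (c + + 2 * d) ≡ x + + 2 * c + + 2 * (r + + 2 * d)
    e = solve-∀

  S-def : ∀ B f → S B f ≡ f 0 + + 2 * sumTo B f
  S-def B f = refl

-- Convolution with squares and representation numbers.

conv : (ℕ → ℤ) → ℕ → ℕ → ℤ
conv D n t with t ℕ.* t ℕ.≤? n
... | yes _ = D (n ℕ.∸ t ℕ.* t)
-- Without this case truncated subtraction would let every t with t² > n contribute `D 0`.
... | no  _ = 0ℤ

conv-cong : ∀ {D E} n t → (t ℕ.* t ℕ.≤ n → D (n ℕ.∸ t ℕ.* t) ≡ E (n ℕ.∸ t ℕ.* t)) → conv D n t ≡ conv E n t
conv-cong n t h with t ℕ.* t ℕ.≤? n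
... | yes p = h p
... | no  _ = refl

conv-+ : ∀ D E n t → conv (λ m → D m + E m) n t ≡ conv D n t + conv E n t
conv-+ D E n t with t ℕ.* t ℕ.≤? n
... | yes _ = refl
... | no  _ = refl

conv-* : ∀ c D n t → conv (λ m → c * D m) n t ≡ c * conv D n t
conv-* c D n t with t ℕ.* t ℕ.≤? n
... | yes _ = refl
... | no  _ = sym (ℤ.*-zeroʳ c)

δ-conv : ∀ m n t → δ (t ℕ.* t ℕ.+ m) n ≡ conv (δ m) n t
δ-conv m n t with t ℕ.* t ℕ.≤? n
... | no  t²≰n = δ-≢ (λ eq → t²≰n (subst (t ℕ.* t ℕ.≤_) eq (ℕ.m≤m+n (t ℕ.* t) m)))
... | yes t²≤n with m ℕ.≟ n ℕ.∸ t ℕ.* t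
...   | yes eq = trans (cong (λ z → δ z n) (trans (cong (t ℕ.* t ℕ.+_) eq) (ℕ.m+[n∸m]≡n t²≤n))) (δ-refl n)
...   | no neq = δ-≢ (λ eq → neq (trans (sym (ℕ.m+n∸m≡n (t ℕ.* t) m)) (cong (ℕ._∸ t ℕ.* t) eq)))

conv-S : ∀ B (f : ℕ → ℕ → ℤ) n t → conv (λ m → S B (f m)) n t ≡ S B (λ x → conv (λ m → f m x) n t)
conv-S B f n t with t ℕ.* t ℕ.≤? n
... | yes _ = refl
... | no  _ = sym (S-0 B)

conv-sumVec : ∀ B k (e : Vec ℕ k → ℕ) (w : Vec ℕ k → ℤ) n t →
  sumVec B k (λ x → conv (δ (e x)) n t * w x) ≡ conv (λ m → sumVec B k (λ x → δ (e x) m * w x)) n t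
conv-sumVec B k e w n t with t ℕ.* t ℕ.≤? n
... | yes _ = refl
... | no  _ = sumVec-zero B k (λ _ _ → refl)

# : ∀ {k} → Form ℕ k → Vec Bool k → ℕ → ℕ → ℤ
# {k} q p B N = sumVec B k (λ x → δ (N.eval q x) N * pars p x)

Z-dot-0 : ∀ {k} (x : Vec ℤ k) → Z.dot (Vec.replicate k (+ 0)) x ≡ 0ℤ
Z-dot-0 []       = refl
Z-dot-0 (x ∷ xs) = cong (_+_ (0ℤ * x)) (Z-dot-0 xs)

N-dot-0 : ∀ {k} (x : Vec ℕ k) → N.dot (Vec.replicate k 0) x ≡ 0
N-dot-0 []       = refl
N-dot-0 (x ∷ xs) = N-dot-0 xs

eval-zeros : ∀ {k} (x : Vec ℤ k) → Z.eval (zeros k) x ≡ 0ℤ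
eval-zeros []       = refl
eval-zeros (x ∷ xs) = trans (cong₂ (λ a b → x * a + b) (Z-dot-0 (x ∷ xs)) (eval-zeros xs)) (trans (ℤ.+-identityʳ _) (ℤ.*-zeroʳ x))

⟦count⟧ : ∀ {k} (q : Form ℕ k) p c B N → ⟦_⟧ B N (count q p c) ≡ c * # q p B N
⟦count⟧ {k} q p c B N = trans (sumVec-cong B k (λ x _ → pointwise x)) (sumVec-* B k c (λ x → δ (N.eval q x) N * pars p x))
  where
  e : ∀ d p c → d * (p * (c + 0ℤ)) ≡ c * (d * p)
  e = solve-∀
  no-weight : ∀ x → weigh (count q p c) x ≡ c + 0ℤ
  no-weight x = cong (_+_ c) (eval-zeros (Vec.map +_ x))
  pointwise : ∀ x → Value.value B N (count q p c) x ≡ c * (δ (N.eval q x) N * pars p x)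
  pointwise x = trans (cong (λ w → δ (N.eval q x) N * (pars p x * w)) (no-weight x)) (e (δ (N.eval q x) N) (pars p x) c)

-- Grouping the solutions by their first variable t turns a certified term into one side of a
-- recurrence.
⟦lift⟧ : ∀ {k} b (q : Form ℕ k) p c B n → ⟦_⟧ B n (lift b (count q p c)) ≡ c * sumTo B (λ t → par b t * conv (# q p B) n t)
⟦lift⟧ {k} b q p c B n = trans (sumTo-cong B (λ t → fibre (suc t))) (sumTo-* B c (λ t → par b t * conv (# q p B) n t))
  where
  e : ∀ d s p c → d * ((s * p) * (c + 0ℤ)) ≡ (c * s) * (d * p)
  e = solve-∀
  form-value : ∀ t xs → N.eval ((1 ∷ Vec.replicate k 0) ∷ q) (t ∷ xs) ≡ t ℕ.* t ℕ.+ N.eval q xs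
  form-value t xs = cong (ℕ._+ N.eval q xs) (trans (cong (λ z → t ℕ.* (t ℕ.+ 0 ℕ.+ z)) (N-dot-0 xs)) (cong (t ℕ.*_) (trans (ℕ.+-identityʳ (t ℕ.+ 0)) (ℕ.+-identityʳ t))))
  no-weight : ∀ t xs → weigh (lift b (count q p c)) (t ∷ xs) ≡ c + 0ℤ
  no-weight t xs = cong (_+_ c) (trans (cong₂ (λ a b → + t * a + b) (Z-dot-0 (+ t ∷ Vec.map +_ xs)) (eval-zeros (Vec.map +_ xs))) (trans (ℤ.+-identityʳ (+ t * 0ℤ)) (ℤ.*-zeroʳ (+ t))))
  pointwise : ∀ t xs → Value.value B n (lift b (count q p c)) (t ∷ xs) ≡ (c * par b t) * (conv (δ (N.eval q xs)) n t * pars p xs)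
  pointwise t xs = begin
    δ (N.eval ((1 ∷ Vec.replicate k 0) ∷ q) (t ∷ xs)) n * ((par b t * pars p xs) * weigh (lift b (count q p c)) (t ∷ xs))
      ≡⟨ cong₂ (λ m w → δ m n * ((par b t * pars p xs) * w)) (form-value t xs) (no-weight t xs) ⟩
    δ (t ℕ.* t ℕ.+ N.eval q xs) n * ((par b t * pars p xs) * (c + 0ℤ))
      ≡⟨ e (δ (t ℕ.* t ℕ.+ N.eval q xs) n) (par b t) (pars p xs) c ⟩
    (c * par b t) * (δ (t ℕ.* t ℕ.+ N.eval q xs) n * pars p xs)
      ≡⟨ cong (λ d → (c * par b t) * (d * pars p xs)) (δ-conv (N.eval q xs) n t) ⟩
    (c * par b t) * (conv (δ (N.eval q xs)) n t * pars p xs) ∎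
    where open ≡-Reasoning
  fibre : ∀ t → sumVec B k (λ xs → Value.value B n (lift b (count q p c)) (t ∷ xs)) ≡ c * (par b t * conv (# q p B) n t)
  fibre t = begin
    sumVec B k (λ xs → Value.value B n (lift b (count q p c)) (t ∷ xs))
      ≡⟨ sumVec-cong B k (λ xs _ → pointwise t xs) ⟩
    sumVec B k (λ xs → (c * par b t) * (conv (δ (N.eval q xs)) n t * pars p xs))
      ≡⟨ sumVec-* B k (c * par b t) (λ xs → conv (δ (N.eval q xs)) n t * pars p xs) ⟩
    (c * par b t) * sumVec B k (λ xs → conv (δ (N.eval q xs)) n t * pars p xs)
      ≡⟨ cong (_*_ (c * par b t)) (conv-sumVec B k (N.eval q) (pars p) n t) ⟩
    (c * par b t) * conv (# q p B) n t
      ≡⟨ ℤ.*-assoc c (par b t) (conv (# q p B) n t) ⟩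
    c * (par b t * conv (# q p B) n t) ∎
    where open ≡-Reasoning

111ₚ 110ₚ 100ₚ : Vec Bool 3
111ₚ = ● ∷ ● ∷ ● ∷ []
110ₚ = ● ∷ ● ∷ ○ ∷ []
100ₚ = ● ∷ ○ ∷ ○ ∷ []

11ₚ 10ₚ : Vec Bool 2
11ₚ = ● ∷ ● ∷ []
10ₚ = ● ∷ ○ ∷ []

δ-subst : ∀ {m n} {f g : ℤ} → (m ≡ n → f ≡ g) → δ m n * f ≡ δ m n * g
δ-subst {m} {n} {f} {g} h with m ℕ.≟ n
... | yes eq = cong (_*_ 1ℤ) (h eq)
... | no  _  = refl

-- On solutions ab + ac + bc = n - t², so the weight 6(ab + ac + bc - 3t²) equals 6(n - 4t²) and
-- depends on t alone.
⟦starTerm⟧ : ∀ B n → ⟦_⟧ B n starTerm ≡ + 6 * sumTo B (λ t → (par true t * (+ n - + 4 * (+ t * + t))) * conv (# q₃ 111ₚ B) n t)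
⟦starTerm⟧ B n = trans (sumTo-cong B (λ t → fibre (suc t))) (sumTo-* B (+ 6) (λ t → (par true t * (+ n - + 4 * (+ t * + t))) * conv (# q₃ 111ₚ B) n t))
  where
  weight-on : ∀ t a b c → N.eval ((1 ∷ 0 ∷ 0 ∷ 0 ∷ []) ∷ q₃) (t ∷ a ∷ b ∷ c ∷ []) ≡ n →
    weigh starTerm (t ∷ a ∷ b ∷ c ∷ []) ≡ + 6 * (+ n - + 4 * (+ t * + t))
  weight-on t a b c refl = trans (in-ℤ (+ t) (+ a) (+ b) (+ c)) (cong (λ z → + 6 * (z - + 4 * (+ t * + t))) (sym casts))
    where
    in-ℤ : ∀ t a b c → 0ℤ + (t * (-[1+ 17 ] * t + (+ 0 * a + (+ 0 * b + (+ 0 * c + 0ℤ)))) + (a * (+ 0 * a + (+ 6 * b + (+ 6 * c + 0ℤ))) + (b * (+ 0 * b + (+ 6 * c + 0ℤ)) + (c * (+ 0 * c + 0ℤ) + 0ℤ))))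
                   ≡ + 6 * (t * t + (a * b + (a * c + b * c)) - + 4 * (t * t))
    in-ℤ = solve-∀
    in-ℕ : ∀ t a b c → t ℕ.* (1 ℕ.* t ℕ.+ (0 ℕ.* a ℕ.+ (0 ℕ.* b ℕ.+ (0 ℕ.* c ℕ.+ 0)))) ℕ.+ (a ℕ.* (0 ℕ.* a ℕ.+ (1 ℕ.* b ℕ.+ (1 ℕ.* c ℕ.+ 0))) ℕ.+ (b ℕ.* (0 ℕ.* b ℕ.+ (1 ℕ.* c ℕ.+ 0)) ℕ.+ (c ℕ.* (0 ℕ.* c ℕ.+ 0) ℕ.+ 0))) ≡ t ℕ.* t ℕ.+ (a ℕ.* b ℕ.+ (a ℕ.* c ℕ.+ b ℕ.* c))
    in-ℕ = ℕ-Solver.solve-∀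
    casts : + N.eval ((1 ∷ 0 ∷ 0 ∷ 0 ∷ []) ∷ q₃) (t ∷ a ∷ b ∷ c ∷ []) ≡ + t * + t + (+ a * + b + (+ a * + c + + b * + c))
    casts = trans (cong +_ (in-ℕ t a b c)) (cong₂ _+_ (ℤ.pos-* t t) (cong₂ _+_ (ℤ.pos-* a b) (cong₂ _+_ (ℤ.pos-* a c) (ℤ.pos-* b c))))
  e : ∀ d s p w → d * ((s * p) * (+ 6 * w)) ≡ (+ 6 * (s * w)) * (d * p)
  e = solve-∀
  pointwise : ∀ t xs → Value.value B n starTerm (t ∷ xs) ≡ (+ 6 * (par true t * (+ n - + 4 * (+ t * + t)))) * (conv (δ (N.eval q₃ xs)) n t * pars 111ₚ xs)
  pointwise t xs@(a ∷ b ∷ c ∷ []) = begin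
    δ m n * ((par true t * pars 111ₚ xs) * weigh starTerm (t ∷ xs))
      ≡⟨ δ-subst {m} (λ eq → cong (_*_ (par true t * pars 111ₚ xs)) (weight-on t a b c eq)) ⟩
    δ m n * ((par true t * pars 111ₚ xs) * (+ 6 * W))
      ≡⟨ e (δ m n) (par true t) (pars 111ₚ xs) W ⟩
    (+ 6 * (par true t * W)) * (δ m n * pars 111ₚ xs)
      ≡⟨ cong (λ d → (+ 6 * (par true t * W)) * (d * pars 111ₚ xs)) (trans (cong (λ z → δ z n) form-value) (δ-conv (N.eval q₃ xs) n t)) ⟩
    (+ 6 * (par true t * W)) * (conv (δ (N.eval q₃ xs)) n t * pars 111ₚ xs) ∎
    where
    open ≡-Reasoning
    m : ℕ
    m = N.eval ((1 ∷ 0 ∷ 0 ∷ 0 ∷ []) ∷ q₃) (t ∷ xs)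
    W : ℤ
    W = + n - + 4 * (+ t * + t)
    form-value : m ≡ t ℕ.* t ℕ.+ N.eval q₃ xs
    form-value = cong (ℕ._+ N.eval q₃ xs) (cong (t ℕ.*_) (trans (ℕ.+-identityʳ (t ℕ.+ 0)) (ℕ.+-identityʳ t)))
  fibre : ∀ t → sumVec B 3 (λ xs → Value.value B n starTerm (t ∷ xs)) ≡ + 6 * ((par true t * (+ n - + 4 * (+ t * + t))) * conv (# q₃ 111ₚ B) n t)
  fibre t = begin
    sumVec B 3 (λ xs → Value.value B n starTerm (t ∷ xs))
      ≡⟨ sumVec-cong B 3 (λ xs _ → pointwise t xs) ⟩
    sumVec B 3 (λ xs → (+ 6 * G) * (conv (δ (N.eval q₃ xs)) n t * pars 111ₚ xs))
      ≡⟨ sumVec-* B 3 (+ 6 * G) (λ xs → conv (δ (N.eval q₃ xs)) n t * pars 111ₚ xs) ⟩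
    (+ 6 * G) * sumVec B 3 (λ xs → conv (δ (N.eval q₃ xs)) n t * pars 111ₚ xs)
      ≡⟨ cong (_*_ (+ 6 * G)) (conv-sumVec B 3 (N.eval q₃) (pars 111ₚ) n t) ⟩
    (+ 6 * G) * conv (# q₃ 111ₚ B) n t
      ≡⟨ ℤ.*-assoc (+ 6) G (conv (# q₃ 111ₚ B) n t) ⟩
    + 6 * (G * conv (# q₃ 111ₚ B) n t) ∎
    where
    open ≡-Reasoning
    G : ℤ
    G = par true t * (+ n - + 4 * (+ t * + t))

R₃ : ℕ → ℕ → ℤ
R₃ B N = S B (λ x → S B (λ y → S B (λ z → δ (x ℕ.* x ℕ.+ (y ℕ.* y ℕ.+ z ℕ.* z)) N)))

Φ : ℕ → ℕ → ℕ → ℕ → ℕ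
Φ t x y z = t ℕ.* t ℕ.+ (x ℕ.* x ℕ.+ (y ℕ.* y ℕ.+ z ℕ.* z))

S⁴ : ℕ → (ℕ → ℕ → ℕ → ℕ → ℤ) → ℤ
S⁴ B F = S B (λ t → S B (λ x → S B (λ y → S B (λ z → F t x y z))))

S⁴-cong : ∀ B {F G} → (∀ t x y z → F t x y z ≡ G t x y z) → S⁴ B F ≡ S⁴ B G
S⁴-cong B h = S-cong B (λ t → S-cong B (λ x → S-cong B (λ y → S-cong B (λ z → h t x y z))))

S⁴-+ : ∀ B F G → S⁴ B (λ t x y z → F t x y z + G t x y z) ≡ S⁴ B F + S⁴ B G
S⁴-+ B F G = trans (S-cong B (λ t → trans (S-cong B (λ x → trans (S-cong B (λ y →
    S-+ B (F t x y) (G t x y)))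
    (S-+ B (λ y → S B (F t x y)) (λ y → S B (G t x y)))))
    (S-+ B (λ x → S B (λ y → S B (F t x y))) (λ x → S B (λ y → S B (G t x y))))))
  (S-+ B (λ t → S B (λ x → S B (λ y → S B (F t x y)))) (λ t → S B (λ x → S B (λ y → S B (G t x y)))))

S⁴-scale : ∀ B (g : ℕ → ℤ) (F : ℕ → ℕ → ℕ → ℕ → ℤ) → S B (λ t → g t * S B (λ x → S B (λ y → S B (F t x y)))) ≡ S⁴ B (λ t x y z → g t * F t x y z)
S⁴-scale B g F = S-cong B (λ t → sym (trans (S-cong B (λ x → trans (S-cong B (λ y →
    S-* B (g t) (F t x y)))
    (S-* B (g t) (λ y → S B (F t x y)))))
    (S-* B (g t) (λ x → S B (λ y → S B (F t x y))))))

S⁴-rotate : ∀ B F → S⁴ B (λ a b c d → F d a b c) ≡ S⁴ B F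
S⁴-rotate B F = begin
  S B (λ a → S B (λ b → S B (λ c → S B (λ d → F d a b c)))) ≡⟨ S-cong B (λ a → S-cong B (λ b → S-swap B (λ c d → F d a b c))) ⟩
  S B (λ a → S B (λ b → S B (λ d → S B (λ c → F d a b c)))) ≡⟨ S-cong B (λ a → S-swap B (λ b d → S B (λ c → F d a b c))) ⟩
  S B (λ a → S B (λ d → S B (λ b → S B (λ c → F d a b c)))) ≡⟨ S-swap B (λ a d → S B (λ b → S B (λ c → F d a b c))) ⟩
  S⁴ B F ∎
  where open ≡-Reasoning

Φ-rotate : ∀ t x y z → t ℕ.* t ℕ.+ (x ℕ.* x ℕ.+ (y ℕ.* y ℕ.+ z ℕ.* z)) ≡ x ℕ.* x ℕ.+ (y ℕ.* y ℕ.+ (z ℕ.* z ℕ.+ t ℕ.* t))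
Φ-rotate = ℕ-Solver.solve-∀

-- The left side is the sum Q of g(t) over the quadruples with t² + x² + y² + z² = n in the box.
-- Cyclic rotation shows that g(x), g(y) and g(z) have the same sum, so 4Q is the sum of g(t) + g(x)
-- + g(y) + g(z), which vanishes termwise.
quadruple-identity : ∀ B n (g : ℕ → ℤ) → (∀ t x y z → Φ t x y z ≡ n → g t + (g x + (g y + g z)) ≡ 0ℤ) →
  S B (λ t → g t * conv (R₃ B) n t) ≡ 0ℤ
quadruple-identity B n g h = trans convolve (ℤ.*-cancelˡ-≡ (+ 4) Q 0ℤ (trans (four Q) all-zero))
  where
  open ≡-Reasoning
  F₀ F₁ F₂ F₃ : ℕ → ℕ → ℕ → ℕ → ℤ
  F₀ t x y z = g t * δ (Φ t x y z) n
  F₁ t x y z = g x * δ (Φ t x y z) n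
  F₂ t x y z = g y * δ (Φ t x y z) n
  F₃ t x y z = g z * δ (Φ t x y z) n
  Q = S⁴ B F₀
  F₃≡ : S⁴ B F₃ ≡ Q
  F₃≡ = trans (S⁴-cong B (λ a b c d → cong (λ m → g d * δ m n) (sym (Φ-rotate d a b c)))) (S⁴-rotate B F₀)
  F₂≡ : S⁴ B F₂ ≡ Q
  F₂≡ = trans (S⁴-cong B (λ a b c d → cong (λ m → g c * δ m n) (sym (Φ-rotate d a b c)))) (trans (S⁴-rotate B F₃) F₃≡)
  F₁≡ : S⁴ B F₁ ≡ Q
  F₁≡ = trans (S⁴-cong B (λ a b c d → cong (λ m → g b * δ m n) (sym (Φ-rotate d a b c)))) (trans (S⁴-rotate B F₂) F₂≡)
  four : ∀ q → + 4 * q ≡ q + (q + (q + q))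
  four = solve-∀
  distrib : ∀ a b c d e → a * e + (b * e + (c * e + d * e)) ≡ e * (a + (b + (c + d)))
  distrib = solve-∀
  all-zero : Q + (Q + (Q + Q)) ≡ 0ℤ
  all-zero = begin
    Q + (Q + (Q + Q)) ≡⟨ cong (_+_ Q) (cong₂ _+_ (sym F₁≡) (cong₂ _+_ (sym F₂≡) (sym F₃≡))) ⟩
    Q + (S⁴ B F₁ + (S⁴ B F₂ + S⁴ B F₃)) ≡⟨ cong (_+_ Q) (trans (cong (_+_ (S⁴ B F₁)) (sym (S⁴-+ B F₂ F₃))) (sym (S⁴-+ B F₁ (λ t x y z → F₂ t x y z + F₃ t x y z)))) ⟩
    Q + S⁴ B (λ t x y z → F₁ t x y z + (F₂ t x y z + F₃ t x y z)) ≡⟨ sym (S⁴-+ B F₀ (λ t x y z → F₁ t x y z + (F₂ t x y z + F₃ t x y z))) ⟩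
    S⁴ B (λ t x y z → F₀ t x y z + (F₁ t x y z + (F₂ t x y z + F₃ t x y z)))
      ≡⟨ S⁴-cong B (λ t x y z → trans (distrib (g t) (g x) (g y) (g z) (δ (Φ t x y z) n)) (trans (δ-subst {m = Φ t x y z} (h t x y z)) (ℤ.*-zeroʳ (δ (Φ t x y z) n)))) ⟩
    S⁴ B (λ _ _ _ _ → 0ℤ) ≡⟨ S-zero B (λ _ → S-zero B (λ _ → S-zero B (λ _ → S-0 B))) ⟩
    0ℤ ∎
  sq₃ : ℕ → ℕ → ℕ → ℕ
  sq₃ x y z = x ℕ.* x ℕ.+ (y ℕ.* y ℕ.+ z ℕ.* z)
  fibre : ∀ t → conv (R₃ B) n t ≡ S B (λ x → S B (λ y → S B (λ z → δ (Φ t x y z) n)))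
  fibre t = begin
    conv (R₃ B) n t ≡⟨ conv-S B (λ m x → S B (λ y → S B (λ z → δ (sq₃ x y z) m))) n t ⟩
    S B (λ x → conv (λ m → S B (λ y → S B (λ z → δ (sq₃ x y z) m))) n t)
      ≡⟨ S-cong B (λ x → trans (conv-S B (λ m y → S B (λ z → δ (sq₃ x y z) m)) n t)
          (S-cong B (λ y → trans (conv-S B (λ m z → δ (sq₃ x y z) m) n t) (S-cong B (λ z → sym (δ-conv (sq₃ x y z) n t)))))) ⟩
    S B (λ x → S B (λ y → S B (λ z → δ (Φ t x y z) n))) ∎
  convolve : S B (λ t → g t * conv (R₃ B) n t) ≡ Q
  convolve = trans (S-cong B (λ t → cong (_*_ (g t)) (fibre t))) (S⁴-scale B g (λ t x y z → δ (Φ t x y z) n))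

sumTo-single : ∀ n f → 1 ℕ.≤ n → (∀ i → f (2 ℕ.+ i) ≡ 0ℤ) → sumTo n f ≡ f 1
sumTo-single (suc zero)    f _ h = ℤ.+-identityˡ (f 1)
sumTo-single (suc (suc n)) f _ h = trans (cong₂ _+_ (sumTo-single (suc n) f (s≤s z≤n) h) (h n)) (ℤ.+-identityʳ (f 1))

S-single : ∀ B → 1 ℕ.≤ B → ∀ f → (∀ t → t ≢ 1 → f t ≡ 0ℤ) → S B f ≡ + 2 * f 1
S-single B 1≤B f h = trans (S-def B f) (trans (cong₂ (λ x y → x + + 2 * y) (h 0 (λ ())) (sumTo-single B f 1≤B (λ i → h _ (λ ())))) (ℤ.+-identityˡ (+ 2 * f 1)))

-- This is the induction step of every recursion below: the difference of the two sums reduces to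
-- the contribution of t = ±1, that is of the argument n - 1.
S-unique : ∀ B → 1 ℕ.≤ B → ∀ f h → S B f ≡ 0ℤ → S B h ≡ 0ℤ → (∀ t → t ≢ 1 → f t ≡ h t) → f 1 ≡ h 1
S-unique B 1≤B f h Sf Sh same = ℤ.*-cancelˡ-≡ (+ 2) (f 1) (h 1) (from-difference (trans (sym (S-single B 1≤B (λ t → f t + - 1ℤ * h t) (λ t ne → trans (cong (_+ - 1ℤ * h t) (same t ne)) (cancel (h t)))))
  (trans (S-+ B f (λ t → - 1ℤ * h t)) (cong₂ _+_ Sf (trans (S-* B (- 1ℤ) h) (cong (_*_ (- 1ℤ)) Sh))))))
  where
  cancel : ∀ x → x + - 1ℤ * x ≡ 0ℤ
  cancel = solve-∀
  from-difference : + 2 * (f 1 + - 1ℤ * h 1) ≡ 0ℤ → + 2 * f 1 ≡ + 2 * h 1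
  from-difference eq = trans (split₂ (f 1) (h 1)) (trans (cong (_+ + 2 * h 1) eq) (ℤ.+-identityˡ _))
    where
    split₂ : ∀ x y → + 2 * x ≡ + 2 * (x + - 1ℤ * y) + + 2 * y
    split₂ = solve-∀

-- The implicit `True` argument is found by evaluating the decision for all residues, so a
-- congruence fact costs only its statement.
residue : ∀ m .{{_ : NonZero m}} {P : ℕ → Set} (P? : ∀ r → Dec (P r)) →
  {True (Fin.all? (λ (i : Fin m) → P? (Fin.toℕ i)))} → ∀ n → P (n ℕ.% m)
residue m {P} P? {t} n = subst P (Fin.toℕ-fromℕ< (ℕ.m%n<n n m)) (toWitness t (Fin.fromℕ< (ℕ.m%n<n n m)))

sq%8 : ∀ n → (n ℕ.* n) ℕ.% 8 ≡ ((n ℕ.% 8) ℕ.* (n ℕ.% 8)) ℕ.% 8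
sq%8 n = ℕ.%-distribˡ-* n n 8

odd-sq%8 : ∀ n → odd n ≡ true → (n ℕ.* n) ℕ.% 8 ≡ 1
odd-sq%8 n h = trans (sq%8 n) (residue 8 (λ r → (odd r Bool.≟ true) →-dec ((r ℕ.* r) ℕ.% 8 ℕ.≟ 1)) n (trans (sym (odd-%8 n)) h))

bit : Bool → ℕ
bit b = if b then 1 else 0

sq%4 : ∀ n → (n ℕ.* n) ℕ.% 4 ≡ bit (odd n)
sq%4 n = begin
  (n ℕ.* n) ℕ.% 4 ≡⟨ sym (ℕ.m∣n⇒o%n%m≡o%m 4 8 (n ℕ.* n) (divides 2 refl)) ⟩
  (n ℕ.* n) ℕ.% 8 ℕ.% 4 ≡⟨ cong (ℕ._% 4) (sq%8 n) ⟩
  ((n ℕ.% 8) ℕ.* (n ℕ.% 8)) ℕ.% 8 ℕ.% 4 ≡⟨ residue 8 (λ r → (r ℕ.* r) ℕ.% 8 ℕ.% 4 ℕ.≟ bit (odd r)) n ⟩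
  bit (odd (n ℕ.% 8)) ≡⟨ cong bit (sym (odd-%8 n)) ⟩
  bit (odd n) ∎
  where open ≡-Reasoning

%4-+ : ∀ a b {r s} → a ℕ.% 4 ≡ r → b ℕ.% 4 ≡ s → (a ℕ.+ b) ℕ.% 4 ≡ (r ℕ.+ s) ℕ.% 4
%4-+ a b refl refl = ℕ.%-distribˡ-+ a b 4

%-absorb : ∀ a b → (a ℕ.+ b ℕ.% 4) ℕ.% 4 ≡ (a ℕ.+ b) ℕ.% 4
%-absorb a b = trans (ℕ.%-distribˡ-+ a (b ℕ.% 4) 4) (trans (cong (λ z → (a ℕ.% 4 ℕ.+ z) ℕ.% 4) (ℕ.m%n%n≡m%n b 4)) (sym (ℕ.%-distribˡ-+ a b 4)))

Φ%4 : ∀ t x y z → Φ t x y z ℕ.% 4 ≡ (bit (odd t) ℕ.+ (bit (odd x) ℕ.+ (bit (odd y) ℕ.+ bit (odd z)))) ℕ.% 4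
Φ%4 t x y z = trans (%4-+ (t ℕ.* t) _ (sq%4 t) (trans (%4-+ (x ℕ.* x) _ (sq%4 x) (%4-+ (y ℕ.* y) (z ℕ.* z) (sq%4 y) (sq%4 z))) (%-absorb (bit (odd x)) _)))
  (%-absorb (bit (odd t)) _)

-- A square is 0 or 1 modulo 4 according to parity, so n ≡ 0 forces all four entries even, where
-- every weight is 0, or all odd, where the weights add up to 4n - 4(t² + x² + y² + z²) = 0.
star-quadruple : ∀ n → n ℕ.% 4 ≡ 0 → ∀ t x y z → Φ t x y z ≡ n →
  let g = λ t → par true t * (+ n - + 4 * (+ t * + t)) in g t + (g x + (g y + g z)) ≡ 0ℤ
star-quadruple _ h t x y z refl with odd t | odd x | odd y | odd z | trans (sym (Φ%4 t x y z)) h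
... | false | false | false | false | _ = refl
... | true  | true  | true  | true  | _ = trans (cong (λ n → f n (+ t) + (f n (+ x) + (f n (+ y) + f n (+ z)))) casts) (ring (+ t) (+ x) (+ y) (+ z))
  where
  f : ℤ → ℤ → ℤ
  f n t = 1ℤ * (n - + 4 * (t * t))
  casts : + Φ t x y z ≡ + t * + t + (+ x * + x + (+ y * + y + + z * + z))
  casts = cong₂ _+_ (ℤ.pos-* t t) (cong₂ _+_ (ℤ.pos-* x x) (cong₂ _+_ (ℤ.pos-* y y) (ℤ.pos-* z z)))
  ring : ∀ t x y z → let n = t * t + (x * x + (y * y + z * z)) in
    1ℤ * (n - + 4 * (t * t)) + (1ℤ * (n - + 4 * (x * x)) + (1ℤ * (n - + 4 * (y * y)) + 1ℤ * (n - + 4 * (z * z)))) ≡ 0ℤ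
  ring = solve-∀
... | true  | false | false | false | ()
... | false | true  | false | false | ()
... | false | false | true  | false | ()
... | false | false | false | true  | ()
... | true  | true  | false | false | ()
... | true  | false | true  | false | ()
... | true  | false | false | true  | ()
... | false | true  | true  | false | ()
... | false | true  | false | true  | ()
... | false | false | true  | true  | ()
... | false | true  | true  | true  | ()
... | true  | false | true  | true  | ()
... | true  | true  | false | true  | ()
... | true  | true  | true  | false | ()

-- For n ≡ 3 (mod 4) three of the four entries are odd, whence the values 1 and -3; for n ≡ 2 (mod
-- 4) two are odd and two even, whence the values -1 and 1.
gJ gE : ℕ → ℤ
gJ t = par true t + - (+ 3) * par false t
gE t = par false t + - 1ℤ * par true t

J-quadruple : ∀ n → n ℕ.% 4 ≡ 3 → ∀ t x y z → Φ t x y z ≡ n → gJ t + (gJ x + (gJ y + gJ z)) ≡ 0ℤ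
J-quadruple _ h t x y z refl with odd t | odd x | odd y | odd z | trans (sym (Φ%4 t x y z)) h
... | false | true  | true  | true  | _ = refl
... | true  | false | true  | true  | _ = refl
... | true  | true  | false | true  | _ = refl
... | true  | true  | true  | false | _ = refl
... | false | false | false | false | ()
... | true  | true  | true  | true  | ()
... | true  | false | false | false | ()
... | false | true  | false | false | ()
... | false | false | true  | false | ()
... | false | false | false | true  | ()
... | true  | true  | false | false | ()
... | true  | false | true  | false | ()
... | true  | false | false | true  | ()
... | false | true  | true  | false | ()
... | false | true  | false | true  | ()
... | false | false | true  | true  | ()

E-quadruple : ∀ n → n ℕ.% 4 ≡ 2 → ∀ t x y z → Φ t x y z ≡ n → gE t + (gE x + (gE y + gE z)) ≡ 0ℤ
E-quadruple _ h t x y z refl with odd t | odd x | odd y | odd z | trans (sym (Φ%4 t x y z)) h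
... | true  | true  | false | false | _ = refl
... | true  | false | true  | false | _ = refl
... | true  | false | false | true  | _ = refl
... | false | true  | true  | false | _ = refl
... | false | true  | false | true  | _ = refl
... | false | false | true  | true  | _ = refl
... | false | false | false | false | ()
... | true  | true  | true  | true  | ()
... | true  | false | false | false | ()
... | false | true  | false | false | ()
... | false | false | true  | false | ()
... | false | false | false | true  | ()
... | false | true  | true  | true  | ()
... | true  | false | true  | true  | ()
... | true  | true  | false | true  | ()
... | true  | true  | true  | false | ()

-- Class-number expressions: G₁, G₂, G₃ will turn out to be R₃ on the classes 1, 2, 3 modulo 4.
module Counts (B : ℕ) where

  -- Each G is four times a count of nonnegative solutions of ab + ac + bc = N with the parities in
  -- any order. `#11` and `#10` account for the solutions with one variable 0, which get weight 1/2;
  -- in `G₃` the solutions with all variables odd get weight -1.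
  #111 #110 #100 #11 #10 G₁ G₂ G₃ : ℕ → ℤ
  #111 = # q₃ 111ₚ B
  #110 = # q₃ 110ₚ B
  #100 = # q₃ 100ₚ B
  #11  = # q₂ 11ₚ B
  #10  = # q₂ 10ₚ B
  G₁ N = + 12 * #110 N + + 6 * #11 N
  G₂ N = + 12 * #100 N + + 12 * #10 N
  G₃ N = + 12 * #110 N + (+ 6 * #11 N + - (+ 4) * #111 N)

  U : Bool → (ℕ → ℤ) → ℕ → ℤ
  U s D n = sumTo B (λ t → par s t * conv D n t)

  U-+ : ∀ s D E n → U s (λ m → D m + E m) n ≡ U s D n + U s E n
  U-+ s D E n = trans (sumTo-cong B (λ t → trans (cong (_*_ (par s (suc t))) (conv-+ D E n (suc t))) (ℤ.*-distribˡ-+ (par s (suc t)) (conv D n (suc t)) (conv E n (suc t)))))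
    (sumTo-+ B (λ t → par s t * conv D n t) (λ t → par s t * conv E n t))

  U-* : ∀ s c D n → U s (λ m → c * D m) n ≡ c * U s D n
  U-* s c D n = trans (sumTo-cong B (λ t → trans (cong (_*_ (par s (suc t))) (conv-* c D n (suc t))) (e (par s (suc t)) c (conv D n (suc t)))))
    (sumTo-* B c (λ t → par s t * conv D n t))
    where
    e : ∀ s c d → s * (c * d) ≡ c * (s * d)
    e = solve-∀

  U-G₂ : ∀ s n → U s G₂ n ≡ + 12 * U s #100 n + + 12 * U s #10 n
  U-G₂ s n = trans (U-+ s (λ m → + 12 * #100 m) (λ m → + 12 * #10 m) n) (cong₂ _+_ (U-* s (+ 12) #100 n) (U-* s (+ 12) #10 n))

  U-G₁ : ∀ s n → U s G₁ n ≡ + 12 * U s #110 n + + 6 * U s #11 n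
  U-G₁ s n = trans (U-+ s (λ m → + 12 * #110 m) (λ m → + 6 * #11 m) n) (cong₂ _+_ (U-* s (+ 12) #110 n) (U-* s (+ 6) #11 n))

  U-G₃ : ∀ s n → U s G₃ n ≡ + 12 * U s #110 n + (+ 6 * U s #11 n + - (+ 4) * U s #111 n)
  U-G₃ s n = trans (U-+ s (λ m → + 12 * #110 m) (λ m → + 6 * #11 m + - (+ 4) * #111 m) n)
    (cong₂ _+_ (U-* s (+ 12) #110 n) (trans (U-+ s (λ m → + 6 * #11 m) (λ m → - (+ 4) * #111 m) n) (cong₂ _+_ (U-* s (+ 6) #11 n) (U-* s (- (+ 4)) #111 n))))

  J-identity : ∀ n → n ℕ.≤ B → n ℕ.% 8 ≡ 3 ⊎ n ℕ.% 8 ≡ 7 →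
    S B (λ t → par true t * conv G₂ n t + - (+ 3) * (par false t * conv G₃ n t)) ≡ 0ℤ
  J-identity n n≤B h = begin
    S B F ≡⟨ S-def B F ⟩
    F 0 + + 2 * sumTo B F ≡⟨ cong (λ c → F 0 + + 2 * c) (trans (sumTo-+ B (λ t → par true t * conv G₂ n t) (λ t → - (+ 3) * (par false t * conv G₃ n t))) (cong (_+_ (U true G₂ n)) (sumTo-* B (- (+ 3)) (λ t → par false t * conv G₃ n t)))) ⟩
    F 0 + + 2 * (U true G₂ n + - (+ 3) * U false G₃ n) ≡⟨ cong₂ (λ x y → F 0 + + 2 * (x + - (+ 3) * y)) (U-G₂ true n) (U-G₃ false n) ⟩
    F 0 + + 2 * (+ 12 * U true #100 n + + 12 * U true #10 n + - (+ 3) * (+ 12 * U false #110 n + (+ 6 * U false #11 n + - (+ 4) * U false #111 n)))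
      ≡⟨ ring (U true #100 n) (U true #10 n) (U false #110 n) (U false #111 n) (U false #11 n) (#110 n) (#111 n) (#11 n) (conv G₂ n 0) ⟩
    + 24 * U true #100 n + (+ 24 * U true #10 n + (-[1+ 71 ] * U false #110 n + (+ 24 * U false #111 n + (-[1+ 35 ] * U false #11 n + (-[1+ 35 ] * #110 n + (+ 12 * #111 n + (-[1+ 17 ] * #11 n + 0ℤ)))))))
      ≡⟨ sym (cong₂ _+_ (⟦lift⟧ ● q₃ 100ₚ (+ 24) B n) (cong₂ _+_ (⟦lift⟧ ● q₂ 10ₚ (+ 24) B n) (cong₂ _+_ (⟦lift⟧ ○ q₃ 110ₚ -[1+ 71 ] B n) (cong₂ _+_ (⟦lift⟧ ○ q₃ 111ₚ (+ 24) B n) (cong₂ _+_ (⟦lift⟧ ○ q₂ 11ₚ -[1+ 35 ] B n) (cong₂ _+_ (⟦count⟧ q₃ 110ₚ -[1+ 35 ] B n) (cong₂ _+_ (⟦count⟧ q₃ 111ₚ (+ 12) B n) (cong (_+ 0ℤ) (⟦count⟧ q₂ 11ₚ -[1+ 17 ] B n))))))))) ⟩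
    ⟦_⟧* B n target-J ≡⟨ certificate h ⟩
    0ℤ ∎
    where
    open ≡-Reasoning
    F : ℕ → ℤ
    F t = par true t * conv G₂ n t + - (+ 3) * (par false t * conv G₃ n t)
    ring : ∀ a b c d e x y z w → 0ℤ * w + - (+ 3) * (1ℤ * (+ 12 * x + (+ 6 * z + - (+ 4) * y))) + + 2 * (+ 12 * a + + 12 * b + - (+ 3) * (+ 12 * c + (+ 6 * e + - (+ 4) * d)))
      ≡ + 24 * a + (+ 24 * b + (-[1+ 71 ] * c + (+ 24 * d + (-[1+ 35 ] * e + (-[1+ 35 ] * x + (+ 12 * y + (-[1+ 17 ] * z + 0ℤ)))))))
    ring = solve-∀
    certificate : n ℕ.% 8 ≡ 3 ⊎ n ℕ.% 8 ≡ 7 → ⟦_⟧* B n target-J ≡ 0ℤ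
    certificate (inj₁ e) = certified B n n≤B 3 target-J cert-J e check-J₃
    certificate (inj₂ e) = certified B n n≤B 7 target-J cert-J e check-J₇

  E-identity : ∀ n → n ℕ.≤ B → n ℕ.% 8 ≡ 2 ⊎ n ℕ.% 8 ≡ 6 →
    S B (λ t → par false t * conv G₂ n t + - 1ℤ * (par true t * conv G₁ n t)) ≡ 0ℤ
  E-identity n n≤B h = begin
    S B F ≡⟨ S-def B F ⟩
    F 0 + + 2 * sumTo B F ≡⟨ cong (λ c → F 0 + + 2 * c) (trans (sumTo-+ B (λ t → par false t * conv G₂ n t) (λ t → - 1ℤ * (par true t * conv G₁ n t))) (cong (_+_ (U false G₂ n)) (sumTo-* B (- 1ℤ) (λ t → par true t * conv G₁ n t)))) ⟩
    F 0 + + 2 * (U false G₂ n + - 1ℤ * U true G₁ n) ≡⟨ cong₂ (λ x y → F 0 + + 2 * (x + - 1ℤ * y)) (U-G₂ false n) (U-G₁ true n) ⟩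
    F 0 + + 2 * (+ 12 * U false #100 n + + 12 * U false #10 n + - 1ℤ * (+ 12 * U true #110 n + + 6 * U true #11 n))
      ≡⟨ ring (U false #100 n) (U false #10 n) (U true #110 n) (U true #11 n) (#100 n) (#10 n) (conv G₁ n 0) ⟩
    + 2 * (+ 12 * U false #100 n + (+ 12 * U false #10 n + (-[1+ 11 ] * U true #110 n + (-[1+ 5 ] * U true #11 n + (+ 6 * #100 n + (+ 6 * #10 n + 0ℤ))))))
      ≡⟨ cong (_*_ (+ 2)) (sym (cong₂ _+_ (⟦lift⟧ ○ q₃ 100ₚ (+ 12) B n) (cong₂ _+_ (⟦lift⟧ ○ q₂ 10ₚ (+ 12) B n) (cong₂ _+_ (⟦lift⟧ ● q₃ 110ₚ -[1+ 11 ] B n) (cong₂ _+_ (⟦lift⟧ ● q₂ 11ₚ -[1+ 5 ] B n) (cong₂ _+_ (⟦count⟧ q₃ 100ₚ (+ 6) B n) (cong (_+ 0ℤ) (⟦count⟧ q₂ 10ₚ (+ 6) B n)))))))) ⟩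
    + 2 * ⟦_⟧* B n target-ev ≡⟨ cong (_*_ (+ 2)) (certificate h) ⟩
    0ℤ ∎
    where
    open ≡-Reasoning
    F : ℕ → ℤ
    F t = par false t * conv G₂ n t + - 1ℤ * (par true t * conv G₁ n t)
    ring : ∀ a b c d x y w → 1ℤ * (+ 12 * x + + 12 * y) + - 1ℤ * (0ℤ * w) + + 2 * (+ 12 * a + + 12 * b + - 1ℤ * (+ 12 * c + + 6 * d))
      ≡ + 2 * (+ 12 * a + (+ 12 * b + (-[1+ 11 ] * c + (-[1+ 5 ] * d + (+ 6 * x + (+ 6 * y + 0ℤ))))))
    ring = solve-∀
    certificate : n ℕ.% 8 ≡ 2 ⊎ n ℕ.% 8 ≡ 6 → ⟦_⟧* B n target-ev ≡ 0ℤ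
    certificate (inj₁ e) = certified B n n≤B 2 target-ev cert-ev e check-ev₂
    certificate (inj₂ e) = certified B n n≤B 6 target-ev cert-ev e check-ev₆

  star-weight : ℕ → ℕ → ℤ
  star-weight n t = par true t * (+ n - + 4 * (+ t * + t))

  star-identity : ∀ n → n ℕ.≤ B → n ℕ.% 8 ≡ 4 → S B (λ t → star-weight n t * conv (λ m → + 8 * #111 m) n t) ≡ 0ℤ
  star-identity n n≤B h = begin
    S B (λ t → star-weight n t * conv (λ m → + 8 * #111 m) n t) ≡⟨ S-cong B (λ t → trans (cong (_*_ (star-weight n t)) (conv-* (+ 8) #111 n t)) (e (star-weight n t) (+ 8) (conv #111 n t))) ⟩
    S B (λ t → + 8 * (star-weight n t * conv #111 n t)) ≡⟨ S-* B (+ 8) (λ t → star-weight n t * conv #111 n t) ⟩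
    + 8 * S B (λ t → star-weight n t * conv #111 n t) ≡⟨ cong (_*_ (+ 8)) (trans (S-def B (λ t → star-weight n t * conv #111 n t)) (cong (λ z → 0ℤ + + 2 * z) zero-sum)) ⟩
    0ℤ ∎
    where
    open ≡-Reasoning
    e : ∀ s c d → s * (c * d) ≡ c * (s * d)
    e = solve-∀
    zero-sum : sumTo B (λ t → star-weight n t * conv #111 n t) ≡ 0ℤ
    zero-sum = ℤ.*-cancelˡ-≡ (+ 6) (sumTo B (λ t → star-weight n t * conv #111 n t)) 0ℤ
      (trans (sym (⟦starTerm⟧ B n)) (trans (sym (ℤ.+-identityʳ (⟦_⟧ B n starTerm))) (certified B n n≤B 4 target-star cert-star h check-star)))

  -- The certificate says 6 `#110` + 3 `#11` = 6 `#111`, and 12 - 4 = 8. In `class₇` the right side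
  -- is 2 `#111` instead, and 4 - 4 = 0.
  class₃ : ∀ n → n ℕ.≤ B → n ℕ.% 8 ≡ 3 → G₃ n ≡ + 8 * #111 n
  class₃ n n≤B h = trans (ring (#110 n) (#11 n) (#111 n)) (trans (cong (λ z → + 2 * z + + 8 * #111 n) combination) (ℤ.+-identityˡ (+ 8 * #111 n)))
    where
    ring : ∀ a b c → + 12 * a + (+ 6 * b + - (+ 4) * c) ≡ + 2 * (+ 6 * a + (+ 3 * b + (-[1+ 5 ] * c + 0ℤ))) + + 8 * c
    ring = solve-∀
    combination : + 6 * #110 n + (+ 3 * #11 n + (-[1+ 5 ] * #111 n + 0ℤ)) ≡ 0ℤ
    combination = trans (sym (cong₂ _+_ (⟦count⟧ q₃ 110ₚ (+ 6) B n) (cong₂ _+_ (⟦count⟧ q₂ 11ₚ (+ 3) B n) (cong (_+ 0ℤ) (⟦count⟧ q₃ 111ₚ -[1+ 5 ] B n)))))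
      (certified B n n≤B 3 target-cls3 cert-cls3 h check-cls3)

  class₇ : ∀ n → n ℕ.≤ B → n ℕ.% 8 ≡ 7 → G₃ n ≡ 0ℤ
  class₇ n n≤B h = trans (ring (#110 n) (#11 n) (#111 n)) (cong (_*_ (+ 2)) combination)
    where
    ring : ∀ a b c → + 12 * a + (+ 6 * b + - (+ 4) * c) ≡ + 2 * (+ 6 * a + (+ 3 * b + (-[1+ 1 ] * c + 0ℤ)))
    ring = solve-∀
    combination : + 6 * #110 n + (+ 3 * #11 n + (-[1+ 1 ] * #111 n + 0ℤ)) ≡ 0ℤ
    combination = trans (sym (cong₂ _+_ (⟦count⟧ q₃ 110ₚ (+ 6) B n) (cong₂ _+_ (⟦count⟧ q₂ 11ₚ (+ 3) B n) (cong (_+ 0ℤ) (⟦count⟧ q₃ 111ₚ -[1+ 1 ] B n)))))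
      (certified B n n≤B 7 target-cls7 cert-cls7 h check-cls7)

%8%4 : ∀ n → n ℕ.% 8 ℕ.% 4 ≡ n ℕ.% 4
%8%4 n = ℕ.m∣n⇒o%n%m≡o%m 4 8 n (divides 2 refl)

remainder : ∀ m .{{_ : NonZero m}} n {a} → a ℕ.≤ n → n ℕ.% m ≡ ((a ℕ.% m) ℕ.+ ((n ℕ.∸ a) ℕ.% m)) ℕ.% m
remainder m n {a} a≤n = trans (cong (ℕ._% m) (sym (ℕ.m+[n∸m]≡n a≤n))) (ℕ.%-distribˡ-+ a (n ℕ.∸ a) m)

odd⇒bit : ∀ {n} → odd n ≡ true → (n ℕ.* n) ℕ.% 4 ≡ 1
odd⇒bit {n} h = trans (sq%4 n) (cong bit h)

even⇒bit : ∀ {n} → odd n ≡ false → (n ℕ.* n) ℕ.% 4 ≡ 0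
even⇒bit {n} h = trans (sq%4 n) (cong bit h)

all-odd : ∀ x y z {N} → x ℕ.* x ℕ.+ (y ℕ.* y ℕ.+ z ℕ.* z) ≡ N → N ℕ.% 4 ≡ 3 → odd x ≡ true × odd y ≡ true × odd z ≡ true
all-odd x y z refl h with odd x | odd y | odd z | trans (sym (Φ%4 0 x y z)) h
... | true  | true  | true  | _ = refl , refl , refl
... | false | false | false | ()
... | true  | false | false | ()
... | false | true  | false | ()
... | false | false | true  | ()
... | true  | true  | false | ()
... | true  | false | true  | ()
... | false | true  | true  | ()

≢1∧odd⇒≥2 : ∀ {t} → odd t ≡ true → t ≢ 1 → 2 ℕ.≤ t
≢1∧odd⇒≥2 {suc zero}    _ h = ⊥-elim (h refl)
≢1∧odd⇒≥2 {suc (suc t)} _ _ = s≤s (s≤s z≤n)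

all-ones : ∀ x y z → x ℕ.* x ℕ.+ (y ℕ.* y ℕ.+ z ℕ.* z) ≡ 3 → x ≡ 1 × y ≡ 1 × z ≡ 1
all-ones x y z eq = let (ox , oy , oz) = all-odd x y z eq refl in
    one x ox (ℕ.m≤m+n (x ℕ.* x) _)
  , one y oy (ℕ.≤-trans (ℕ.m≤m+n (y ℕ.* y) (z ℕ.* z)) (ℕ.m≤n+m _ (x ℕ.* x)))
  , one z oz (ℕ.≤-trans (ℕ.m≤n+m (z ℕ.* z) (y ℕ.* y)) (ℕ.m≤n+m _ (x ℕ.* x)))
  where
  one : ∀ n → odd n ≡ true → n ℕ.* n ℕ.≤ x ℕ.* x ℕ.+ (y ℕ.* y ℕ.+ z ℕ.* z) → n ≡ 1
  one n o n²≤ with n ℕ.≟ 1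
  ... | yes n≡1 = n≡1
  ... | no  n≢1 = ⊥-elim (ℕ.1+n≰n (ℕ.≤-trans (ℕ.*-mono-≤ {2} {n} (≢1∧odd⇒≥2 o n≢1) (≢1∧odd⇒≥2 o n≢1)) (subst (n ℕ.* n ℕ.≤_) eq n²≤)))

q₃-value : ∀ a b c → N.eval q₃ (a ∷ b ∷ c ∷ []) ≡ a ℕ.* b ℕ.+ (a ℕ.* c ℕ.+ b ℕ.* c)
q₃-value a b c = ring a b c
  where
  ring : ∀ a b c → a ℕ.* (0 ℕ.* a ℕ.+ (1 ℕ.* b ℕ.+ (1 ℕ.* c ℕ.+ 0))) ℕ.+ (b ℕ.* (0 ℕ.* b ℕ.+ (1 ℕ.* c ℕ.+ 0)) ℕ.+ (c ℕ.* (0 ℕ.* c ℕ.+ 0) ℕ.+ 0)) ≡ a ℕ.* b ℕ.+ (a ℕ.* c ℕ.+ b ℕ.* c)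
  ring = ℕ-Solver.solve-∀

q₂-value : ∀ a b → N.eval q₂ (a ∷ b ∷ []) ≡ a ℕ.* b
q₂-value a b = ring a b
  where
  ring : ∀ a b → a ℕ.* (0 ℕ.* a ℕ.+ (1 ℕ.* b ℕ.+ 0)) ℕ.+ (b ℕ.* (0 ℕ.* b ℕ.+ 0) ℕ.+ 0) ≡ a ℕ.* b
  ring = ℕ-Solver.solve-∀

unit-triple : ∀ a b c → N.eval q₃ (suc a ∷ suc b ∷ suc c ∷ []) ≡ 3 → a ≡ 0 × b ≡ 0 × c ≡ 0
unit-triple zero    zero    zero    _  = refl , refl , refl
unit-triple (suc a) b c eq with trans (sym (trans (q₃-value (2 ℕ.+ a) (suc b) (suc c)) (ring a b c))) eq
  where
  ring : ∀ a b c → (2 ℕ.+ a) ℕ.* (1 ℕ.+ b) ℕ.+ ((2 ℕ.+ a) ℕ.* (1 ℕ.+ c) ℕ.+ (1 ℕ.+ b) ℕ.* (1 ℕ.+ c)) ≡ 5 ℕ.+ (2 ℕ.* a ℕ.+ 3 ℕ.* b ℕ.+ 3 ℕ.* c ℕ.+ a ℕ.* b ℕ.+ a ℕ.* c ℕ.+ b ℕ.* c)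
  ring = ℕ-Solver.solve-∀
... | ()
unit-triple zero (suc b) c eq with trans (sym (trans (q₃-value 1 (2 ℕ.+ b) (suc c)) (ring b c))) eq
  where
  ring : ∀ b c → 1 ℕ.* (2 ℕ.+ b) ℕ.+ (1 ℕ.* (1 ℕ.+ c) ℕ.+ (2 ℕ.+ b) ℕ.* (1 ℕ.+ c)) ≡ 5 ℕ.+ (2 ℕ.* b ℕ.+ 3 ℕ.* c ℕ.+ b ℕ.* c)
  ring = ℕ-Solver.solve-∀
... | ()
unit-triple zero zero (suc c) eq with trans (sym (trans (q₃-value 1 1 (2 ℕ.+ c)) (ring c))) eq
  where
  ring : ∀ c → 1 ℕ.* 1 ℕ.+ (1 ℕ.* (2 ℕ.+ c) ℕ.+ 1 ℕ.* (2 ℕ.+ c)) ≡ 5 ℕ.+ 2 ℕ.* c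
  ring = ℕ-Solver.solve-∀
... | ()

odd-%4 : ∀ n → odd n ≡ odd (n ℕ.% 4)
odd-%4 n = trans (odd-%8 n) (trans (residue 8 (λ r → odd r Bool.≟ odd (r ℕ.% 4)) n) (cong odd (%8%4 n)))

module Recursion (B : ℕ) (1≤B : 1 ℕ.≤ B) where

  open Counts B

  R : ℕ → ℤ
  R = R₃ B

  R-3 : R 3 ≡ + 8
  R-3 = trans (S-single B 1≤B (λ x → S B (λ y → S B (λ z → δ (x ℕ.* x ℕ.+ (y ℕ.* y ℕ.+ z ℕ.* z)) 3)))
                (λ x x≢1 → S-zero B (λ y → S-zero B (λ z → δ-≢ (λ eq → x≢1 (proj₁ (all-ones x y z eq)))))))
       (cong (_*_ (+ 2)) (trans (S-single B 1≤B (λ y → S B (λ z → δ (1 ℕ.+ (y ℕ.* y ℕ.+ z ℕ.* z)) 3))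
                (λ y y≢1 → S-zero B (λ z → δ-≢ (λ eq → y≢1 (proj₁ (proj₂ (all-ones 1 y z eq)))))))
       (cong (_*_ (+ 2)) (S-single B 1≤B (λ z → δ (1 ℕ.+ (1 ℕ.+ z ℕ.* z)) 3)
                (λ z z≢1 → δ-≢ (λ eq → z≢1 (proj₂ (proj₂ (all-ones 1 1 z eq)))))))))

  #111-3 : #111 3 ≡ + 1
  #111-3 = trans (sumTo-single B (λ x → sumTo B (λ y → sumTo B (λ z → v x y z))) 1≤B
                   (λ i → sumTo-zero B (λ j → sumTo-zero B (λ k → vanish (suc i) j k (λ ())))))
          (trans (sumTo-single B (λ y → sumTo B (λ z → v 1 y z)) 1≤B (λ j → sumTo-zero B (λ k → vanish₂ (suc j) k (λ ()))))
                 (sumTo-single B (λ z → v 1 1 z) 1≤B (λ k → vanish₃ (suc k) (λ ()))))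
    where
    v : ℕ → ℕ → ℕ → ℤ
    v x y z = δ (N.eval q₃ (x ∷ y ∷ z ∷ [])) 3 * pars 111ₚ (x ∷ y ∷ z ∷ [])
    vanish : ∀ i j k → i ≢ 0 → v (suc i) (suc j) (suc k) ≡ 0ℤ
    vanish i j k i≢0 = cong (_* pars 111ₚ (suc i ∷ suc j ∷ suc k ∷ [])) (δ-≢ (λ eq → i≢0 (proj₁ (unit-triple i j k eq))))
    vanish₂ : ∀ j k → j ≢ 0 → v 1 (suc j) (suc k) ≡ 0ℤ
    vanish₂ j k j≢0 = cong (_* pars 111ₚ (1 ∷ suc j ∷ suc k ∷ [])) (δ-≢ (λ eq → j≢0 (proj₁ (proj₂ (unit-triple 0 j k eq)))))
    vanish₃ : ∀ k → k ≢ 0 → v 1 1 (suc k) ≡ 0ℤ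
    vanish₃ k k≢0 = cong (_* pars 111ₚ (1 ∷ 1 ∷ suc k ∷ [])) (δ-≢ (λ eq → k≢0 (proj₂ (proj₂ (unit-triple 0 0 k eq)))))

  smaller : ∀ {N t} → 2 ℕ.≤ t → t ℕ.* t ℕ.≤ suc N → suc N ℕ.∸ t ℕ.* t ℕ.< N
  smaller {N} {t} 2≤t t²≤n = ℕ.+-cancelˡ-< (t ℕ.* t) _ _ (subst (ℕ._< t ℕ.* t ℕ.+ N) (sym (ℕ.m+[n∸m]≡n t²≤n))
    (ℕ.≤-trans (s≤s (ℕ.n≤1+n (suc N))) (ℕ.≤-trans (ℕ.n≤1+n _) (ℕ.+-monoˡ-≤ N (ℕ.*-mono-≤ {2} {t} 2≤t 2≤t)))))

  -- Take n = N + 1 ≡ 4 (mod 8). Only odd t carry weight, and they lead to n - t² ≡ 3 (mod 8), which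
  -- is less than N for t ≥ 3.
  R≡8#111 : ∀ N → N ℕ.% 8 ≡ 3 → suc N ℕ.≤ B → R N ≡ + 8 * #111 N
  R≡8#111 = <-rec (λ N → N ℕ.% 8 ≡ 3 → suc N ℕ.≤ B → R N ≡ + 8 * #111 N) step
    where
    step : ∀ N → (∀ {M} → M ℕ.< N → M ℕ.% 8 ≡ 3 → suc M ℕ.≤ B → R M ≡ + 8 * #111 M) → N ℕ.% 8 ≡ 3 → suc N ℕ.≤ B → R N ≡ + 8 * #111 N
    step N ih h n≤B with N ℕ.≟ 3
    -- The weight at t = 1 is n - 4 = N - 3. It vanishes exactly at N = 3, where the recurrence says
    -- nothing and both sides are computed.
    ... | yes refl = trans R-3 (cong (_*_ (+ 8)) (sym #111-3))
    ... | no  N≢3  = leading N h N≢3 (S-unique B 1≤B (λ t → star-weight n t * conv R n t) (λ t → star-weight n t * conv (λ m → + 8 * #111 m) n t)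
            (quadruple-identity B n (star-weight n) (star-quadruple n (trans (sym (%8%4 n)) (cong (ℕ._% 4) n%8))))
            (star-identity n n≤B n%8) same)
      where
      n = suc N
      n%8 : n ℕ.% 8 ≡ 4
      n%8 = trans (ℕ.%-distribˡ-+ 1 N 8) (cong (λ r → (1 ℕ.+ r) ℕ.% 8) h)
      leading : ∀ N → N ℕ.% 8 ≡ 3 → N ≢ 3 → star-weight (suc N) 1 * R N ≡ star-weight (suc N) 1 * (+ 8 * #111 N) → R N ≡ + 8 * #111 N
      leading 3 h N≢3 eq = ⊥-elim (N≢3 refl)
      leading (suc (suc (suc (suc m)))) h N≢3 eq = ℤ.*-cancelˡ-≡ (+ 1 * + (suc m)) (R (4 ℕ.+ m)) (+ 8 * #111 (4 ℕ.+ m)) eq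
      same : ∀ t → t ≢ 1 → star-weight n t * conv R n t ≡ star-weight n t * conv (λ m → + 8 * #111 m) n t
      same t t≢1 with odd t in ot
      ... | false = refl
      ... | true  = cong (_*_ (1ℤ * (+ n - + 4 * (+ t * + t)))) (conv-cong n t (λ t²≤n →
          let s = smaller (≢1∧odd⇒≥2 ot t≢1) t²≤n in
          ih s (residue 8 (λ r → ((1 ℕ.+ r) ℕ.% 8 ℕ.≟ 4) →-dec (r ℕ.≟ 3)) (n ℕ.∸ t ℕ.* t)
                 (trans (cong (λ u → (u ℕ.+ ((n ℕ.∸ t ℕ.* t) ℕ.% 8)) ℕ.% 8) (sym (odd-sq%8 t ot))) (trans (sym (remainder 8 n t²≤n)) n%8)))
            (ℕ.≤-trans (ℕ.<⇒≤ (s≤s s)) n≤B)))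

  R≡G₃ : ∀ N → N ℕ.% 4 ≡ 3 → suc N ℕ.≤ B → R N ≡ G₃ N
  R≡G₃ N h n≤B with residue 8 (λ r → (r ℕ.% 4 ℕ.≟ 3) →-dec ((r ℕ.≟ 3) ⊎-dec (r ℕ.≟ 7))) N (trans (%8%4 N) h)
  ... | inj₁ r3 = trans (R≡8#111 N r3 n≤B) (sym (class₃ N (ℕ.<⇒≤ n≤B) r3))
  -- Both sides are 0: N ≡ 3 (mod 4) makes all three roots odd, and three odd squares add up to 3
  -- modulo 8.
  ... | inj₂ r7 = trans (S-zero B (λ x → S-zero B (λ y → S-zero B (λ z → δ-≢ (none x y z))))) (sym (class₇ N (ℕ.<⇒≤ n≤B) r7))
    where
    none : ∀ x y z → x ℕ.* x ℕ.+ (y ℕ.* y ℕ.+ z ℕ.* z) ≢ N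
    none x y z eq with trans (sym r7) (trans (cong (ℕ._% 8) (sym eq)) sum-3)
      where
      sum-3 : (x ℕ.* x ℕ.+ (y ℕ.* y ℕ.+ z ℕ.* z)) ℕ.% 8 ≡ 3
      sum-3 = let (ox , oy , oz) = all-odd x y z eq h in
        trans (ℕ.%-distribˡ-+ (x ℕ.* x) _ 8) (cong₂ (λ u v → (u ℕ.+ v) ℕ.% 8) (odd-sq%8 x ox)
          (trans (ℕ.%-distribˡ-+ (y ℕ.* y) (z ℕ.* z) 8) (cong₂ (λ u v → (u ℕ.+ v) ℕ.% 8) (odd-sq%8 y oy) (odd-sq%8 z oz))))
    ... | ()

  -- Take n = N + 1 ≡ 3 (mod 4). Odd t lead to n - t² ≡ 2, the class under induction; even t lead to
  -- n - t² ≡ 3, settled by `R≡G₃`. The latter is needed even at n itself (t = 0), which explains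
  -- the bound 2 + N.
  R≡G₂ : ∀ N → N ℕ.% 4 ≡ 2 → 2 ℕ.+ N ℕ.≤ B → R N ≡ G₂ N
  R≡G₂ = <-rec (λ N → N ℕ.% 4 ≡ 2 → 2 ℕ.+ N ℕ.≤ B → R N ≡ G₂ N) step
    where
    step : ∀ N → (∀ {M} → M ℕ.< N → M ℕ.% 4 ≡ 2 → 2 ℕ.+ M ℕ.≤ B → R M ≡ G₂ M) → N ℕ.% 4 ≡ 2 → 2 ℕ.+ N ℕ.≤ B → R N ≡ G₂ N
    step N ih h b≤ = simplify (R N) (G₂ N) (conv G₃ n 1) (S-unique B 1≤B (λ t → gJ t * conv R n t) F
        (quadruple-identity B n gJ (J-quadruple n n%4))
        (J-identity n (ℕ.<⇒≤ b≤) (residue 8 (λ r → (r ℕ.% 4 ℕ.≟ 3) →-dec ((r ℕ.≟ 3) ⊎-dec (r ℕ.≟ 7))) n (trans (%8%4 n) n%4))) same)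
      where
      n = suc N
      n%4 : n ℕ.% 4 ≡ 3
      n%4 = trans (ℕ.%-distribˡ-+ 1 N 4) (cong (λ r → (1 ℕ.+ r) ℕ.% 4) h)
      F : ℕ → ℤ
      F t = par true t * conv G₂ n t + - (+ 3) * (par false t * conv G₃ n t)
      simplify : ∀ r g u → (1ℤ + - (+ 3) * 0ℤ) * r ≡ 1ℤ * g + - (+ 3) * (0ℤ * u) → r ≡ g
      simplify r g u eq = trans (trans (e₁ r) eq) (e₂ g u)
        where
        e₁ : ∀ r → r ≡ (1ℤ + - (+ 3) * 0ℤ) * r
        e₁ = solve-∀
        e₂ : ∀ g u → 1ℤ * g + - (+ 3) * (0ℤ * u) ≡ g
        e₂ = solve-∀
      same : ∀ t → t ≢ 1 → gJ t * conv R n t ≡ F t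
      same t t≢1 with odd t in ot
      ... | true  = trans (cong (_*_ (1ℤ + - (+ 3) * 0ℤ)) (conv-cong n t (λ t²≤n →
              let s = smaller (≢1∧odd⇒≥2 ot t≢1) t²≤n in
              ih s (residue 4 (λ r → ((1 ℕ.+ r) ℕ.% 4 ℕ.≟ 3) →-dec (r ℕ.≟ 2)) (n ℕ.∸ t ℕ.* t)
                     (trans (cong (λ u → (u ℕ.+ ((n ℕ.∸ t ℕ.* t) ℕ.% 4)) ℕ.% 4) (sym (odd⇒bit {t} ot))) (trans (sym (remainder 4 n t²≤n)) n%4)))
                (ℕ.≤-trans (ℕ.<⇒≤ (s≤s (s≤s s))) b≤))))
            (e (conv G₂ n t) (conv G₃ n t))
        where
        e : ∀ x y → (1ℤ + - (+ 3) * 0ℤ) * x ≡ 1ℤ * x + - (+ 3) * (0ℤ * y)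
        e = solve-∀
      ... | false = trans (cong (_*_ (0ℤ + - (+ 3) * 1ℤ)) (conv-cong n t (λ t²≤n →
              R≡G₃ (n ℕ.∸ t ℕ.* t) (residue 4 (λ r → ((0 ℕ.+ r) ℕ.% 4 ℕ.≟ 3) →-dec (r ℕ.≟ 3)) (n ℕ.∸ t ℕ.* t)
                     (trans (cong (λ u → (u ℕ.+ ((n ℕ.∸ t ℕ.* t) ℕ.% 4)) ℕ.% 4) (sym (even⇒bit {t} ot))) (trans (sym (remainder 4 n t²≤n)) n%4)))
                (ℕ.≤-trans (s≤s (ℕ.m∸n≤m n (t ℕ.* t))) b≤))))
            (e (conv G₂ n t) (conv G₃ n t))
        where
        e : ∀ x y → (0ℤ + - (+ 3) * 1ℤ) * y ≡ 0ℤ * x + - (+ 3) * (1ℤ * y)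
        e = solve-∀

  -- The same scheme with n = N + 1 ≡ 2 (mod 4): odd t stay in the class 1, even t fall into the
  -- class 2. The value t = 0 calls `R≡G₂` at N + 1, hence the bound 3 + N, which is the B chosen in
  -- `three-squares`.
  R≡G₁ : ∀ N → N ℕ.% 4 ≡ 1 → 3 ℕ.+ N ℕ.≤ B → R N ≡ G₁ N
  R≡G₁ = <-rec (λ N → N ℕ.% 4 ≡ 1 → 3 ℕ.+ N ℕ.≤ B → R N ≡ G₁ N) step
    where
    step : ∀ N → (∀ {M} → M ℕ.< N → M ℕ.% 4 ≡ 1 → 3 ℕ.+ M ℕ.≤ B → R M ≡ G₁ M) → N ℕ.% 4 ≡ 1 → 3 ℕ.+ N ℕ.≤ B → R N ≡ G₁ N
    step N ih h b≤ = simplify (R N) (G₁ N) (conv G₂ n 1) (S-unique B 1≤B (λ t → gE t * conv R n t) F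
        (quadruple-identity B n gE (E-quadruple n n%4))
        (E-identity n (ℕ.<⇒≤ (ℕ.<⇒≤ b≤)) (residue 8 (λ r → (r ℕ.% 4 ℕ.≟ 2) →-dec ((r ℕ.≟ 2) ⊎-dec (r ℕ.≟ 6))) n (trans (%8%4 n) n%4))) same)
      where
      n = suc N
      n%4 : n ℕ.% 4 ≡ 2
      n%4 = trans (ℕ.%-distribˡ-+ 1 N 4) (cong (λ r → (1 ℕ.+ r) ℕ.% 4) h)
      F : ℕ → ℤ
      F t = par false t * conv G₂ n t + - 1ℤ * (par true t * conv G₁ n t)
      simplify : ∀ r g u → (0ℤ + - 1ℤ * 1ℤ) * r ≡ 0ℤ * u + - 1ℤ * (1ℤ * g) → r ≡ g
      simplify r g u eq = trans (e₁ r) (trans (cong (_*_ (- 1ℤ)) eq) (e₂ g u))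
        where
        e₁ : ∀ r → r ≡ - 1ℤ * ((0ℤ + - 1ℤ * 1ℤ) * r)
        e₁ = solve-∀
        e₂ : ∀ g u → - 1ℤ * (0ℤ * u + - 1ℤ * (1ℤ * g)) ≡ g
        e₂ = solve-∀
      same : ∀ t → t ≢ 1 → gE t * conv R n t ≡ F t
      same t t≢1 with odd t in ot
      ... | true  = trans (cong (_*_ (0ℤ + - 1ℤ * 1ℤ)) (conv-cong n t (λ t²≤n →
              let s = smaller (≢1∧odd⇒≥2 ot t≢1) t²≤n in
              ih s (residue 4 (λ r → ((1 ℕ.+ r) ℕ.% 4 ℕ.≟ 2) →-dec (r ℕ.≟ 1)) (n ℕ.∸ t ℕ.* t)
                     (trans (cong (λ u → (u ℕ.+ ((n ℕ.∸ t ℕ.* t) ℕ.% 4)) ℕ.% 4) (sym (odd⇒bit {t} ot))) (trans (sym (remainder 4 n t²≤n)) n%4)))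
                (ℕ.≤-trans (ℕ.<⇒≤ (s≤s (s≤s (s≤s s)))) b≤))))
            (e (conv G₂ n t) (conv G₁ n t))
        where
        e : ∀ x y → (0ℤ + - 1ℤ * 1ℤ) * y ≡ 0ℤ * x + - 1ℤ * (1ℤ * y)
        e = solve-∀
      ... | false = trans (cong (_*_ (1ℤ + - 1ℤ * 0ℤ)) (conv-cong n t (λ t²≤n →
              R≡G₂ (n ℕ.∸ t ℕ.* t) (residue 4 (λ r → ((0 ℕ.+ r) ℕ.% 4 ℕ.≟ 2) →-dec (r ℕ.≟ 2)) (n ℕ.∸ t ℕ.* t)
                     (trans (cong (λ u → (u ℕ.+ ((n ℕ.∸ t ℕ.* t) ℕ.% 4)) ℕ.% 4) (sym (even⇒bit {t} ot))) (trans (sym (remainder 4 n t²≤n)) n%4)))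
                (ℕ.≤-trans (s≤s (s≤s (ℕ.m∸n≤m n (t ℕ.* t)))) b≤))))
            (e (conv G₂ n t) (conv G₁ n t))
        where
        e : ∀ x y → (1ℤ + - 1ℤ * 0ℤ) * x ≡ 1ℤ * x + - 1ℤ * (0ℤ * y)
        e = solve-∀

-- Positivity of the counts and the three squares theorem.

sumTo-≥0 : ∀ n {f} → (∀ i → 0ℤ ℤ.≤ f i) → 0ℤ ℤ.≤ sumTo n f
sumTo-≥0 zero    h = ℤ.≤-refl
sumTo-≥0 (suc n) h = ℤ.+-mono-≤ (sumTo-≥0 n h) (h (suc n))

sumTo-≥ : ∀ n {f} k → (∀ i → 0ℤ ℤ.≤ f i) → 1 ℕ.≤ k → k ℕ.≤ n → f k ℤ.≤ sumTo n f
sumTo-≥ (suc n) {f} k h 1≤k k≤n with k ℕ.≟ suc n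
... | yes refl = subst (ℤ._≤ sumTo n f + f (suc n)) (ℤ.+-identityˡ (f (suc n))) (ℤ.+-monoˡ-≤ (f (suc n)) (sumTo-≥0 n h))
... | no  k≢n  = subst (ℤ._≤ sumTo n f + f (suc n)) (ℤ.+-identityʳ (f k)) (ℤ.+-mono-≤ (sumTo-≥ n k h 1≤k (ℕ.≤-pred (ℕ.≤∧≢⇒< k≤n k≢n))) (h (suc n)))
sumTo-≥ zero k h (s≤s _) ()

par-≥0 : ∀ b n → 0ℤ ℤ.≤ par b n
par-≥0 b n with b xor odd n
... | true  = ℤ.≤-refl
... | false = ℤ.+≤+ z≤n

δ-≥0 : ∀ m n → 0ℤ ℤ.≤ δ m n
δ-≥0 m n with m ℕ.≟ n
... | yes _ = ℤ.+≤+ z≤n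
... | no  _ = ℤ.≤-refl

*-≥0 : ∀ {a b} → 0ℤ ℤ.≤ a → 0ℤ ℤ.≤ b → 0ℤ ℤ.≤ a * b
*-≥0 {+ a} {+ b} _ _ = subst (0ℤ ℤ.≤_) (ℤ.pos-* a b) (ℤ.+≤+ z≤n)

pars-≥0 : ∀ {k} (p : Vec Bool k) x → 0ℤ ℤ.≤ pars p x
pars-≥0 []      []       = ℤ.+≤+ z≤n
pars-≥0 (b ∷ p) (x ∷ xs) = *-≥0 (par-≥0 b x) (pars-≥0 p xs)

sumVec-≥0 : ∀ B k {f : Vec ℕ k → ℤ} → (∀ x → 0ℤ ℤ.≤ f x) → 0ℤ ℤ.≤ sumVec B k f
sumVec-≥0 B zero    h = h []
sumVec-≥0 B (suc k) h = sumTo-≥0 B (λ i → sumVec-≥0 B k (λ xs → h (i ∷ xs)))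

data InBox (B : ℕ) : ∀ {k} → Vec ℕ k → Set where
  []  : InBox B []
  _∷_ : ∀ {k x} {xs : Vec ℕ k} → (1 ℕ.≤ x) × (x ℕ.≤ B) → InBox B xs → InBox B (x ∷ xs)

sumVec-≥ : ∀ B {k} {f : Vec ℕ k → ℤ} x → (∀ x → 0ℤ ℤ.≤ f x) → InBox B x → f x ℤ.≤ sumVec B k f
sumVec-≥ B []       h [] = ℤ.≤-refl
sumVec-≥ B (x ∷ xs) h ((1≤x , x≤B) ∷ bs) = ℤ.≤-trans (sumVec-≥ B xs (λ ys → h (x ∷ ys)) bs)
  (sumTo-≥ B x (λ i → sumVec-≥0 B _ (λ ys → h (i ∷ ys))) 1≤x x≤B)

#-≥0 : ∀ {k} (q : Form ℕ k) p B N → 0ℤ ℤ.≤ # q p B N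
#-≥0 {k} q p B N = sumVec-≥0 B k (λ x → *-≥0 (δ-≥0 (N.eval q x) N) (pars-≥0 p x))

#-≥1 : ∀ {k} (q : Form ℕ k) p B N x → InBox B x → N.eval q x ≡ N → pars p x ≡ 1ℤ → 1ℤ ℤ.≤ # q p B N
#-≥1 q p B N x bx refl px = subst (ℤ._≤ # q p B N) (cong₂ _*_ (δ-refl N) px)
  (sumVec-≥ B x (λ y → *-≥0 (δ-≥0 (N.eval q y) N) (pars-≥0 p y)) bx)

sumTo-witness : ∀ n (f : ℕ → ℤ) → sumTo n f ≢ 0ℤ → ∃ λ i → f i ≢ 0ℤ
sumTo-witness zero    f h = ⊥-elim (h refl)
sumTo-witness (suc n) f h with f (suc n) ℤ.≟ 0ℤ
... | no  ne = suc n , ne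
... | yes e  = sumTo-witness n f (λ s → h (cong₂ _+_ s e))

S-witness : ∀ B (f : ℕ → ℤ) → S B f ≢ 0ℤ → ∃ λ i → f i ≢ 0ℤ
S-witness B f h with f 0 ℤ.≟ 0ℤ
... | no  ne = 0 , ne
... | yes e  = sumTo-witness B f (λ s → h (trans (S-def B f) (cong₂ (λ a c → a + + 2 * c) e s)))

δ-witness : ∀ {m n} → δ m n ≢ 0ℤ → m ≡ n
δ-witness {m} {n} h = decide (m ℕ.≟ n)
  where
  decide : Dec (m ≡ n) → m ≡ n
  decide (yes eq) = eq
  decide (no  ne) = ⊥-elim (h (δ-≢ ne))

R₃-witness : ∀ B N → R₃ B N ≢ 0ℤ → ∃ λ x → ∃ λ y → ∃ λ z → x ℕ.* x ℕ.+ (y ℕ.* y ℕ.+ z ℕ.* z) ≡ N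
R₃-witness B N h =
  let (x , hx) = S-witness B (λ x → S B (λ y → S B (λ z → δ (x ℕ.* x ℕ.+ (y ℕ.* y ℕ.+ z ℕ.* z)) N))) h
      (y , hy) = S-witness B (λ y → S B (λ z → δ (x ℕ.* x ℕ.+ (y ℕ.* y ℕ.+ z ℕ.* z)) N)) hx
      (z , hz) = S-witness B (λ z → δ (x ℕ.* x ℕ.+ (y ℕ.* y ℕ.+ z ℕ.* z)) N) hy
  in x , y , z , δ-witness hz

three-squares : ∀ N → N ℕ.% 8 ≡ 3 ⊎ N ℕ.% 4 ≡ 1 ⊎ N ℕ.% 4 ≡ 2 → ∃ λ x → ∃ λ y → ∃ λ z → x ℕ.* x ℕ.+ (y ℕ.* y ℕ.+ z ℕ.* z) ≡ N
three-squares N cls = R₃-witness (3 ℕ.+ N) N (nonzero cls)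
  where
  B : ℕ
  B = 3 ℕ.+ N
  open Recursion B (s≤s z≤n)
  open Counts B
  N≤B : N ℕ.≤ B
  N≤B = ℕ.m≤n+m N 3
  1≤B : 1 ℕ.≤ B
  1≤B = s≤s z≤n
  positive-≢0 : ∀ {x} → 1ℤ ℤ.≤ x → x ≢ 0ℤ
  positive-≢0 (ℤ.+≤+ ()) refl
  positive-* : ∀ c {x} → 1ℤ ℤ.≤ x → 1ℤ ℤ.≤ + suc c * x
  positive-* c {+ suc m} _ = ℤ.+≤+ (s≤s z≤n)
  positive-* c {+ zero} (ℤ.+≤+ ())
  nonzero⇒≥1 : ∀ {N} → N ℕ.% 4 ≢ 0 → 1 ℕ.≤ N
  nonzero⇒≥1 {zero}  h = ⊥-elim (h refl)
  nonzero⇒≥1 {suc N} h = s≤s z≤n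
  par-of : ∀ s n → odd n ≡ s → par s n ≡ 1ℤ
  par-of s n refl with odd n
  ... | true  = refl
  ... | false = refl
  nonzero : N ℕ.% 8 ≡ 3 ⊎ N ℕ.% 4 ≡ 1 ⊎ N ℕ.% 4 ≡ 2 → R N ≢ 0ℤ
  -- The solution counted is (1, 1, c) with c = (N - 1)/2, which is odd for N ≡ 3 (mod 8). The other
  -- two classes use N = 1 · N.
  nonzero (inj₁ h) = subst (_≢ 0ℤ) (sym (R≡8#111 N h (ℕ.m≤n+m (suc N) 2))) (positive-≢0 (positive-* 7
    (#-≥1 q₃ 111ₚ B N (1 ∷ 1 ∷ c ∷ []) ((ℕ.≤-refl , 1≤B) ∷ (ℕ.≤-refl , 1≤B) ∷ (s≤s z≤n , ℕ.≤-trans c≤N N≤B) ∷ [])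
      (trans (q₃-value 1 1 c) (trans (double k) (sym N≡)))
      (cong (λ z → 1ℤ * (1ℤ * (z * 1ℤ))) (par-of true c (trans (odd-+ 1 (k ℕ.* 4)) (cong not (odd-*4 k))))))))
    where
    k = N ℕ./ 8
    c = 1 ℕ.+ k ℕ.* 4
    N≡ : N ≡ 3 ℕ.+ k ℕ.* 8
    N≡ = trans (ℕ.m≡m%n+[m/n]*n N 8) (cong (ℕ._+ k ℕ.* 8) h)
    double : ∀ k → 1 ℕ.* 1 ℕ.+ (1 ℕ.* (1 ℕ.+ k ℕ.* 4) ℕ.+ 1 ℕ.* (1 ℕ.+ k ℕ.* 4)) ≡ 3 ℕ.+ k ℕ.* 8
    double = ℕ-Solver.solve-∀
    c≤N : c ℕ.≤ N
    c≤N = subst (c ℕ.≤_) (sym N≡) (ℕ.+-mono-≤ {1} {3} (s≤s z≤n) (ℕ.*-monoʳ-≤ k {4} {8} (ℕ.m≤m+n 4 4)))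
    odd-*4 : ∀ n → odd (n ℕ.* 4) ≡ false
    odd-*4 zero    = refl
    odd-*4 (suc n) = trans (notnot₄ (odd (n ℕ.* 4))) (odd-*4 n)
      where
      notnot₄ : ∀ b → not (not (not (not b))) ≡ b
      notnot₄ true  = refl
      notnot₄ false = refl
  nonzero (inj₂ (inj₁ h)) = subst (_≢ 0ℤ) (sym (R≡G₁ N h ℕ.≤-refl)) (positive-≢0 (ℤ.≤-trans (positive-* 5 some)
      (subst (ℤ._≤ G₁ N) (ℤ.+-identityˡ (+ 6 * #11 N)) (ℤ.+-monoˡ-≤ (+ 6 * #11 N) (*-≥0 {+ 12} (ℤ.+≤+ z≤n) (#-≥0 q₃ 110ₚ B N))))))
    where
    some : 1ℤ ℤ.≤ #11 N
    some = #-≥1 q₂ 11ₚ B N (1 ∷ N ∷ []) ((ℕ.≤-refl , 1≤B) ∷ (nonzero⇒≥1 (λ z → 1≢0 (trans (sym h) z)) , N≤B) ∷ []) (trans (q₂-value 1 N) (ℕ.*-identityˡ N))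
      (cong (λ z → 1ℤ * (z * 1ℤ)) (par-of true N (trans (odd-%4 N) (cong odd h))))
      where
      1≢0 : 1 ≢ 0
      1≢0 ()
  nonzero (inj₂ (inj₂ h)) = subst (_≢ 0ℤ) (sym (R≡G₂ N h (ℕ.n≤1+n _))) (positive-≢0 (ℤ.≤-trans (positive-* 11 some)
      (subst (ℤ._≤ G₂ N) (ℤ.+-identityˡ (+ 12 * #10 N)) (ℤ.+-monoˡ-≤ (+ 12 * #10 N) (*-≥0 {+ 12} (ℤ.+≤+ z≤n) (#-≥0 q₃ 100ₚ B N))))))
    where
    some : 1ℤ ℤ.≤ #10 N
    some = #-≥1 q₂ 10ₚ B N (1 ∷ N ∷ []) ((ℕ.≤-refl , 1≤B) ∷ (nonzero⇒≥1 (λ z → 2≢0 (trans (sym h) z)) , N≤B) ∷ []) (trans (q₂-value 1 N) (ℕ.*-identityˡ N))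
      (cong (λ z → 1ℤ * (z * 1ℤ)) (par-of false N (trans (odd-%4 N) (cong odd h))))
      where
      2≢0 : 2 ≢ 0
      2≢0 ()

-- Quaternions

record ℍ : Set where
  constructor quat
  field re im jm km : ℤ

quat-cong : ∀ {a a' b b' c c' d d'} → a ≡ a' → b ≡ b' → c ≡ c' → d ≡ d' → quat a b c d ≡ quat a' b' c' d'
quat-cong refl refl refl refl = refl

infixl 7 _⊗_
infixl 6 _⊕_

_⊕_ : ℍ → ℍ → ℍ
quat a b c d ⊕ quat x y z w = quat (a + x) (b + y) (c + z) (d + w)

_·_ : ℤ → ℍ → ℍ
e · quat x y z w = quat (e * x) (e * y) (e * z) (e * w)

_⊗_ : ℍ → ℍ → ℍ
quat a b c d ⊗ quat x y z w = quat
  (a * x - b * y - c * z - d * w) (a * y + b * x + c * w - d * z)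
  (a * z - b * w + c * x + d * y) (a * w + b * z - c * y + d * x)

conj : ℍ → ℍ
conj (quat a b c d) = quat a (- b) (- c) (- d)

norm : ℍ → ℤ
norm (quat a b c d) = a * a + (b * b + (c * c + d * d))

inner : ℍ → ℍ → ℤ
inner (quat a b c d) (quat x y z w) = a * x + (b * y + (c * z + d * w))

norm-⊗ : ∀ p q → norm (p ⊗ q) ≡ norm p * norm q
norm-⊗ (quat a b c d) (quat x y z w) = ring a b c d x y z w
  where
  ring : ∀ a b c d x y z w →
    (a * x - b * y - c * z - d * w) * (a * x - b * y - c * z - d * w)
    + ((a * y + b * x + c * w - d * z) * (a * y + b * x + c * w - d * z)
    + ((a * z - b * w + c * x + d * y) * (a * z - b * w + c * x + d * y)
    + (a * w + b * z - c * y + d * x) * (a * w + b * z - c * y + d * x)))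
    ≡ (a * a + (b * b + (c * c + d * d))) * (x * x + (y * y + (z * z + w * w)))
  ring = solve-∀

norm-conj : ∀ p → norm (conj p) ≡ norm p
norm-conj (quat a b c d) = ring a b c d
  where
  ring : ∀ a b c d → a * a + ((- b) * (- b) + ((- c) * (- c) + (- d) * (- d))) ≡ a * a + (b * b + (c * c + d * d))
  ring = solve-∀

conj-conj : ∀ p → conj (conj p) ≡ p
conj-conj (quat a b c d) = quat-cong refl (ℤ.neg-involutive b) (ℤ.neg-involutive c) (ℤ.neg-involutive d)

conj-⊗ : ∀ p q → conj (p ⊗ q) ≡ conj q ⊗ conj p
conj-⊗ (quat a b c d) (quat x y z w) = quat-cong (e₀ a b c d x y z w) (e₁ a b c d x y z w) (e₂ a b c d x y z w) (e₃ a b c d x y z w)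
  where
  e₀ : ∀ a b c d x y z w → a * x - b * y - c * z - d * w ≡ x * a - (- y) * (- b) - (- z) * (- c) - (- w) * (- d)
  e₀ = solve-∀
  e₁ : ∀ a b c d x y z w → - (a * y + b * x + c * w - d * z) ≡ x * (- b) + (- y) * a + (- z) * (- d) - (- w) * (- c)
  e₁ = solve-∀
  e₂ : ∀ a b c d x y z w → - (a * z - b * w + c * x + d * y) ≡ x * (- c) - (- y) * (- d) + (- z) * a + (- w) * (- b)
  e₂ = solve-∀
  e₃ : ∀ a b c d x y z w → - (a * w + b * z - c * y + d * x) ≡ x * (- d) + (- y) * (- c) - (- z) * (- b) + (- w) * a
  e₃ = solve-∀

⊗-distrib : ∀ p q r → p ⊗ (q ⊕ r) ≡ p ⊗ q ⊕ p ⊗ r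
⊗-distrib (quat a b c d) (quat x y z w) (quat x' y' z' w') = quat-cong (e₀ a b c d x y z w x' y' z' w') (e₁ a b c d x y z w x' y' z' w') (e₂ a b c d x y z w x' y' z' w') (e₃ a b c d x y z w x' y' z' w')
  where
  e₀ : ∀ a b c d x y z w x' y' z' w' → a * (x + x') - b * (y + y') - c * (z + z') - d * (w + w') ≡ a * x - b * y - c * z - d * w + (a * x' - b * y' - c * z' - d * w')
  e₀ = solve-∀
  e₁ : ∀ a b c d x y z w x' y' z' w' → a * (y + y') + b * (x + x') + c * (w + w') - d * (z + z') ≡ a * y + b * x + c * w - d * z + (a * y' + b * x' + c * w' - d * z')
  e₁ = solve-∀
  e₂ : ∀ a b c d x y z w x' y' z' w' → a * (z + z') - b * (w + w') + c * (x + x') + d * (y + y') ≡ a * z - b * w + c * x + d * y + (a * z' - b * w' + c * x' + d * y')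
  e₂ = solve-∀
  e₃ : ∀ a b c d x y z w x' y' z' w' → a * (w + w') + b * (z + z') - c * (y + y') + d * (x + x') ≡ a * w + b * z - c * y + d * x + (a * w' + b * z' - c * y' + d * x')
  e₃ = solve-∀

⊗-conj : ∀ p q → p ⊗ (conj p ⊗ q) ≡ norm p · q
⊗-conj (quat a b c d) (quat x y z w) = quat-cong (e₀ a b c d x y z w) (e₁ a b c d x y z w) (e₂ a b c d x y z w) (e₃ a b c d x y z w)
  where
  e₀ : ∀ a b c d x y z w → a * (a * x - (- b) * y - (- c) * z - (- d) * w) - b * (a * y + (- b) * x + (- c) * w - (- d) * z) - c * (a * z - (- b) * w + (- c) * x + (- d) * y) - d * (a * w + (- b) * z - (- c) * y + (- d) * x)
     ≡ (a * a + (b * b + (c * c + d * d))) * x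
  e₀ = solve-∀
  e₁ : ∀ a b c d x y z w → a * (a * y + (- b) * x + (- c) * w - (- d) * z) + b * (a * x - (- b) * y - (- c) * z - (- d) * w) + c * (a * w + (- b) * z - (- c) * y + (- d) * x) - d * (a * z - (- b) * w + (- c) * x + (- d) * y)
     ≡ (a * a + (b * b + (c * c + d * d))) * y
  e₁ = solve-∀
  e₂ : ∀ a b c d x y z w → a * (a * z - (- b) * w + (- c) * x + (- d) * y) - b * (a * w + (- b) * z - (- c) * y + (- d) * x) + c * (a * x - (- b) * y - (- c) * z - (- d) * w) + d * (a * y + (- b) * x + (- c) * w - (- d) * z)
     ≡ (a * a + (b * b + (c * c + d * d))) * z
  e₂ = solve-∀
  e₃ : ∀ a b c d x y z w → a * (a * w + (- b) * z - (- c) * y + (- d) * x) + b * (a * z - (- b) * w + (- c) * x + (- d) * y) - c * (a * y + (- b) * x + (- c) * w - (- d) * z) + d * (a * x - (- b) * y - (- c) * z - (- d) * w)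
     ≡ (a * a + (b * b + (c * c + d * d))) * w
  e₃ = solve-∀

⊗-assoc : ∀ p q r → p ⊗ (q ⊗ r) ≡ p ⊗ q ⊗ r
⊗-assoc (quat a b c d) (quat x y z w) (quat k l m n) = quat-cong (e₀ a b c d x y z w k l m n) (e₁ a b c d x y z w k l m n) (e₂ a b c d x y z w k l m n) (e₃ a b c d x y z w k l m n)
  where
  e₀ : ∀ a b c d x y z w k l m n → a * (x * k - y * l - z * m - w * n) - b * (x * l + y * k + z * n - w * m) - c * (x * m - y * n + z * k + w * l) - d * (x * n + y * m - z * l + w * k)
    ≡ (a * x - b * y - c * z - d * w) * k - (a * y + b * x + c * w - d * z) * l - (a * z - b * w + c * x + d * y) * m - (a * w + b * z - c * y + d * x) * n
  e₀ = solve-∀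
  e₁ : ∀ a b c d x y z w k l m n → a * (x * l + y * k + z * n - w * m) + b * (x * k - y * l - z * m - w * n) + c * (x * n + y * m - z * l + w * k) - d * (x * m - y * n + z * k + w * l)
    ≡ (a * x - b * y - c * z - d * w) * l + (a * y + b * x + c * w - d * z) * k + (a * z - b * w + c * x + d * y) * n - (a * w + b * z - c * y + d * x) * m
  e₁ = solve-∀
  e₂ : ∀ a b c d x y z w k l m n → a * (x * m - y * n + z * k + w * l) - b * (x * n + y * m - z * l + w * k) + c * (x * k - y * l - z * m - w * n) + d * (x * l + y * k + z * n - w * m)
    ≡ (a * x - b * y - c * z - d * w) * m - (a * y + b * x + c * w - d * z) * n + (a * z - b * w + c * x + d * y) * k + (a * w + b * z - c * y + d * x) * l
  e₂ = solve-∀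
  e₃ : ∀ a b c d x y z w k l m n → a * (x * n + y * m - z * l + w * k) + b * (x * m - y * n + z * k + w * l) - c * (x * l + y * k + z * n - w * m) + d * (x * k - y * l - z * m - w * n)
    ≡ (a * x - b * y - c * z - d * w) * n + (a * y + b * x + c * w - d * z) * m - (a * z - b * w + c * x + d * y) * l + (a * w + b * z - c * y + d * x) * k
  e₃ = solve-∀

norm-⊕· : ∀ r e t → norm (r ⊕ e · t) ≡ norm r + e * (+ 2 * inner r t + e * norm t)
norm-⊕· (quat a b c d) e (quat x y z w) = ring a b c d e x y z w
  where
  ring : ∀ a b c d e x y z w → (a + e * x) * (a + e * x) + ((b + e * y) * (b + e * y) + ((c + e * z) * (c + e * z) + (d + e * w) * (d + e * w)))
    ≡ a * a + (b * b + (c * c + d * d)) + e * (+ 2 * (a * x + (b * y + (c * z + d * w))) + e * (x * x + (y * y + (z * z + w * w))))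
  ring = solve-∀

2m≢1+2x : ∀ m x → + 2 * m ≢ 1ℤ + + 2 * x
2m≢1+2x m x eq = absurd (m - x) (trans (e₁ m x) (trans (cong (_+ - (+ 2 * x)) eq) (e₂ x)))
  where
  e₁ : ∀ m x → + 2 * (m - x) ≡ + 2 * m + - (+ 2 * x)
  e₁ = solve-∀
  e₂ : ∀ x → 1ℤ + + 2 * x + - (+ 2 * x) ≡ 1ℤ
  e₂ = solve-∀
  absurd : ∀ z → + 2 * z ≢ 1ℤ
  absurd z h with trans (sym (ℤ.abs-* (+ 2) z)) (cong ∣_∣ h)
  ... | h' with ∣ z ∣
  ...   | zero  = 0≢1 h'
    where
    0≢1 : 0 ≢ 1
    0≢1 ()
  ...   | suc n = 2≢1 n h'
    where
    2≢1 : ∀ n → 2 ℕ.* suc n ≢ 1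
    2≢1 n e with trans (sym (cong suc (ℕ.+-suc n (n ℕ.+ 0)))) e
    ... | ()

difference : ∀ x y → ∃ λ s → y ≡ x + + 2 * s ⊎ y ≡ x + (1ℤ + + 2 * s)
difference x y with (y - x) ℤ.%ℕ 2 | ℤ.n%ℕd<d (y - x) 2 | ℤ.a≡a%ℕn+[a/ℕn]*n (y - x) 2
... | 0 | _ | e = (y - x) ℤ./ℕ 2 , inj₁ (trans (r₁ x y) (cong (_+_ x) (trans e (r₂ ((y - x) ℤ./ℕ 2)))))
  where
  r₁ : ∀ x y → y ≡ x + (y - x)
  r₁ = solve-∀
  r₂ : ∀ s → 0ℤ + s * + 2 ≡ + 2 * s
  r₂ = solve-∀
... | 1 | _ | e = (y - x) ℤ./ℕ 2 , inj₂ (trans (r₁ x y) (cong (_+_ x) (trans e (r₂ ((y - x) ℤ./ℕ 2)))))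
  where
  r₁ : ∀ x y → y ≡ x + (y - x)
  r₁ = solve-∀
  r₂ : ∀ s → 1ℤ + s * + 2 ≡ 1ℤ + + 2 * s
  r₂ = solve-∀
... | suc (suc _) | s≤s (s≤s ()) | _

-- An even norm means an even number of odd coordinates, so they split into two pairs of equal
-- parity. According to whether the real part is paired with the i, j or k coordinate, 1 + i, 1 + j
-- or 1 + k divides on the left.
even-norm-factor : ∀ q m → norm q ≡ + 2 * m → ∃ λ p → ∃ λ r → q ≡ p ⊗ r × norm p ≡ + 2
even-norm-factor (quat a b c d) m eq with difference a b
even-norm-factor (quat a b c d) m eq | s , inj₁ refl with difference c d
... | v , inj₁ refl = quat 1ℤ 1ℤ 0ℤ 0ℤ , quat (a + s) s (c + v) v , quat-cong (e₀ a s c v) (e₁ a s c v) (e₂ a s c v) (e₃ a s c v) , refl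
  where
  e₀ : ∀ a s c v → a ≡ 1ℤ * (a + s) - 1ℤ * s - 0ℤ * (c + v) - 0ℤ * v
  e₀ = solve-∀
  e₁ : ∀ a s c v → a + + 2 * s ≡ 1ℤ * s + 1ℤ * (a + s) + 0ℤ * v - 0ℤ * (c + v)
  e₁ = solve-∀
  e₂ : ∀ a s c v → c ≡ 1ℤ * (c + v) - 1ℤ * v + 0ℤ * (a + s) + 0ℤ * s
  e₂ = solve-∀
  e₃ : ∀ a s c v → c + + 2 * v ≡ 1ℤ * v + 1ℤ * (c + v) - 0ℤ * s + 0ℤ * (a + s)
  e₃ = solve-∀
... | v , inj₂ refl = ⊥-elim (2m≢1+2x m (a * a + + 2 * a * s + + 2 * s * s + c * c + c * (1ℤ + + 2 * v) + + 2 * v + + 2 * v * v) (trans (sym eq) (odd-norm a s c v)))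
  where
  odd-norm : ∀ a s c v → a * a + ((a + + 2 * s) * (a + + 2 * s) + (c * c + (c + (1ℤ + + 2 * v)) * (c + (1ℤ + + 2 * v))))
    ≡ 1ℤ + + 2 * (a * a + + 2 * a * s + + 2 * s * s + c * c + c * (1ℤ + + 2 * v) + + 2 * v + + 2 * v * v)
  odd-norm = solve-∀
even-norm-factor (quat a b c d) m eq | s , inj₂ refl with difference a c
even-norm-factor (quat a _ c d) m eq | s , inj₂ refl | u , inj₁ refl with difference d (a + (1ℤ + + 2 * s))
... | v , inj₁ b≡ = quat 1ℤ 0ℤ 1ℤ 0ℤ , quat (a + u) v u (d + v) , quat-cong (e₀ a u d v) (trans b≡ (e₁ a u d v)) (e₂ a u d v) (e₃ a u d v) , refl
  where
  e₀ : ∀ a s d v → a ≡ 1ℤ * (a + s) - 0ℤ * v - 1ℤ * s - 0ℤ * (d + v)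
  e₀ = solve-∀
  e₁ : ∀ a s d v → d + + 2 * v ≡ 1ℤ * v + 0ℤ * (a + s) + 1ℤ * (d + v) - 0ℤ * s
  e₁ = solve-∀
  e₂ : ∀ a s d v → a + + 2 * s ≡ 1ℤ * s - 0ℤ * (d + v) + 1ℤ * (a + s) + 0ℤ * v
  e₂ = solve-∀
  e₃ : ∀ a s d v → d ≡ 1ℤ * (d + v) + 0ℤ * s - 1ℤ * v + 0ℤ * (a + s)
  e₃ = solve-∀
... | v , inj₂ b≡ = ⊥-elim (2m≢1+2x m (a * a + + 2 * a * u + + 2 * u * u + d * d + d * (1ℤ + + 2 * v) + + 2 * v + + 2 * v * v) (trans (sym eq) (trans (cong (λ b → a * a + (b * b + ((a + + 2 * u) * (a + + 2 * u) + d * d))) b≡) (odd-norm a u d v))))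
  where
  odd-norm : ∀ a s d v → a * a + ((d + (1ℤ + + 2 * v)) * (d + (1ℤ + + 2 * v)) + ((a + + 2 * s) * (a + + 2 * s) + d * d))
    ≡ 1ℤ + + 2 * (a * a + + 2 * a * s + + 2 * s * s + d * d + d * (1ℤ + + 2 * v) + + 2 * v + + 2 * v * v)
  odd-norm = solve-∀
even-norm-factor (quat a _ _ d) m eq | s , inj₂ refl | u , inj₂ refl with difference a d
... | v , inj₁ refl = quat 1ℤ 0ℤ 0ℤ 1ℤ , quat (a + v) (a + (1ℤ + + 2 * s) + (u - s)) (u - s) v , quat-cong (e₀ a s u v) (e₁ a s u v) (e₂ a s u v) (e₃ a s u v) , refl
  where
  e₀ : ∀ a s u v → a ≡ 1ℤ * (a + v) - 0ℤ * (a + (1ℤ + + 2 * s) + (u - s)) - 0ℤ * (u - s) - 1ℤ * v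
  e₀ = solve-∀
  e₁ : ∀ a s u v → a + (1ℤ + + 2 * s) ≡ 1ℤ * (a + (1ℤ + + 2 * s) + (u - s)) + 0ℤ * (a + v) + 0ℤ * v - 1ℤ * (u - s)
  e₁ = solve-∀
  e₂ : ∀ a s u v → a + (1ℤ + + 2 * u) ≡ 1ℤ * (u - s) - 0ℤ * v + 0ℤ * (a + v) + 1ℤ * (a + (1ℤ + + 2 * s) + (u - s))
  e₂ = solve-∀
  e₃ : ∀ a s u v → a + + 2 * v ≡ 1ℤ * v + 0ℤ * (u - s) - 0ℤ * (a + (1ℤ + + 2 * s) + (u - s)) + 1ℤ * (a + v)
  e₃ = solve-∀
... | v , inj₂ refl = ⊥-elim (2m≢1+2x m (+ 2 * a * a + a * (+ 3 + + 2 * s + + 2 * u + + 2 * v) + 1ℤ + + 2 * s + + 2 * s * s + + 2 * u + + 2 * u * u + + 2 * v + + 2 * v * v) (trans (sym eq) (odd-norm a s u v)))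
  where
  odd-norm : ∀ a s u v → a * a + ((a + (1ℤ + + 2 * s)) * (a + (1ℤ + + 2 * s)) + ((a + (1ℤ + + 2 * u)) * (a + (1ℤ + + 2 * u)) + (a + (1ℤ + + 2 * v)) * (a + (1ℤ + + 2 * v))))
    ≡ 1ℤ + + 2 * (+ 2 * a * a + a * (+ 3 + + 2 * s + + 2 * u + + 2 * v) + 1ℤ + + 2 * s + + 2 * s * s + + 2 * u + + 2 * u * u + + 2 * v + + 2 * v * v)
  odd-norm = solve-∀

-- For an odd modulus E = 1 + 2h four centred remainders have norm at most 4h² < E². For even E all
-- four could be E/2, the norm would be E², and the descent in `factor-odd` would stall.
centred-remainder : ∀ h x → ∃ λ r → ∃ λ t → x ≡ r + + (1 ℕ.+ 2 ℕ.* h) * t × ∣ r ∣ ℕ.≤ h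
centred-remainder h x with x ℤ.%ℕ (1 ℕ.+ 2 ℕ.* h) | ℤ.n%ℕd<d x (1 ℕ.+ 2 ℕ.* h) | ℤ.a≡a%ℕn+[a/ℕn]*n x (1 ℕ.+ 2 ℕ.* h)
... | r | r<E | e with r ℕ.≤? h
...   | yes r≤h = + r , x ℤ./ℕ (1 ℕ.+ 2 ℕ.* h) , trans e (cong (_+_ (+ r)) (ℤ.*-comm (x ℤ./ℕ (1 ℕ.+ 2 ℕ.* h)) (+ (1 ℕ.+ 2 ℕ.* h)))) , r≤h
...   | no  r≰h = - (+ s) , x ℤ./ℕ E + 1ℤ , trans e (trans (cong (λ z → z + x ℤ./ℕ E * + E) (trans (cong (_+ + r) (sym (ℤ.+-inverseˡ (+ s)))) (trans (ℤ.+-assoc (- (+ s)) (+ s) (+ r)) (cong (λ z → - (+ s) + + z) s+r)))) (ring (- (+ s)) (+ E) (x ℤ./ℕ E))) , subst (ℕ._≤ h) (sym (ℤ.∣-i∣≡∣i∣ (+ s))) s≤h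
  where
  E = 1 ℕ.+ 2 ℕ.* h
  s = E ℕ.∸ r
  s+r : s ℕ.+ r ≡ E
  s+r = ℕ.m∸n+n≡m (ℕ.<⇒≤ r<E)
  s≤h : s ℕ.≤ h
  s≤h = ℕ.+-cancelʳ-≤ (suc h) s h (ℕ.≤-trans (ℕ.+-monoʳ-≤ s (ℕ.≰⇒> r≰h)) (ℕ.≤-reflexive (trans s+r (double h))))
    where
    double : ∀ h → 1 ℕ.+ 2 ℕ.* h ≡ h ℕ.+ suc h
    double = ℕ-Solver.solve-∀
  ring : ∀ s e q → s + e + q * e ≡ s + e * (q + 1ℤ)
  ring = solve-∀

absNorm : ℍ → ℕ
absNorm (quat a b c d) = ∣ a ∣ ℕ.* ∣ a ∣ ℕ.+ (∣ b ∣ ℕ.* ∣ b ∣ ℕ.+ (∣ c ∣ ℕ.* ∣ c ∣ ℕ.+ ∣ d ∣ ℕ.* ∣ d ∣))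

square-abs : ∀ a → a * a ≡ + (∣ a ∣ ℕ.* ∣ a ∣)
square-abs (+ n)      = sym (ℤ.pos-* n n)
square-abs (-[1+ n ]) = refl

norm-abs : ∀ q → norm q ≡ + absNorm q
norm-abs (quat a b c d) = cong₂ _+_ (square-abs a) (cong₂ _+_ (square-abs b) (cong₂ _+_ (square-abs c) (square-abs d)))

of-naturals : ∀ x y z w → norm (quat (+ x) (+ y) (+ z) (+ w)) ≡ + (x ℕ.* x ℕ.+ (y ℕ.* y ℕ.+ (z ℕ.* z ℕ.+ w ℕ.* w)))
of-naturals x y z w = norm-abs (quat (+ x) (+ y) (+ z) (+ w))

-- For n ≡ 7 (mod 8) subtracting 2² leaves the class 3 modulo 8; in the other classes three squares
-- already suffice.
four-squares : ∀ n → n ℕ.% 4 ≢ 0 → ∃ λ q → norm q ≡ + n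
four-squares n h with residue 8 (λ r → (r ℕ.% 4 ℕ.≟ 0) ⊎-dec ((r ℕ.≟ 7) ⊎-dec ((r ℕ.≟ 3) ⊎-dec ((r ℕ.% 4 ℕ.≟ 1) ⊎-dec (r ℕ.% 4 ℕ.≟ 2))))) n
... | inj₁ r0 = ⊥-elim (h (trans (sym (%8%4 n)) r0))
... | inj₂ (inj₁ r7) =
  let (x , y , z , e) = three-squares (n ℕ.∸ 4) (inj₁ n-4%8) in
  quat (+ 2) (+ x) (+ y) (+ z) , trans (of-naturals 2 x y z) (cong +_ (trans (cong (4 ℕ.+_) e) (ℕ.m+[n∸m]≡n 4≤n)))
  where
  4≤n : 4 ℕ.≤ n
  4≤n = ℕ.≤-trans (ℕ.≤-trans (ℕ.m≤m+n 4 3) (ℕ.≤-reflexive (sym r7))) (ℕ.m%n≤m n 8)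
  n-4%8 : (n ℕ.∸ 4) ℕ.% 8 ≡ 3
  n-4%8 = residue 8 (λ r → ((4 ℕ.+ r) ℕ.% 8 ℕ.≟ 7) →-dec (r ℕ.≟ 3)) (n ℕ.∸ 4)
    (trans (sym (ℕ.%-distribˡ-+ 4 (n ℕ.∸ 4) 8)) (trans (cong (ℕ._% 8) (ℕ.m+[n∸m]≡n 4≤n)) r7))
... | inj₂ (inj₂ cls) =
  let (x , y , z , e) = three-squares n (classify cls) in
  quat 0ℤ (+ x) (+ y) (+ z) , trans (of-naturals 0 x y z) (cong +_ e)
  where
  classify : n ℕ.% 8 ≡ 3 ⊎ n ℕ.% 8 ℕ.% 4 ≡ 1 ⊎ n ℕ.% 8 ℕ.% 4 ≡ 2 → n ℕ.% 8 ≡ 3 ⊎ n ℕ.% 4 ≡ 1 ⊎ n ℕ.% 4 ≡ 2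
  classify (inj₁ e)        = inj₁ e
  classify (inj₂ (inj₁ e)) = inj₂ (inj₁ (trans (sym (%8%4 n)) e))
  classify (inj₂ (inj₂ e)) = inj₂ (inj₂ (trans (sym (%8%4 n)) e))

-- A norm divisible by E is to yield a left divisor of norm exactly E with integer coordinates.
Factor : ℕ → Set
Factor E = ∀ q m → norm q ≡ + E * m → ∃ λ p → ∃ λ r → q ≡ p ⊗ r × norm p ≡ + E

factor-even : ∀ E → Factor E → Factor (2 ℕ.* E)
factor-even E F q m eq =
  let 2Em : norm q ≡ + 2 * (+ E * m)
      2Em = trans eq (trans (cong (_* m) (ℤ.pos-* 2 E)) (ℤ.*-assoc (+ 2) (+ E) m))
      (p , r , q≡ , np) = even-norm-factor q (+ E * m) 2Em
      nr : norm r ≡ + E * m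
      nr = ℤ.*-cancelˡ-≡ (+ 2) (norm r) (+ E * m) (trans (cong (_* norm r) (sym np)) (trans (sym (norm-⊗ p r)) (trans (cong norm (sym q≡)) 2Em)))
      (p' , r' , r≡ , np') = F r m nr
  in p ⊗ p' , r' , trans q≡ (trans (cong (p ⊗_) r≡) (⊗-assoc p p' r')) , trans (norm-⊗ p p') (trans (cong₂ _*_ np np') (sym (ℤ.pos-* 2 E)))

-- Reducing q modulo E gives q = r + E t with N(r) = E f and f < E. If f > 0, induction applied to
-- the conjugate of r splits off a left factor of norm f; its cofactor has norm E, and conjugating
-- back makes that cofactor a left divisor of r. If f = 0, then r = 0 and any quaternion of norm E
-- will do.
factor-odd : ∀ h → (∀ {f} → f ℕ.< 1 ℕ.+ 2 ℕ.* h → 1 ℕ.≤ f → Factor f) → Factor (1 ℕ.+ 2 ℕ.* h)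
factor-odd h ih q@(quat x y z w) m eq with centred-remainder h x | centred-remainder h y | centred-remainder h z | centred-remainder h w
... | a , x' , x≡ , a≤h | b , y' , y≡ , b≤h | c , z' , z≡ , c≤h | d , w' , w≡ , d≤h =
  let (p , g , r≡ , np) = split f refl in
  -- A left divisor p of r with N(p) = E also divides E t, because E t = p (p̄ t).
  p , g ⊕ conj p ⊗ t , trans q≡ (sym (trans (⊗-distrib p g (conj p ⊗ t)) (cong₂ _⊕_ (sym r≡) (trans (⊗-conj p t) (cong (_· t) np))))) , np
  where
  E = 1 ℕ.+ 2 ℕ.* h
  r = quat a b c d
  t = quat x' y' z' w'
  q≡ : q ≡ r ⊕ (+ E) · t
  q≡ = quat-cong x≡ y≡ z≡ w≡
  f' : ℤ
  f' = m - (+ 2 * inner r t + + E * norm t)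
  f : ℕ
  f = ∣ f' ∣
  norm-r : norm r ≡ + E * f'
  norm-r = trans (e₁ (norm r) (+ E) (+ 2 * inner r t + + E * norm t)) (trans (cong (_- + E * (+ 2 * inner r t + + E * norm t)) (trans (sym (norm-⊕· r (+ E) t)) (trans (cong norm (sym q≡)) eq))) (e₂ (+ E) m (+ 2 * inner r t + + E * norm t)))
    where
    e₁ : ∀ n e s → n ≡ n + e * s - e * s
    e₁ = solve-∀
    e₂ : ∀ e m s → e * m - e * s ≡ e * (m - s)
    e₂ = solve-∀
  abs-r : absNorm r ≡ E ℕ.* f
  abs-r = trans (cong ∣_∣ (trans (sym (norm-abs r)) norm-r)) (ℤ.abs-* (+ E) f')
  norm-r' : norm r ≡ + f * + E
  norm-r' = trans (norm-abs r) (trans (cong +_ (trans abs-r (ℕ.*-comm E f))) (ℤ.pos-* f E))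
  small : absNorm r ℕ.< E ℕ.* E
  small = ℕ.≤-<-trans (ℕ.+-mono-≤ (ℕ.*-mono-≤ a≤h a≤h) (ℕ.+-mono-≤ (ℕ.*-mono-≤ b≤h b≤h) (ℕ.+-mono-≤ (ℕ.*-mono-≤ c≤h c≤h) (ℕ.*-mono-≤ d≤h d≤h))))
    (subst (h ℕ.* h ℕ.+ (h ℕ.* h ℕ.+ (h ℕ.* h ℕ.+ h ℕ.* h)) ℕ.<_) (ring h) (ℕ.m<m+n _ (s≤s z≤n)))
    where
    ring : ∀ h → h ℕ.* h ℕ.+ (h ℕ.* h ℕ.+ (h ℕ.* h ℕ.+ h ℕ.* h)) ℕ.+ suc (4 ℕ.* h) ≡ (1 ℕ.+ 2 ℕ.* h) ℕ.* (1 ℕ.+ 2 ℕ.* h)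
    ring = ℕ-Solver.solve-∀
  f<E : f ℕ.< E
  f<E = ℕ.*-cancelˡ-< E f E (subst (ℕ._< E ℕ.* E) abs-r small)
  zero-abs : ∀ a → ∣ a ∣ ℕ.* ∣ a ∣ ≡ 0 → a ≡ 0ℤ
  zero-abs a e with ℕ.m*n≡0⇒m≡0∨n≡0 ∣ a ∣ e
  ... | inj₁ e' = ℤ.∣i∣≡0⇒i≡0 e'
  ... | inj₂ e' = ℤ.∣i∣≡0⇒i≡0 e'
  split : ∀ k → f ≡ k → ∃ λ p → ∃ λ g → r ≡ p ⊗ g × norm p ≡ + E
  split zero f≡0 =
    let (p , np) = four-squares E E%4 in p , quat 0ℤ 0ℤ 0ℤ 0ℤ , trans r≡0 (p⊗0 p) , np
    where
    E%4 : E ℕ.% 4 ≢ 0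
    E%4 e with trans (cong (ℕ._% 2) (sym e)) (trans (ℕ.m∣n⇒o%n%m≡o%m 2 4 E (divides 2 refl)) (trans (cong (λ z → (1 ℕ.+ z) ℕ.% 2) (ℕ.*-comm 2 h)) (ℕ.[m+kn]%n≡m%n 1 h 2)))
    ... | ()
    sum0 : absNorm r ≡ 0
    sum0 = trans abs-r (trans (cong (E ℕ.*_) f≡0) (ℕ.*-zeroʳ E))
    r≡0 : r ≡ quat 0ℤ 0ℤ 0ℤ 0ℤ
    r≡0 = quat-cong (zero-abs a (ℕ.m+n≡0⇒m≡0 (∣ a ∣ ℕ.* ∣ a ∣) sum0))
      (zero-abs b (ℕ.m+n≡0⇒m≡0 (∣ b ∣ ℕ.* ∣ b ∣) sum1))
      (zero-abs c (ℕ.m+n≡0⇒m≡0 (∣ c ∣ ℕ.* ∣ c ∣) sum2))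
      (zero-abs d (ℕ.m+n≡0⇒n≡0 (∣ c ∣ ℕ.* ∣ c ∣) sum2))
      where
      sum1 = ℕ.m+n≡0⇒n≡0 (∣ a ∣ ℕ.* ∣ a ∣) sum0
      sum2 = ℕ.m+n≡0⇒n≡0 (∣ b ∣ ℕ.* ∣ b ∣) sum1
    p⊗0 : ∀ p → quat 0ℤ 0ℤ 0ℤ 0ℤ ≡ p ⊗ quat 0ℤ 0ℤ 0ℤ 0ℤ
    p⊗0 (quat a b c d) = quat-cong (e₀ a b c d) (e₁ a b c d) (e₂ a b c d) (e₃ a b c d)
      where
      e₀ : ∀ a b c d → 0ℤ ≡ a * 0ℤ - b * 0ℤ - c * 0ℤ - d * 0ℤ
      e₀ = solve-∀
      e₁ : ∀ a b c d → 0ℤ ≡ a * 0ℤ + b * 0ℤ + c * 0ℤ - d * 0ℤ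
      e₁ = solve-∀
      e₂ : ∀ a b c d → 0ℤ ≡ a * 0ℤ - b * 0ℤ + c * 0ℤ + d * 0ℤ
      e₂ = solve-∀
      e₃ : ∀ a b c d → 0ℤ ≡ a * 0ℤ + b * 0ℤ - c * 0ℤ + d * 0ℤ
      e₃ = solve-∀
  split (suc k) f≡ =
    let (g , p , r̄≡ , ng) = ih f<E (subst (1 ℕ.≤_) (sym f≡) (s≤s z≤n)) (conj r) (+ E) (trans (norm-conj r) norm-r')
        r≡ : r ≡ conj p ⊗ conj g
        r≡ = trans (sym (conj-conj r)) (trans (cong conj r̄≡) (conj-⊗ g p))
    in conj p , conj g , r≡ , cancel p g ng (trans (cong norm (sym r̄≡)) (trans (norm-conj r) norm-r'))
    where
    cancel : ∀ p g → norm g ≡ + f → norm (g ⊗ p) ≡ + f * + E → norm (conj p) ≡ + E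
    cancel p g ng e = trans (norm-conj p) (ℤ.*-cancelˡ-≡ (+ suc k) (norm p) (+ E)
      (subst (λ z → z * norm p ≡ z * + E) (cong +_ f≡) (trans (cong (_* norm p) (sym ng)) (trans (sym (norm-⊗ g p)) e))))

factor : ∀ E → 1 ℕ.≤ E → Factor E
factor = <-rec (λ E → 1 ℕ.≤ E → Factor E) step
  where
  step : ∀ E → (∀ {f} → f ℕ.< E → 1 ℕ.≤ f → Factor f) → 1 ℕ.≤ E → Factor E
  step E ih 1≤E with E ℕ.% 2 | ℕ.m%n<n E 2 | ℕ.m≡m%n+[m/n]*n E 2
  ... | 0 | _ | e = subst Factor (sym E≡) (factor-even k (ih k<E 1≤k))
    where
    k = E ℕ./ 2
    E≡ : E ≡ 2 ℕ.* k
    E≡ = trans e (ℕ.*-comm k 2)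
    1≤k : 1 ℕ.≤ k
    1≤k with k | E≡
    ... | zero  | e' = ⊥-elim (ℕ.1+n≰n (subst (1 ℕ.≤_) e' 1≤E))
    ... | suc _ | _  = s≤s z≤n
    k<E : k ℕ.< E
    k<E = subst (k ℕ.<_) (sym E≡) (ℕ.m<m+n k (subst (0 ℕ.<_) (sym (ℕ.+-identityʳ k)) 1≤k))
  ... | 1 | _ | e = subst Factor (sym E≡) (factor-odd k (λ f< → ih (subst (_ ℕ.<_) (sym E≡) f<)))
    where
    k = E ℕ./ 2
    E≡ : E ≡ 1 ℕ.+ 2 ℕ.* k
    E≡ = trans e (cong suc (ℕ.*-comm k 2))
  ... | suc (suc _) | s≤s (s≤s ()) | _

-- From a binary form to four squares prime to p

Odd : ℤ → Set
Odd z = ∃ λ k → z ≡ 1ℤ + + 2 * k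

odd-* : ∀ {x y} → Odd x → Odd y → Odd (x * y)
odd-* (k , refl) (m , refl) = k + m + + 2 * k * m , ring k m
  where
  ring : ∀ k m → (1ℤ + + 2 * k) * (1ℤ + + 2 * m) ≡ 1ℤ + + 2 * (k + m + + 2 * k * m)
  ring = solve-∀

even+odd : ∀ x {y} → Odd y → Odd (+ 2 * x + y)
even+odd x (k , refl) = x + k , ring x k
  where
  ring : ∀ x k → + 2 * x + (1ℤ + + 2 * k) ≡ 1ℤ + + 2 * (x + k)
  ring = solve-∀

odd-neg : ∀ {x} → Odd x → Odd (- x)
odd-neg (k , refl) = - k - 1ℤ , ring k
  where
  ring : ∀ k → - (1ℤ + + 2 * k) ≡ 1ℤ + + 2 * (- k - 1ℤ)
  ring = solve-∀

odd⇒1+2k : ∀ n → odd n ≡ true → ∃ λ k → n ≡ 1 ℕ.+ 2 ℕ.* k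
even⇒2k : ∀ n → odd n ≡ false → ∃ λ k → n ≡ 2 ℕ.* k
odd⇒1+2k (suc n) h with odd n in e
... | false = let (k , eq) = even⇒2k n e in k , cong suc eq
even⇒2k zero    h = 0 , refl
even⇒2k (suc n) h with odd n in e
... | true  = let (k , eq) = odd⇒1+2k n e in suc k , trans (cong suc eq) (ring k)
  where
  ring : ∀ k → 2 ℕ.+ 2 ℕ.* k ≡ 2 ℕ.* suc k
  ring = ℕ-Solver.solve-∀

odd⇒Odd : ∀ n → odd n ≡ true → Odd (+ n)
odd⇒Odd n h = let (k , eq) = odd⇒1+2k n h in + k , trans (cong +_ eq) (cong (_+_ 1ℤ) (ℤ.pos-* 2 k))

abs-cases : ∀ z → z ≡ + ∣ z ∣ ⊎ z ≡ - (+ ∣ z ∣)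
abs-cases (+ n)    = inj₁ refl
abs-cases -[1+ n ] = inj₂ refl

odd-abs⇒Odd : ∀ z → odd ∣ z ∣ ≡ true → Odd z
odd-abs⇒Odd z h with abs-cases z
... | inj₁ e = subst Odd (sym e) (odd⇒Odd ∣ z ∣ h)
... | inj₂ e = subst Odd (sym e) (odd-neg (odd⇒Odd ∣ z ∣ h))

even-abs⇒2k : ∀ z → odd ∣ z ∣ ≡ false → ∃ λ k → z ≡ + 2 * k
even-abs⇒2k z h with even⇒2k ∣ z ∣ h | abs-cases z
... | k , eq | inj₁ e = + k , trans e (trans (cong +_ eq) (ℤ.pos-* 2 k))
... | k , eq | inj₂ e = - (+ k) , trans e (trans (cong (λ m → - (+ m)) eq) (trans (cong -_ (ℤ.pos-* 2 k)) (ℤ.neg-distribʳ-* (+ 2) (+ k))))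

Odd⇒odd-abs : ∀ z → Odd z → odd ∣ z ∣ ≡ true
Odd⇒odd-abs z (k , e) with odd ∣ z ∣ in o
... | true  = refl
... | false = let (m , e') = even-abs⇒2k z o in ⊥-elim (2m≢1+2x m k (trans (sym e') e))

multiple : ∀ p z → p ∣ℕ ∣ z ∣ → ∃ λ y → z ≡ + p * y
multiple p z (divides q e) with abs-cases z
... | inj₁ z≡ = + q , trans z≡ (trans (cong +_ (trans e (ℕ.*-comm q p))) (ℤ.pos-* p q))
... | inj₂ z≡ = - (+ q) , trans z≡ (trans (cong (λ m → - (+ m)) (trans e (ℕ.*-comm q p))) (trans (cong -_ (ℤ.pos-* p q)) (ℤ.neg-distribʳ-* (+ p) (+ q))))

mod-4 : ∀ a b x → + a ≡ + b + + 4 * x → a ℕ.% 4 ≡ b ℕ.% 4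
mod-4 a b (+ k) e = trans (cong (ℕ._% 4) (ℤ.+-injective (trans e (cong (_+_ (+ b)) (trans (sym (ℤ.pos-* 4 k)) (cong +_ (ℕ.*-comm 4 k))))))) (ℕ.[m+kn]%n≡m%n b k 4)
mod-4 a b -[1+ k ] e = sym (trans (cong (ℕ._% 4) (ℤ.+-injective (sym b≡))) (ℕ.[m+kn]%n≡m%n a (suc k) 4))
  where
  cancel : ∀ b k → b + + 4 * - k + k * + 4 ≡ b
  cancel = solve-∀
  b≡ : + (a ℕ.+ suc k ℕ.* 4) ≡ + b
  b≡ = trans (cong₂ _+_ e (ℤ.pos-* (suc k) 4)) (cancel (+ b) (+ suc k))

-- Modulo 4 the odd numbers are ±1: the sum is 2 when the signs agree, and the product is then 1; it
-- is 0 when they differ, and the product is then -1.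
odd-product : ∀ E j → odd E ≡ true → odd j ≡ true → ∀ s r → (s ≡ 2 × r ≡ 1) ⊎ (s ≡ 0 × r ≡ 3) → (E ℕ.+ j) ℕ.% 4 ≡ s → (j ℕ.* E) ℕ.% 4 ≡ r
odd-product E j oE oj s r cls e = trans (trans (ℕ.%-distribˡ-* j E 4) refl) (pick cls)
  where
  a b : Fin 4
  a = Fin.fromℕ< (ℕ.m%n<n E 4)
  b = Fin.fromℕ< (ℕ.m%n<n j 4)
  a≡ : Fin.toℕ a ≡ E ℕ.% 4
  a≡ = Fin.toℕ-fromℕ< (ℕ.m%n<n E 4)
  b≡ : Fin.toℕ b ≡ j ℕ.% 4
  b≡ = Fin.toℕ-fromℕ< (ℕ.m%n<n j 4)
  sum≡ : (Fin.toℕ a ℕ.+ Fin.toℕ b) ℕ.% 4 ≡ s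
  sum≡ = trans (cong₂ (λ x y → (x ℕ.+ y) ℕ.% 4) a≡ b≡) (trans (sym (ℕ.%-distribˡ-+ E j 4)) e)
  oa : odd (Fin.toℕ a) ≡ true
  oa = trans (cong odd a≡) (trans (sym (odd-%4 E)) oE)
  ob : odd (Fin.toℕ b) ≡ true
  ob = trans (cong odd b≡) (trans (sym (odd-%4 j)) oj)
  table : ∀ (s r : ℕ) → Set
  table s r = ∀ (a b : Fin 4) → odd (Fin.toℕ a) ≡ true → odd (Fin.toℕ b) ≡ true → (Fin.toℕ a ℕ.+ Fin.toℕ b) ℕ.% 4 ≡ s → (Fin.toℕ b ℕ.* Fin.toℕ a) ℕ.% 4 ≡ r
  table? : ∀ s r → Dec (table s r)
  table? s r = Fin.all? λ a → Fin.all? λ b → (odd (Fin.toℕ a) Bool.≟ true) →-dec ((odd (Fin.toℕ b) Bool.≟ true) →-dec (((Fin.toℕ a ℕ.+ Fin.toℕ b) ℕ.% 4 ℕ.≟ s) →-dec ((Fin.toℕ b ℕ.* Fin.toℕ a) ℕ.% 4 ℕ.≟ r)))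
  finish : table s r → ((j ℕ.% 4) ℕ.* (E ℕ.% 4)) ℕ.% 4 ≡ r
  finish tb = trans (sym (cong₂ (λ x y → (x ℕ.* y) ℕ.% 4) b≡ a≡)) (tb a b oa ob sum≡)
  pick : (s ≡ 2 × r ≡ 1) ⊎ (s ≡ 0 × r ≡ 3) → ((j ℕ.% 4) ℕ.* (E ℕ.% 4)) ℕ.% 4 ≡ r
  pick (inj₁ (refl , refl)) = finish (from-yes (table? 2 1))
  pick (inj₂ (refl , refl)) = finish (from-yes (table? 0 3))

-- n is the value at (t, p) of the positive definite binary form with coefficients E, l, j.
record BinaryRep (p n : ℕ) : Set where
  field
    E t j    : ℕ
    l        : ℤ
    E-odd    : odd E ≡ true
    t-odd    : odd t ≡ true
    j-odd    : odd j ≡ true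
    p∤t      : ¬ (p ∣ℕ t)
    value    : + n ≡ + t * + t * + E + + t * + p * l + + p * + p * + j
    small    : 4 ℕ.* E ℕ.< p ℕ.* p
    definite : ∣ l ∣ ℕ.* ∣ l ∣ ℕ.< 4 ℕ.* (j ℕ.* E)

-- Zero is allowed because `prune` finally drops zero coordinates; this is how fewer than four
-- squares arise.
Admissible : ℕ → ℤ → Set
Admissible p x = x ≡ 0ℤ ⊎ ¬ (p ∣ℕ ∣ x ∣)

Rep : ℕ → ℕ → Set
Rep p n = ∃ λ x → ∃ λ y → ∃ λ z → ∃ λ w → norm (quat x y z w) ≡ + n × Admissible p x × Admissible p y × Admissible p z × Admissible p w

-- The rows of a symmetric 4 × 4 Hadamard matrix. They are orthogonal of norm 4, so half of the
-- matrix is orthogonal.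
sum₀ sum₁ sum₂ sum₃ : ℍ → ℤ
sum₀ (quat a b c d) = a + b + c + d
sum₁ (quat a b c d) = a + b - c - d
sum₂ (quat a b c d) = a - b + c - d
sum₃ (quat a b c d) = a - b - c + d

sums : ℍ → ℍ
sums q = quat (sum₀ q) (sum₁ q) (sum₂ q) (sum₃ q)

norm-sums : ∀ q → norm (sums q) ≡ + 4 * norm q
norm-sums (quat a b c d) = ring a b c d
  where
  ring : ∀ a b c d → (a + b + c + d) * (a + b + c + d) + ((a + b - c - d) * (a + b - c - d) + ((a - b + c - d) * (a - b + c - d) + (a - b - c + d) * (a - b - c + d)))
    ≡ + 4 * (a * a + (b * b + (c * c + d * d)))
  ring = solve-∀

square-parity : ∀ x → ∃ λ k → x * x ≡ x + + 2 * k
square-parity x with difference 0ℤ x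
... | s , inj₁ e = s * (+ 2 * s - 1ℤ) , trans (cong (λ z → z * z) (trans e (ℤ.+-identityˡ (+ 2 * s)))) (trans (ring s) (cong (_+ + 2 * (s * (+ 2 * s - 1ℤ))) (sym (trans e (ℤ.+-identityˡ (+ 2 * s))))))
  where
  ring : ∀ s → + 2 * s * (+ 2 * s) ≡ + 2 * s + + 2 * (s * (+ 2 * s - 1ℤ))
  ring = solve-∀
... | s , inj₂ e = s * (+ 2 * s + 1ℤ) , trans (cong (λ z → z * z) (trans e (ℤ.+-identityˡ (1ℤ + + 2 * s)))) (trans (ring s) (cong (_+ + 2 * (s * (+ 2 * s + 1ℤ))) (sym (trans e (ℤ.+-identityˡ (1ℤ + + 2 * s))))))
  where
  ring : ∀ s → (1ℤ + + 2 * s) * (1ℤ + + 2 * s) ≡ 1ℤ + + 2 * s + + 2 * (s * (+ 2 * s + 1ℤ))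
  ring = solve-∀

norm-parity : ∀ q → ∃ λ k → sum₀ q ≡ norm q + + 2 * k
norm-parity (quat a b c d) with square-parity a | square-parity b | square-parity c | square-parity d
... | k , ea | l , eb | m , ec | n , ed = - (k + l + m + n) ,
  trans (ring a b c d k l m n) (sym (cong (_+ + 2 * - (k + l + m + n)) (cong₂ _+_ ea (cong₂ _+_ eb (cong₂ _+_ ec ed)))))
  where
  ring : ∀ a b c d k l m n → a + b + c + d ≡ a + + 2 * k + (b + + 2 * l + (c + + 2 * m + (d + + 2 * n))) + + 2 * - (k + l + m + n)
  ring = solve-∀

-- Signs do not matter modulo 2 and x² ≡ x, so all four signed sums have the parity of the norm.
sums-odd : ∀ q → Odd (norm q) → Odd (sum₀ q) × Odd (sum₁ q) × Odd (sum₂ q) × Odd (sum₃ q)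
sums-odd q@(quat a b c d) o =
  let (k , e) = norm-parity q
      o₀ : Odd (sum₀ q)
      o₀ = subst Odd (trans (ℤ.+-comm (+ 2 * k) (norm q)) (sym e)) (even+odd k o)
  in o₀ , subst Odd (e₁ a b c d) (even+odd (- c - d) o₀) , subst Odd (e₂ a b c d) (even+odd (- b - d) o₀) , subst Odd (e₃ a b c d) (even+odd (- b - c) o₀)
  where
  e₁ : ∀ a b c d → + 2 * (- c - d) + (a + b + c + d) ≡ a + b - c - d
  e₁ = solve-∀
  e₂ : ∀ a b c d → + 2 * (- b - d) + (a + b + c + d) ≡ a - b + c - d
  e₂ = solve-∀
  e₃ : ∀ a b c d → + 2 * (- b - c) + (a + b + c + d) ≡ a - b - c + d
  e₃ = solve-∀

component-bounds : ∀ q {m} → norm q ≡ + m → let open ℍ q in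
  (∣ re ∣ ℕ.* ∣ re ∣ ℕ.≤ m) × (∣ im ∣ ℕ.* ∣ im ∣ ℕ.≤ m) × (∣ jm ∣ ℕ.* ∣ jm ∣ ℕ.≤ m) × (∣ km ∣ ℕ.* ∣ km ∣ ℕ.≤ m)
component-bounds q@(quat a b c d) {m} e with ℤ.+-injective (trans (sym (norm-abs q)) e)
... | refl = ℕ.m≤m+n A _ , ℕ.≤-trans (ℕ.m≤m+n B _) (ℕ.m≤n+m _ A)
           , ℕ.≤-trans (ℕ.≤-trans (ℕ.m≤m+n C D) (ℕ.m≤n+m _ B)) (ℕ.m≤n+m _ A)
           , ℕ.≤-trans (ℕ.≤-trans (ℕ.m≤n+m D C) (ℕ.m≤n+m _ B)) (ℕ.m≤n+m _ A)
  where
  A B C D : ℕ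
  A = ∣ a ∣ ℕ.* ∣ a ∣
  B = ∣ b ∣ ℕ.* ∣ b ∣
  C = ∣ c ∣ ℕ.* ∣ c ∣
  D = ∣ d ∣ ℕ.* ∣ d ∣

module Core (p : ℕ) (p-prime : Prime p) (5≤p : 5 ℕ.≤ p) (p-odd : Odd (+ p)) where

  -- If p divided x it would divide 2ts, hence s, as p divides neither 2 nor t. Being odd, s is
  -- nonzero, so p² ≤ s² ≤ 4E, against 4E < p².
  not-divisible : ∀ E t x s c → 4 ℕ.* E ℕ.< p ℕ.* p → ¬ (p ∣ℕ t) → + 4 * x ≡ + 2 * (+ t * s) + + p * c → Odd s → ∣ s ∣ ℕ.* ∣ s ∣ ℕ.≤ 4 ℕ.* E → ¬ (p ∣ℕ ∣ x ∣)
  not-divisible E t x s c small p∤t e s-odd s≤ p∣x with multiple p x p∣x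
  ... | y , x≡ with euclidsLemma 2 (t ℕ.* ∣ s ∣) p-prime (divides ∣ + 4 * y - c ∣ (sym abs-eq))
    where
    in-ℤ : + p * (+ 4 * y - c) ≡ + 2 * (+ t * s)
    in-ℤ = trans (e₁ (+ p) y c) (trans (cong (λ z → + 4 * z - + p * c) (sym x≡)) (trans (cong (_- + p * c) e) (e₂ (+ 2 * (+ t * s)) (+ p * c))))
      where
      e₁ : ∀ p y c → p * (+ 4 * y - c) ≡ + 4 * (p * y) - p * c
      e₁ = solve-∀
      e₂ : ∀ a b → a + b - b ≡ a
      e₂ = solve-∀
    abs-eq : ∣ + 4 * y - c ∣ ℕ.* p ≡ 2 ℕ.* (t ℕ.* ∣ s ∣)
    abs-eq = trans (ℕ.*-comm ∣ + 4 * y - c ∣ p) (trans (sym (ℤ.abs-* (+ p) (+ 4 * y - c))) (trans (cong ∣_∣ in-ℤ) (trans (ℤ.abs-* (+ 2) (+ t * s)) (cong (2 ℕ.*_) (ℤ.abs-* (+ t) s)))))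
  ...   | inj₁ p∣2 = ℕ.<⇒≱ (ℕ.≤-trans (s≤s (s≤s (s≤s z≤n))) 5≤p) (∣⇒≤ p∣2)
  ...   | inj₂ p∣ts with euclidsLemma t ∣ s ∣ p-prime p∣ts
  ...     | inj₁ p∣t = p∤t p∣t
  ...     | inj₂ p∣s with ∣ s ∣ | Odd⇒odd-abs s s-odd
  ...       | suc m | _ = ℕ.<⇒≱ small (ℕ.≤-trans (ℕ.*-mono-≤ (∣⇒≤ p∣s) (∣⇒≤ p∣s)) s≤)

  -- Multiplying the coordinates by 4 clears the denominators of both cases: the matrix of signs is
  -- divided by 4 for odd n and by 2 for even n. The bound on the signed sums of `A` is read off
  -- from `norm-sums`.
  assemble : ∀ n E t A x y z w c₀ c₁ c₂ c₃ → norm (quat x y z w) ≡ + n → norm A ≡ + E → odd E ≡ true → 4 ℕ.* E ℕ.< p ℕ.* p → ¬ (p ∣ℕ t) →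
    + 4 * x ≡ + 2 * (+ t * sum₀ A) + + p * c₀ → + 4 * y ≡ + 2 * (+ t * sum₁ A) + + p * c₁ →
    + 4 * z ≡ + 2 * (+ t * sum₂ A) + + p * c₂ → + 4 * w ≡ + 2 * (+ t * sum₃ A) + + p * c₃ → Rep p n
  assemble n E t A x y z w c₀ c₁ c₂ c₃ nx nA E-odd small p∤t e₀ e₁ e₂ e₃ =
    let (o₀ , o₁ , o₂ , o₃) = sums-odd A (subst Odd (sym nA) (odd⇒Odd E E-odd))
        (b₀ , b₁ , b₂ , b₃) = component-bounds (sums A) (trans (norm-sums A) (trans (cong (_*_ (+ 4)) nA) (sym (ℤ.pos-* 4 E))))
    in x , y , z , w , nx
     , inj₂ (not-divisible E t x (sum₀ A) c₀ small p∤t e₀ o₀ b₀)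
     , inj₂ (not-divisible E t y (sum₁ A) c₁ small p∤t e₁ o₁ b₁)
     , inj₂ (not-divisible E t z (sum₂ A) c₂ small p∤t e₂ o₂ b₂)
     , inj₂ (not-divisible E t w (sum₃ A) c₃ small p∤t e₃ o₃ b₃)

  module _ {n : ℕ} (rep : BinaryRep p n) where
    open BinaryRep rep

    P T : ℤ
    P = + p
    T = + t

    t-Odd : Odd T
    t-Odd = odd⇒Odd t t-odd

    -- The conjugate is taken because the inner product of a and q̄ is the real part of a q.
    -- Prescribing that real part prescribes the middle coefficient of the binary form.
    norm-combination : ∀ u a q → norm (u · a ⊕ P · conj q) ≡ u * u * norm a + + 2 * (u * P * ℍ.re (a ⊗ q)) + P * P * norm q
    norm-combination u (quat a b c d) (quat x y z w) = ring u P a b c d x y z w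
      where
      ring : ∀ u p a b c d x y z w → (u * a + p * x) * (u * a + p * x) + ((u * b + p * - y) * (u * b + p * - y) + ((u * c + p * - z) * (u * c + p * - z) + (u * d + p * - w) * (u * d + p * - w)))
        ≡ u * u * (a * a + (b * b + (c * c + d * d))) + + 2 * (u * p * (a * x - b * y - c * z - d * w)) + p * p * (x * x + (y * y + (z * z + w * w)))
      ring = solve-∀

    -- Four odd entries with sum divisible by 4 become integers under the matrix of signs divided by 4.
    build-odd : ∀ A C → norm A ≡ + E → norm ((+ 2 * T) · A ⊕ P · C) ≡ + 4 * + n → ∀ u v₁ v₂ v₃ →
      (+ 2 * T) · A ⊕ P · C ≡ quat (1ℤ + + 2 * (+ 2 * u - v₁ - v₂ - v₃)) (1ℤ + + 2 * v₁) (1ℤ + + 2 * v₂) (1ℤ + + 2 * v₃) → Rep p n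
    build-odd A@(quat a b c d) C@(quat x y z w) nA nV u v₁ v₂ v₃ eq =
      assemble n E t A (1ℤ + u) (u - v₂ - v₃) (u - v₁ - v₃) (u - v₁ - v₂) (sum₀ C) (sum₁ C) (sum₂ C) (sum₃ C)
        (ℤ.*-cancelˡ-≡ (+ 4) _ (+ n) (trans (four-norms u v₁ v₂ v₃) (trans (cong norm (sym eq)) nV)))
        nA E-odd small p∤t
        (trans (r₀ u v₁ v₂ v₃) (trans (cong sum₀ (sym eq)) (l₀ T P a b c d x y z w)))
        (trans (r₁ u v₁ v₂ v₃) (trans (cong sum₁ (sym eq)) (l₁ T P a b c d x y z w)))
        (trans (r₂ u v₁ v₂ v₃) (trans (cong sum₂ (sym eq)) (l₂ T P a b c d x y z w)))
        (trans (r₃ u v₁ v₂ v₃) (trans (cong sum₃ (sym eq)) (l₃ T P a b c d x y z w)))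
      where
      four-norms : ∀ u v₁ v₂ v₃ → + 4 * ((1ℤ + u) * (1ℤ + u) + ((u - v₂ - v₃) * (u - v₂ - v₃) + ((u - v₁ - v₃) * (u - v₁ - v₃) + (u - v₁ - v₂) * (u - v₁ - v₂))))
        ≡ (1ℤ + + 2 * (+ 2 * u - v₁ - v₂ - v₃)) * (1ℤ + + 2 * (+ 2 * u - v₁ - v₂ - v₃)) + ((1ℤ + + 2 * v₁) * (1ℤ + + 2 * v₁) + ((1ℤ + + 2 * v₂) * (1ℤ + + 2 * v₂) + (1ℤ + + 2 * v₃) * (1ℤ + + 2 * v₃)))
      four-norms = solve-∀
      r₀ : ∀ u v₁ v₂ v₃ → + 4 * (1ℤ + u) ≡ (1ℤ + + 2 * (+ 2 * u - v₁ - v₂ - v₃)) + (1ℤ + + 2 * v₁) + (1ℤ + + 2 * v₂) + (1ℤ + + 2 * v₃)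
      r₀ = solve-∀
      r₁ : ∀ u v₁ v₂ v₃ → + 4 * (u - v₂ - v₃) ≡ (1ℤ + + 2 * (+ 2 * u - v₁ - v₂ - v₃)) + (1ℤ + + 2 * v₁) - (1ℤ + + 2 * v₂) - (1ℤ + + 2 * v₃)
      r₁ = solve-∀
      r₂ : ∀ u v₁ v₂ v₃ → + 4 * (u - v₁ - v₃) ≡ (1ℤ + + 2 * (+ 2 * u - v₁ - v₂ - v₃)) - (1ℤ + + 2 * v₁) + (1ℤ + + 2 * v₂) - (1ℤ + + 2 * v₃)
      r₂ = solve-∀
      r₃ : ∀ u v₁ v₂ v₃ → + 4 * (u - v₁ - v₂) ≡ (1ℤ + + 2 * (+ 2 * u - v₁ - v₂ - v₃)) - (1ℤ + + 2 * v₁) - (1ℤ + + 2 * v₂) + (1ℤ + + 2 * v₃)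
      r₃ = solve-∀
      l₀ : ∀ t p a b c d x y z w → + 2 * t * a + p * x + (+ 2 * t * b + p * y) + (+ 2 * t * c + p * z) + (+ 2 * t * d + p * w) ≡ + 2 * (t * (a + b + c + d)) + p * (x + y + z + w)
      l₀ = solve-∀
      l₁ : ∀ t p a b c d x y z w → + 2 * t * a + p * x + (+ 2 * t * b + p * y) - (+ 2 * t * c + p * z) - (+ 2 * t * d + p * w) ≡ + 2 * (t * (a + b - c - d)) + p * (x + y - z - w)
      l₁ = solve-∀
      l₂ : ∀ t p a b c d x y z w → + 2 * t * a + p * x - (+ 2 * t * b + p * y) + (+ 2 * t * c + p * z) - (+ 2 * t * d + p * w) ≡ + 2 * (t * (a - b + c - d)) + p * (x - y + z - w)
      l₂ = solve-∀
      l₃ : ∀ t p a b c d x y z w → + 2 * t * a + p * x - (+ 2 * t * b + p * y) - (+ 2 * t * c + p * z) + (+ 2 * t * d + p * w) ≡ + 2 * (t * (a - b - c + d)) + p * (x - y - z + w)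
      l₃ = solve-∀

    -- The entries 1 + 2vᵢ have sum 4 + 2(v₀ + v₁ + v₂ + v₃), so `build-odd` applies directly when
    -- the vᵢ have even sum.
    finish-odd : ∀ A C → norm A ≡ + E → norm ((+ 2 * T) · A ⊕ P · C) ≡ + 4 * + n → let open ℍ C in Odd re → Odd im → Odd jm → Odd km → Rep p n
    finish-odd A@(quat a b c d) C@(quat x y z w) nA nV ox oy oz ow
      with entry a ox | entry b oy | entry c oz | entry d ow
      where
      entry : ∀ a {x} → Odd x → Odd (+ 2 * T * a + P * x)
      entry a {x} o = subst Odd (cong (_+ P * x) (sym (ℤ.*-assoc (+ 2) T a))) (even+odd (T * a) (odd-* p-odd o))
    ... | v₀ , e₀ | v₁ , e₁ | v₂ , e₂ | v₃ , e₃ with difference 0ℤ (v₀ + v₁ + v₂ + v₃)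
    ...   | u , inj₁ eu = build-odd A C nA nV u v₁ v₂ v₃
              (quat-cong (trans e₀ (cong (λ v → 1ℤ + + 2 * v) (solve-v₀ v₀ v₁ v₂ v₃ u eu))) e₁ e₂ e₃)
      where
      solve-v₀ : ∀ v₀ v₁ v₂ v₃ u → v₀ + v₁ + v₂ + v₃ ≡ 0ℤ + + 2 * u → v₀ ≡ + 2 * u - v₁ - v₂ - v₃
      solve-v₀ v₀ v₁ v₂ v₃ u e = trans (r₁ v₀ v₁ v₂ v₃) (trans (cong (λ s → s - v₁ - v₂ - v₃) e) (r₂ v₁ v₂ v₃ u))
        where
        r₁ : ∀ v₀ v₁ v₂ v₃ → v₀ ≡ v₀ + v₁ + v₂ + v₃ - v₁ - v₂ - v₃
        r₁ = solve-∀
        r₂ : ∀ v₁ v₂ v₃ u → 0ℤ + + 2 * u - v₁ - v₂ - v₃ ≡ + 2 * u - v₁ - v₂ - v₃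
        r₂ = solve-∀
    -- Negating the first coordinates of `A` and `C` preserves the norms and replaces v₀ by -1 - v₀,
    -- which changes the parity of the sum.
    ...   | u , inj₂ eu = build-odd (quat (- a) b c d) (quat (- x) y z w)
              (trans (flip-norm a b c d) nA) (trans (flip-combination T P a b c d x y z w) nV) (v₁ + v₂ + v₃ - u - 1ℤ) v₁ v₂ v₃
              (quat-cong (trans (flip-entry T P a x) (trans (cong -_ e₀) (solve-v₀ v₀ v₁ v₂ v₃ u eu))) e₁ e₂ e₃)
      where
      flip-norm : ∀ a b c d → - a * - a + (b * b + (c * c + d * d)) ≡ a * a + (b * b + (c * c + d * d))
      flip-norm = solve-∀
      flip-entry : ∀ t p a x → + 2 * t * - a + p * - x ≡ - (+ 2 * t * a + p * x)
      flip-entry = solve-∀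
      flip-combination : ∀ t p a b c d x y z w → (+ 2 * t * - a + p * - x) * (+ 2 * t * - a + p * - x) + ((+ 2 * t * b + p * y) * (+ 2 * t * b + p * y) + ((+ 2 * t * c + p * z) * (+ 2 * t * c + p * z) + (+ 2 * t * d + p * w) * (+ 2 * t * d + p * w)))
        ≡ (+ 2 * t * a + p * x) * (+ 2 * t * a + p * x) + ((+ 2 * t * b + p * y) * (+ 2 * t * b + p * y) + ((+ 2 * t * c + p * z) * (+ 2 * t * c + p * z) + (+ 2 * t * d + p * w) * (+ 2 * t * d + p * w)))
      flip-combination = solve-∀
      solve-v₀ : ∀ v₀ v₁ v₂ v₃ u → v₀ + v₁ + v₂ + v₃ ≡ 0ℤ + (1ℤ + + 2 * u) → - (1ℤ + + 2 * v₀) ≡ 1ℤ + + 2 * (+ 2 * (v₁ + v₂ + v₃ - u - 1ℤ) - v₁ - v₂ - v₃)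
      solve-v₀ v₀ v₁ v₂ v₃ u e = trans (r₁ v₀ v₁ v₂ v₃) (trans (cong (λ s → - (1ℤ + + 2 * (s - v₁ - v₂ - v₃))) e) (r₂ v₁ v₂ v₃ u))
        where
        r₁ : ∀ v₀ v₁ v₂ v₃ → - (1ℤ + + 2 * v₀) ≡ - (1ℤ + + 2 * (v₀ + v₁ + v₂ + v₃ - v₁ - v₂ - v₃))
        r₁ = solve-∀
        r₂ : ∀ v₁ v₂ v₃ u → - (1ℤ + + 2 * (0ℤ + (1ℤ + + 2 * u) - v₁ - v₂ - v₃)) ≡ 1ℤ + + 2 * (+ 2 * (v₁ + v₂ + v₃ - u - 1ℤ) - v₁ - v₂ - v₃)
        r₂ = solve-∀

    -- All four signed sums have the same parity, so an even first one lets half of the matrix of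
    -- signs act with integral result.
    finish-even : ∀ A C → norm A ≡ + E → norm (T · A ⊕ P · C) ≡ + n → ∀ u → sum₀ (T · A ⊕ P · C) ≡ + 2 * u → Rep p n
    finish-even A@(quat a b c d) C@(quat x y z w) nA nV u eq =
      assemble n E t A u (u - v₂ - v₃) (u - v₁ - v₃) (u - v₁ - v₂) (+ 2 * sum₀ C) (+ 2 * sum₁ C) (+ 2 * sum₂ C) (+ 2 * sum₃ C)
        (trans (norms u v₁ v₂ v₃) (trans (cong (λ v → v * v + (v₁ * v₁ + (v₂ * v₂ + v₃ * v₃))) (sym v₀≡)) nV))
        nA E-odd small p∤t
        (trans (r₀ u) (trans (cong (_*_ (+ 2)) (sym eq)) (l₀ T P a b c d x y z w)))
        (trans (r₁ u v₁ v₂ v₃) (trans (cong (λ v → + 2 * (v + v₁ - v₂ - v₃)) (sym v₀≡)) (l₁ T P a b c d x y z w)))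
        (trans (r₂ u v₁ v₂ v₃) (trans (cong (λ v → + 2 * (v - v₁ + v₂ - v₃)) (sym v₀≡)) (l₂ T P a b c d x y z w)))
        (trans (r₃ u v₁ v₂ v₃) (trans (cong (λ v → + 2 * (v - v₁ - v₂ + v₃)) (sym v₀≡)) (l₃ T P a b c d x y z w)))
      where
      v₀ v₁ v₂ v₃ : ℤ
      v₀ = T * a + P * x
      v₁ = T * b + P * y
      v₂ = T * c + P * z
      v₃ = T * d + P * w
      v₀≡ : v₀ ≡ + 2 * u - v₁ - v₂ - v₃
      v₀≡ = trans (e v₀ v₁ v₂ v₃) (cong (λ s → s - v₁ - v₂ - v₃) eq)
        where
        e : ∀ v₀ v₁ v₂ v₃ → v₀ ≡ v₀ + v₁ + v₂ + v₃ - v₁ - v₂ - v₃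
        e = solve-∀
      norms : ∀ u v₁ v₂ v₃ → u * u + ((u - v₂ - v₃) * (u - v₂ - v₃) + ((u - v₁ - v₃) * (u - v₁ - v₃) + (u - v₁ - v₂) * (u - v₁ - v₂)))
        ≡ (+ 2 * u - v₁ - v₂ - v₃) * (+ 2 * u - v₁ - v₂ - v₃) + (v₁ * v₁ + (v₂ * v₂ + v₃ * v₃))
      norms = solve-∀
      r₀ : ∀ u → + 4 * u ≡ + 2 * (+ 2 * u)
      r₀ = solve-∀
      r₁ : ∀ u v₁ v₂ v₃ → + 4 * (u - v₂ - v₃) ≡ + 2 * (+ 2 * u - v₁ - v₂ - v₃ + v₁ - v₂ - v₃)
      r₁ = solve-∀
      r₂ : ∀ u v₁ v₂ v₃ → + 4 * (u - v₁ - v₃) ≡ + 2 * (+ 2 * u - v₁ - v₂ - v₃ - v₁ + v₂ - v₃)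
      r₂ = solve-∀
      r₃ : ∀ u v₁ v₂ v₃ → + 4 * (u - v₁ - v₂) ≡ + 2 * (+ 2 * u - v₁ - v₂ - v₃ - v₁ - v₂ + v₃)
      r₃ = solve-∀
      l₀ : ∀ t p a b c d x y z w → + 2 * (t * a + p * x + (t * b + p * y) + (t * c + p * z) + (t * d + p * w)) ≡ + 2 * (t * (a + b + c + d)) + p * (+ 2 * (x + y + z + w))
      l₀ = solve-∀
      l₁ : ∀ t p a b c d x y z w → + 2 * (t * a + p * x + (t * b + p * y) - (t * c + p * z) - (t * d + p * w)) ≡ + 2 * (t * (a + b - c - d)) + p * (+ 2 * (x + y - z - w))
      l₁ = solve-∀
      l₂ : ∀ t p a b c d x y z w → + 2 * (t * a + p * x - (t * b + p * y) + (t * c + p * z) - (t * d + p * w)) ≡ + 2 * (t * (a - b + c - d)) + p * (+ 2 * (x - y + z - w))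
      l₂ = solve-∀
      l₃ : ∀ t p a b c d x y z w → + 2 * (t * a + p * x - (t * b + p * y) - (t * c + p * z) + (t * d + p * w)) ≡ + 2 * (t * (a - b - c + d)) + p * (+ 2 * (x - y - z + w))
      l₃ = solve-∀

    1≤E : 1 ℕ.≤ E
    1≤E = let (k , e) = odd⇒1+2k E E-odd in subst (1 ℕ.≤_) (sym e) (s≤s z≤n)

    cofactor-norm : ∀ m q a r → norm q ≡ + E * m → q ≡ a ⊗ r → norm a ≡ + E → norm r ≡ m
    cofactor-norm m q a r nq e na with E | 1≤E
    ... | suc E' | _ = ℤ.*-cancelˡ-≡ (+ suc E') (norm r) m (trans (cong (_* norm r) (sym na)) (trans (sym (norm-⊗ a r)) (trans (cong norm (sym e)) nq)))

    odd-terms : ∃ λ m → + t * + t * + E + + p * + p * + j ≡ + 2 * m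
    odd-terms =
      let (k , e) = odd-* (odd-* t-Odd t-Odd) (odd⇒Odd E E-odd)
          (k' , e') = odd-* (odd-* p-odd p-odd) (odd⇒Odd j j-odd)
      in 1ℤ + k + k' , trans (cong₂ _+_ e e') (ring k k')
      where
      ring : ∀ k k' → 1ℤ + + 2 * k + (1ℤ + + 2 * k') ≡ + 2 * (1ℤ + k + k')
      ring = solve-∀

    value' : + n ≡ + t * + t * + E + + p * + p * + j + T * P * l
    value' = trans value (ring (+ t * + t * + E) (T * P * l) (+ p * + p * + j))
      where
      ring : ∀ a b c → a + b + c ≡ a + c + b
      ring = solve-∀

    -- As t²E + p²j is even, l is odd, and 4jE - l² ≡ 4 - 1 = 3 (mod 8) is a sum of three squares.
    -- This gives a quaternion of norm E · 4j with real part l, and its cofactor q has norm 4j, so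
    -- its coordinates are all even or all odd.
    rep-odd : odd n ≡ true → Rep p n
    rep-odd n-odd = go (three-squares D (inj₁ D%8))
      where
      l-odd : odd ∣ l ∣ ≡ true
      l-odd with odd ∣ l ∣ in o
      ... | true  = refl
      ... | false = let (s , l≡) = even-abs⇒2k l o; (m , em) = odd-terms; (k , ek) = odd⇒Odd n n-odd in
        ⊥-elim (2m≢1+2x (m + T * P * s) k (trans (ring m T P s) (trans (sym (trans value' (cong₂ (λ x y → x + T * P * y) em l≡))) ek)))
        where
        ring : ∀ m t p s → + 2 * (m + t * p * s) ≡ + 2 * m + t * p * (+ 2 * s)
        ring = solve-∀
      jE-odd : ∃ λ k → j ℕ.* E ≡ 1 ℕ.+ 2 ℕ.* k
      jE-odd = let (a , ea) = odd⇒1+2k j j-odd; (b , eb) = odd⇒1+2k E E-odd in a ℕ.+ b ℕ.+ 2 ℕ.* a ℕ.* b , trans (cong₂ ℕ._*_ ea eb) (ring a b)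
        where
        ring : ∀ a b → (1 ℕ.+ 2 ℕ.* a) ℕ.* (1 ℕ.+ 2 ℕ.* b) ≡ 1 ℕ.+ 2 ℕ.* (a ℕ.+ b ℕ.+ 2 ℕ.* a ℕ.* b)
        ring = ℕ-Solver.solve-∀
      D : ℕ
      D = 4 ℕ.* (j ℕ.* E) ℕ.∸ ∣ l ∣ ℕ.* ∣ l ∣
      l²≤ : ∣ l ∣ ℕ.* ∣ l ∣ ℕ.≤ 4 ℕ.* (j ℕ.* E)
      l²≤ = ℕ.<⇒≤ definite
      4jE%8 : (4 ℕ.* (j ℕ.* E)) ℕ.% 8 ≡ 4
      4jE%8 = let (k , e) = jE-odd in trans (cong (ℕ._% 8) (trans (cong (4 ℕ.*_) e) (ring k))) (ℕ.[m+kn]%n≡m%n 4 k 8)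
        where
        ring : ∀ k → 4 ℕ.* (1 ℕ.+ 2 ℕ.* k) ≡ 4 ℕ.+ k ℕ.* 8
        ring = ℕ-Solver.solve-∀
      D%8 : D ℕ.% 8 ≡ 3
      D%8 = residue 8 (λ r → ((1 ℕ.+ r) ℕ.% 8 ℕ.≟ 4) →-dec (r ℕ.≟ 3)) D
        (trans (cong (λ u → (u ℕ.+ (D ℕ.% 8)) ℕ.% 8) (sym (odd-sq%8 ∣ l ∣ l-odd))) (trans (sym (remainder 8 (4 ℕ.* (j ℕ.* E)) l²≤)) 4jE%8))
      go : (∃ λ x → ∃ λ y → ∃ λ z → x ℕ.* x ℕ.+ (y ℕ.* y ℕ.+ z ℕ.* z) ≡ D) → Rep p n
      go (Y , Z , W , e) =
        let (a , q , K≡ , na) = factor E 1≤E K (+ 4 * + j) norm-K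
            nq = cofactor-norm (+ 4 * + j) K a q norm-K K≡ na
        in odd-case a q K≡ na nq
        where
        K : ℍ
        K = quat l (+ Y) (+ Z) (+ W)
        norm-K : norm K ≡ + E * (+ 4 * + j)
        norm-K = trans (norm-abs K) (trans (cong +_ (trans (cong (∣ l ∣ ℕ.* ∣ l ∣ ℕ.+_) e) (ℕ.m+[n∸m]≡n l²≤))) (trans (cong +_ (ring j E)) (trans (ℤ.pos-* E (4 ℕ.* j)) (cong (_*_ (+ E)) (ℤ.pos-* 4 j)))))
          where
          ring : ∀ j E → 4 ℕ.* (j ℕ.* E) ≡ E ℕ.* (4 ℕ.* j)
          ring = ℕ-Solver.solve-∀
        odd-case : ∀ a q → K ≡ a ⊗ q → norm a ≡ + E → norm q ≡ + 4 * + j → Rep p n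
        odd-case a q@(quat q₀ q₁ q₂ q₃) K≡ na nq = decide (odd ∣ q₀ ∣) refl (odd ∣ q₁ ∣) refl (odd ∣ q₂ ∣) refl (odd ∣ q₃ ∣) refl
          where
          bits : (bit (odd ∣ q₀ ∣) ℕ.+ (bit (odd ∣ q₁ ∣) ℕ.+ (bit (odd ∣ q₂ ∣) ℕ.+ bit (odd ∣ q₃ ∣)))) ℕ.% 4 ≡ 0
          bits = trans (sym (Φ%4 (∣ q₀ ∣) (∣ q₁ ∣) (∣ q₂ ∣) (∣ q₃ ∣))) (trans (cong (ℕ._% 4) (ℤ.+-injective (trans (sym (norm-abs q)) (trans nq (sym (ℤ.pos-* 4 j)))))) (trans (cong (ℕ._% 4) (ℕ.*-comm 4 j)) (ℕ.m*n%n≡0 j 4)))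
          re≡l : ℍ.re (a ⊗ q) ≡ l
          re≡l = cong ℍ.re (sym K≡)
          norm-V : norm ((+ 2 * T) · a ⊕ P · conj q) ≡ + 4 * + n
          norm-V = trans (norm-combination (+ 2 * T) a q) (trans (cong₂ (λ x y → + 2 * T * (+ 2 * T) * x + + 2 * (+ 2 * T * P * y) + P * P * norm q) na re≡l) (trans (cong (λ z → + 2 * T * (+ 2 * T) * + E + + 2 * (+ 2 * T * P * l) + P * P * z) nq) (trans (ring T P (+ E) l (+ j)) (cong (_*_ (+ 4)) (sym value)))))
            where
            ring : ∀ t p e l j → + 2 * t * (+ 2 * t) * e + + 2 * (+ 2 * t * p * l) + p * p * (+ 4 * j) ≡ + 4 * (t * t * e + t * p * l + p * p * j)
            ring = solve-∀
          -- With q even, the real part of a q would be even, but it is l.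
          not-all-even : odd ∣ q₀ ∣ ≡ false → odd ∣ q₁ ∣ ≡ false → odd ∣ q₂ ∣ ≡ false → odd ∣ q₃ ∣ ≡ false → ⊥
          not-all-even o₀ o₁ o₂ o₃ with even-abs⇒2k q₀ o₀ | even-abs⇒2k q₁ o₁ | even-abs⇒2k q₂ o₂ | even-abs⇒2k q₃ o₃ | odd-abs⇒Odd l l-odd
          ... | k₀ , e₀ | k₁ , e₁ | k₂ , e₂ | k₃ , e₃ | s , l≡ =
            2m≢1+2x (ℍ.re a * k₀ - ℍ.im a * k₁ - ℍ.jm a * k₂ - ℍ.km a * k₃) s (trans (ring (ℍ.re a) (ℍ.im a) (ℍ.jm a) (ℍ.km a) k₀ k₁ k₂ k₃)
              (trans (sym (cong₂ _-_ (cong₂ _-_ (cong₂ _-_ (cong (_*_ (ℍ.re a)) e₀) (cong (_*_ (ℍ.im a)) e₁)) (cong (_*_ (ℍ.jm a)) e₂)) (cong (_*_ (ℍ.km a)) e₃))) (trans re≡l l≡)))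
            where
            ring : ∀ a b c d x y z w → + 2 * (a * x - b * y - c * z - d * w) ≡ a * (+ 2 * x) - b * (+ 2 * y) - c * (+ 2 * z) - d * (+ 2 * w)
            ring = solve-∀
          decide : ∀ b₀ → odd ∣ q₀ ∣ ≡ b₀ → ∀ b₁ → odd ∣ q₁ ∣ ≡ b₁ → ∀ b₂ → odd ∣ q₂ ∣ ≡ b₂ → ∀ b₃ → odd ∣ q₃ ∣ ≡ b₃ → Rep p n
          decide b₀ o₀ b₁ o₁ b₂ o₂ b₃ o₃ = resolve b₀ o₀ b₁ o₁ b₂ o₂ b₃ o₃ (subst (λ z → z ℕ.% 4 ≡ 0) (cong₂ ℕ._+_ (cong bit o₀) (cong₂ ℕ._+_ (cong bit o₁) (cong₂ ℕ._+_ (cong bit o₂) (cong bit o₃)))) bits)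
            where
            resolve : ∀ b₀ → odd ∣ q₀ ∣ ≡ b₀ → ∀ b₁ → odd ∣ q₁ ∣ ≡ b₁ → ∀ b₂ → odd ∣ q₂ ∣ ≡ b₂ → ∀ b₃ → odd ∣ q₃ ∣ ≡ b₃ → (bit b₀ ℕ.+ (bit b₁ ℕ.+ (bit b₂ ℕ.+ bit b₃))) ℕ.% 4 ≡ 0 → Rep p n
            resolve true o₀ true o₁ true o₂ true o₃ _ = finish-odd a (conj q) na norm-V (odd-abs⇒Odd q₀ o₀) (odd-neg (odd-abs⇒Odd q₁ o₁)) (odd-neg (odd-abs⇒Odd q₂ o₂)) (odd-neg (odd-abs⇒Odd q₃ o₃))
            resolve false o₀ false o₁ false o₂ false o₃ _ = ⊥-elim (not-all-even o₀ o₁ o₂ o₃)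
            resolve true  _ false _ false _ false _ ()
            resolve false _ true  _ false _ false _ ()
            resolve false _ false _ true  _ false _ ()
            resolve false _ false _ false _ true  _ ()
            resolve true  _ true  _ false _ false _ ()
            resolve true  _ false _ true  _ false _ ()
            resolve true  _ false _ false _ true  _ ()
            resolve false _ true  _ true  _ false _ ()
            resolve false _ true  _ false _ true  _ ()
            resolve false _ false _ true  _ true  _ ()
            resolve false _ true  _ true  _ true  _ ()
            resolve true  _ false _ true  _ true  _ ()
            resolve true  _ true  _ false _ true  _ ()
            resolve true  _ true  _ true  _ false _ ()

    -- Here l = 2s and n ≡ E + j + 2s (mod 4). For even s this gives E + j ≡ 2, so jE - s² ≡ 1; for
    -- odd s it gives E + j ≡ 0, so jE - s² ≡ 3 - 1 = 2 (mod 4). Either way jE - s² is a sum of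
    -- three squares. The combination built has even norm n, hence even coordinate sum.
    rep-even : n ℕ.% 4 ≡ 2 → Rep p n
    rep-even n%4 = go (half-l (odd ∣ l ∣) refl)
      where
      N₂ : ℕ
      N₂ = 1 ℕ.+ 2 ℕ.* (n ℕ./ 4)
      n≡2N₂ : + n ≡ + 2 * + N₂
      n≡2N₂ = trans (cong +_ (trans (ℕ.m≡m%n+[m/n]*n n 4) (trans (cong (ℕ._+ n ℕ./ 4 ℕ.* 4) n%4) (ring (n ℕ./ 4))))) (ℤ.pos-* 2 N₂)
        where
        ring : ∀ k → 2 ℕ.+ k ℕ.* 4 ≡ 2 ℕ.* (1 ℕ.+ 2 ℕ.* k)
        ring = ℕ-Solver.solve-∀
      half-l : ∀ b → odd ∣ l ∣ ≡ b → ∃ λ s → l ≡ + 2 * s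
      half-l false o = even-abs⇒2k l o
      half-l true  o = let (m , em) = odd-terms; (k , ek) = even+odd m (odd-* (odd-* t-Odd p-odd) (odd-abs⇒Odd l o)) in
        ⊥-elim (2m≢1+2x (+ N₂) k (trans (sym n≡2N₂) (trans value' (trans (cong (_+ T * P * l) em) ek))))
      go : (∃ λ s → l ≡ + 2 * s) → Rep p n
      go (s , l≡2s) = represent (three-squares D (inj₂ D%4))
        where
        abs-l : ∣ l ∣ ≡ 2 ℕ.* ∣ s ∣
        abs-l = trans (cong ∣_∣ l≡2s) (ℤ.abs-* (+ 2) s)
        s²< : ∣ s ∣ ℕ.* ∣ s ∣ ℕ.< j ℕ.* E
        s²< = ℕ.*-cancelˡ-< 4 _ _ (subst (ℕ._< 4 ℕ.* (j ℕ.* E)) (trans (cong (λ z → z ℕ.* z) abs-l) (ring ∣ s ∣)) definite)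
          where
          ring : ∀ k → 2 ℕ.* k ℕ.* (2 ℕ.* k) ≡ 4 ℕ.* (k ℕ.* k)
          ring = ℕ-Solver.solve-∀
        D : ℕ
        D = j ℕ.* E ℕ.∸ ∣ s ∣ ℕ.* ∣ s ∣
        n≡E+j+2s : ∃ λ X → + n ≡ + E + + j + + 2 * s + + 4 * X
        n≡E+j+2s = let (a , ea) = t-Odd; (b , eb) = p-odd in (a + a * a) * + E + (b + b * b) * + j + (a + b + + 2 * a * b) * s ,
            trans value (trans (cong₂ (λ t p → t * t * + E + t * p * l + p * p * + j) ea eb) (trans (cong (λ z → (1ℤ + + 2 * a) * (1ℤ + + 2 * a) * + E + (1ℤ + + 2 * a) * (1ℤ + + 2 * b) * z + (1ℤ + + 2 * b) * (1ℤ + + 2 * b) * + j) l≡2s) (ring a b (+ E) (+ j) s)))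
          where
          ring : ∀ a b e j s → (1ℤ + + 2 * a) * (1ℤ + + 2 * a) * e + (1ℤ + + 2 * a) * (1ℤ + + 2 * b) * (+ 2 * s) + (1ℤ + + 2 * b) * (1ℤ + + 2 * b) * j
            ≡ e + j + + 2 * s + + 4 * ((a + a * a) * e + (b + b * b) * j + (a + b + + 2 * a * b) * s)
          ring = solve-∀
        jE%4 : ∀ σ → odd ∣ s ∣ ≡ σ → (j ℕ.* E) ℕ.% 4 ≡ (if σ then 3 else 1)
        jE%4 false o = let (μ , es) = even-abs⇒2k s o; (X , eX) = n≡E+j+2s in
          odd-product E j E-odd j-odd 2 1 (inj₁ (refl , refl)) (trans (sym (mod-4 n (E ℕ.+ j) (μ + X) (trans eX (trans (cong (λ z → + E + + j + + 2 * z + + 4 * X) es) (ring (+ E + + j) μ X))))) n%4)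
          where
          ring : ∀ e μ X → e + + 2 * (+ 2 * μ) + + 4 * X ≡ e + + 4 * (μ + X)
          ring = solve-∀
        jE%4 true o = let (μ , es) = odd-abs⇒Odd s o; (X , eX) = n≡E+j+2s in
          odd-product E j E-odd j-odd 0 3 (inj₂ (refl , refl)) (residue 4 (λ r → ((2 ℕ.+ r) ℕ.% 4 ℕ.≟ 2) →-dec (r ℕ.≟ 0)) (E ℕ.+ j)
            (trans (sym (ℕ.%-distribˡ-+ 2 (E ℕ.+ j) 4)) (trans (sym (mod-4 n (2 ℕ.+ (E ℕ.+ j)) (μ + X) (trans eX (trans (cong (λ z → + E + + j + + 2 * z + + 4 * X) es) (ring (+ E + + j) μ X))))) n%4)))
          where
          ring : ∀ e μ X → e + + 2 * (1ℤ + + 2 * μ) + + 4 * X ≡ + 2 + e + + 4 * (μ + X)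
          ring = solve-∀
        split-jE : (j ℕ.* E) ℕ.% 4 ≡ (bit (odd ∣ s ∣) ℕ.+ D ℕ.% 4) ℕ.% 4
        split-jE = trans (remainder 4 (j ℕ.* E) (ℕ.<⇒≤ s²<)) (cong (λ u → (u ℕ.+ D ℕ.% 4) ℕ.% 4) (sq%4 ∣ s ∣))
        D%4 : D ℕ.% 4 ≡ 1 ⊎ D ℕ.% 4 ≡ 2
        D%4 = decide (odd ∣ s ∣) refl
          where
          decide : ∀ σ → odd ∣ s ∣ ≡ σ → D ℕ.% 4 ≡ 1 ⊎ D ℕ.% 4 ≡ 2
          decide false o = inj₁ (residue 4 (λ r → ((0 ℕ.+ r) ℕ.% 4 ℕ.≟ 1) →-dec (r ℕ.≟ 1)) D (trans (cong (λ σ → (bit σ ℕ.+ D ℕ.% 4) ℕ.% 4) (sym o)) (trans (sym split-jE) (jE%4 false o))))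
          decide true  o = inj₂ (residue 4 (λ r → ((1 ℕ.+ r) ℕ.% 4 ℕ.≟ 3) →-dec (r ℕ.≟ 2)) D (trans (cong (λ σ → (bit σ ℕ.+ D ℕ.% 4) ℕ.% 4) (sym o)) (trans (sym split-jE) (jE%4 true o))))
        represent : (∃ λ x → ∃ λ y → ∃ λ z → x ℕ.* x ℕ.+ (y ℕ.* y ℕ.+ z ℕ.* z) ≡ D) → Rep p n
        represent (Y , Z , W , e) =
          let (a , q , K≡ , na) = factor E 1≤E K (+ j) norm-K
              nq = cofactor-norm (+ j) K a q norm-K K≡ na
              nV = norm-V a q K≡ na nq
              (k , ek) = norm-parity (T · a ⊕ P · conj q)
          in finish-even a (conj q) na nV (+ N₂ + k) (trans ek (trans (cong (_+ + 2 * k) (trans nV n≡2N₂)) (sym (ℤ.*-distribˡ-+ (+ 2) (+ N₂) k))))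
          where
          K : ℍ
          K = quat s (+ Y) (+ Z) (+ W)
          norm-K : norm K ≡ + E * + j
          norm-K = trans (norm-abs K) (trans (cong +_ (trans (cong (∣ s ∣ ℕ.* ∣ s ∣ ℕ.+_) e) (ℕ.m+[n∸m]≡n (ℕ.<⇒≤ s²<)))) (trans (cong +_ (ℕ.*-comm j E)) (ℤ.pos-* E j)))
          norm-V : ∀ a q → K ≡ a ⊗ q → norm a ≡ + E → norm q ≡ + j → norm (T · a ⊕ P · conj q) ≡ + n
          norm-V a q K≡ na nq = trans (norm-combination T a q) (trans (cong₂ (λ x y → T * T * x + + 2 * (T * P * y) + P * P * norm q) na (cong ℍ.re (sym K≡)))
            (trans (cong (λ z → T * T * + E + + 2 * (T * P * s) + P * P * z) nq) (trans (ring T P (+ E) s (+ j)) (trans (cong (λ z → T * T * + E + T * P * z + P * P * + j) (sym l≡2s)) (sym value)))))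
            where
            ring : ∀ t p e s j → t * t * e + + 2 * (t * p * s) + p * p * j ≡ t * t * e + t * p * (+ 2 * s) + p * p * j
            ring = solve-∀

    represented : n ℕ.% 4 ≢ 0 → Rep p n
    represented n%4≢0 with residue 4 (λ r → (r ℕ.≟ 0) ⊎-dec ((odd r Bool.≟ true) ⊎-dec (r ℕ.≟ 2))) n
    ... | inj₁ e        = ⊥-elim (n%4≢0 e)
    ... | inj₂ (inj₁ e) = rep-odd (trans (odd-%4 n) e)
    ... | inj₂ (inj₂ e) = rep-even e

-- Choice of the binary form

pronic-even : ∀ a → ∃ λ k → a ℕ.* (1 ℕ.+ a) ≡ 2 ℕ.* k
pronic-even zero    = 0 , refl
pronic-even (suc a) = let (k , e) = pronic-even a in k ℕ.+ suc a , trans (r₁ a) (trans (cong (ℕ._+ 2 ℕ.* suc a) e) (r₂ k a))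
  where
  r₁ : ∀ a → suc a ℕ.* (1 ℕ.+ suc a) ≡ a ℕ.* (1 ℕ.+ a) ℕ.+ 2 ℕ.* suc a
  r₁ = ℕ-Solver.solve-∀
  r₂ : ∀ k a → 2 ℕ.* k ℕ.+ 2 ℕ.* suc a ≡ 2 ℕ.* (k ℕ.+ suc a)
  r₂ = ℕ-Solver.solve-∀

odd-2* : ∀ k → odd (2 ℕ.* k) ≡ false
odd-2* k = trans (odd-+ k (k ℕ.+ 0)) (trans (cong (λ z → odd k xor odd z) (ℕ.+-identityʳ k)) (xor-self (odd k)))

odd-1+2* : ∀ k → odd (1 ℕ.+ 2 ℕ.* k) ≡ true
odd-1+2* k = cong not (odd-2* k)

distance-≤ : ∀ m n k → m ℕ.≤ n ℕ.+ k → n ℕ.≤ m ℕ.+ k → ∣ + m - + n ∣ ℕ.≤ k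
distance-≤ m n k h₁ h₂ with m ℕ.≤? n
... | yes m≤n = subst (ℕ._≤ k) (sym (trans (cong ∣_∣ (trans (ℤ.m-n≡m⊖n m n) (ℤ.⊖-≤ m≤n))) (ℤ.∣-i∣≡∣i∣ (+ (n ℕ.∸ m))))) (ℕ.m≤n+o⇒m∸n≤o n m h₂)
... | no  m≰n = subst (ℕ._≤ k) (sym (cong ∣_∣ (trans (ℤ.m-n≡m⊖n m n) (ℤ.⊖-≥ (ℕ.<⇒≤ (ℕ.≰⇒> m≰n)))))) (ℕ.m≤n+o⇒m∸n≤o m n h₁)

odd-summand : ∀ x y → odd y ≡ true → odd (x ℕ.+ y) ≡ false → odd x ≡ true
odd-summand x y oy oxy with odd x | trans (sym (odd-+ x y)) oxy
... | true  | _ = refl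
... | false | e rewrite oy = sym e

-- The largest odd E ≡ n (mod p) below p²/4, where p = 17 + 2b; here 9 + b inverts 2 modulo p.
module Residue (b n p h c i q₀ : ℕ) (p≡ : p ≡ 17 ℕ.+ 2 ℕ.* b) (h≡ : h ≡ 72 ℕ.+ 17 ℕ.* b ℕ.+ b ℕ.* b)
  (c≡ : c ≡ 71 ℕ.+ 17 ℕ.* b ℕ.+ b ℕ.* b ℕ.+ (16 ℕ.+ 2 ℕ.* b) ℕ.* n) (i<p : i ℕ.< p) (division : c ℕ.* (9 ℕ.+ b) ≡ i ℕ.+ q₀ ℕ.* p) where

  -- Here h = (p² - 1)/4 is even and c ≡ h - 1 - n (mod p), with -n written as (p - 1)n to stay in
  -- ℕ. Hence 2i ≡ h - 1 - n and h - 1 - 2i ≡ n (mod p). Since i < p, at most 2p - 1 is subtracted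
  -- from h.
  E : ℕ
  E = h ℕ.∸ (1 ℕ.+ 2 ℕ.* i)

  p²≡ : p ℕ.* p ≡ 1 ℕ.+ 4 ℕ.* h
  p²≡ = trans (cong (λ z → z ℕ.* z) p≡) (trans (ring b) (cong (λ z → 1 ℕ.+ 4 ℕ.* z) (sym h≡)))
    where
    ring : ∀ b → (17 ℕ.+ 2 ℕ.* b) ℕ.* (17 ℕ.+ 2 ℕ.* b) ≡ 1 ℕ.+ 4 ℕ.* (72 ℕ.+ 17 ℕ.* b ℕ.+ b ℕ.* b)
    ring = ℕ-Solver.solve-∀

  1+2i≤ : 1 ℕ.+ 2 ℕ.* i ℕ.≤ 33 ℕ.+ 4 ℕ.* b
  1+2i≤ = ℕ.≤-trans (s≤s (ℕ.*-monoʳ-≤ 2 (ℕ.≤-pred (subst (i ℕ.<_) p≡ i<p)))) (ℕ.≤-reflexive (ring b))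
    where
    ring : ∀ b → 1 ℕ.+ 2 ℕ.* (16 ℕ.+ 2 ℕ.* b) ≡ 33 ℕ.+ 4 ℕ.* b
    ring = ℕ-Solver.solve-∀

  1+2i≤h : 1 ℕ.+ 2 ℕ.* i ℕ.≤ h
  1+2i≤h = ℕ.≤-trans 1+2i≤ (ℕ.≤-trans (ℕ.m≤m+n (33 ℕ.+ 4 ℕ.* b) (39 ℕ.+ 13 ℕ.* b ℕ.+ b ℕ.* b)) (ℕ.≤-reflexive (trans (ring b) (sym h≡))))
    where
    ring : ∀ b → 33 ℕ.+ 4 ℕ.* b ℕ.+ (39 ℕ.+ 13 ℕ.* b ℕ.+ b ℕ.* b) ≡ 72 ℕ.+ 17 ℕ.* b ℕ.+ b ℕ.* b
    ring = ℕ-Solver.solve-∀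

  E+ : E ℕ.+ (1 ℕ.+ 2 ℕ.* i) ≡ h
  E+ = ℕ.m∸n+n≡m 1+2i≤h

  E-odd : odd E ≡ true
  E-odd = odd-summand E (1 ℕ.+ 2 ℕ.* i) (odd-1+2* i) (trans (cong odd E+) h-even)
    where
    h-even : odd h ≡ false
    h-even = let (k , e) = pronic-even (8 ℕ.+ b) in trans (cong odd (trans h≡ (trans (ring b) e))) (odd-2* k)
      where
      ring : ∀ b → 72 ℕ.+ 17 ℕ.* b ℕ.+ b ℕ.* b ≡ (8 ℕ.+ b) ℕ.* (1 ℕ.+ (8 ℕ.+ b))
      ring = ℕ-Solver.solve-∀

  E≤h : E ℕ.≤ h
  E≤h = ℕ.m∸n≤m h (1 ℕ.+ 2 ℕ.* i)

  small : 4 ℕ.* E ℕ.< p ℕ.* p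
  small = subst (4 ℕ.* E ℕ.<_) (sym p²≡) (s≤s (ℕ.*-monoʳ-≤ 4 E≤h))

  E-large : 39 ℕ.+ 13 ℕ.* b ℕ.+ b ℕ.* b ℕ.≤ E
  E-large = ℕ.+-cancelʳ-≤ (33 ℕ.+ 4 ℕ.* b) (39 ℕ.+ 13 ℕ.* b ℕ.+ b ℕ.* b) E (ℕ.≤-trans (ℕ.≤-reflexive (trans (ring b) (trans (sym h≡) (sym E+)))) (ℕ.+-monoʳ-≤ E 1+2i≤))
    where
    ring : ∀ b → 39 ℕ.+ 13 ℕ.* b ℕ.+ b ℕ.* b ℕ.+ (33 ℕ.+ 4 ℕ.* b) ≡ 72 ℕ.+ 17 ℕ.* b ℕ.+ b ℕ.* b
    ring = ℕ-Solver.solve-∀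

  congruence : n ℕ.+ p ℕ.* (2 ℕ.* q₀) ≡ E ℕ.+ p ℕ.* (n ℕ.+ c)
  congruence = ℕ.+-cancelʳ-≡ (1 ℕ.+ 2 ℕ.* i) (n ℕ.+ p ℕ.* (2 ℕ.* q₀)) (E ℕ.+ p ℕ.* (n ℕ.+ c)) (begin
    n ℕ.+ p ℕ.* (2 ℕ.* q₀) ℕ.+ (1 ℕ.+ 2 ℕ.* i) ≡⟨ r₁ n p q₀ i ⟩
    1 ℕ.+ n ℕ.+ 2 ℕ.* (i ℕ.+ q₀ ℕ.* p) ≡⟨ cong (λ z → 1 ℕ.+ n ℕ.+ 2 ℕ.* z) (sym division) ⟩
    1 ℕ.+ n ℕ.+ 2 ℕ.* (c ℕ.* (9 ℕ.+ b)) ≡⟨ cong (λ z → 1 ℕ.+ n ℕ.+ 2 ℕ.* (z ℕ.* (9 ℕ.+ b))) c≡ ⟩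
    1 ℕ.+ n ℕ.+ 2 ℕ.* ((71 ℕ.+ 17 ℕ.* b ℕ.+ b ℕ.* b ℕ.+ (16 ℕ.+ 2 ℕ.* b) ℕ.* n) ℕ.* (9 ℕ.+ b)) ≡⟨ r₂ n b ⟩
    72 ℕ.+ 17 ℕ.* b ℕ.+ b ℕ.* b ℕ.+ (17 ℕ.+ 2 ℕ.* b) ℕ.* (n ℕ.+ (71 ℕ.+ 17 ℕ.* b ℕ.+ b ℕ.* b ℕ.+ (16 ℕ.+ 2 ℕ.* b) ℕ.* n))
      ≡⟨ sym (cong₂ ℕ._+_ h≡ (cong₂ (λ x y → x ℕ.* (n ℕ.+ y)) p≡ c≡)) ⟩
    h ℕ.+ p ℕ.* (n ℕ.+ c) ≡⟨ cong (ℕ._+ p ℕ.* (n ℕ.+ c)) (sym E+) ⟩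
    E ℕ.+ (1 ℕ.+ 2 ℕ.* i) ℕ.+ p ℕ.* (n ℕ.+ c) ≡⟨ r₃ E (1 ℕ.+ 2 ℕ.* i) (p ℕ.* (n ℕ.+ c)) ⟩
    E ℕ.+ p ℕ.* (n ℕ.+ c) ℕ.+ (1 ℕ.+ 2 ℕ.* i) ∎)
    where
    open ≡-Reasoning
    r₁ : ∀ n p q i → n ℕ.+ p ℕ.* (2 ℕ.* q) ℕ.+ (1 ℕ.+ 2 ℕ.* i) ≡ 1 ℕ.+ n ℕ.+ 2 ℕ.* (i ℕ.+ q ℕ.* p)
    r₁ = ℕ-Solver.solve-∀
    r₂ : ∀ n b → 1 ℕ.+ n ℕ.+ 2 ℕ.* ((71 ℕ.+ 17 ℕ.* b ℕ.+ b ℕ.* b ℕ.+ (16 ℕ.+ 2 ℕ.* b) ℕ.* n) ℕ.* (9 ℕ.+ b))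
      ≡ 72 ℕ.+ 17 ℕ.* b ℕ.+ b ℕ.* b ℕ.+ (17 ℕ.+ 2 ℕ.* b) ℕ.* (n ℕ.+ (71 ℕ.+ 17 ℕ.* b ℕ.+ b ℕ.* b ℕ.+ (16 ℕ.+ 2 ℕ.* b) ℕ.* n))
    r₂ = ℕ-Solver.solve-∀
    r₃ : ∀ e x y → e ℕ.+ x ℕ.+ y ≡ e ℕ.+ y ℕ.+ x
    r₃ = ℕ-Solver.solve-∀

  h<p² : h ℕ.< p ℕ.* p
  h<p² = subst (h ℕ.<_) (sym p²≡) (s≤s (ℕ.m≤n*m h 4))

  p∣n-E : p ℕ.* p ℕ.≤ n → p ∣ℕ (n ℕ.∸ E)
  p∣n-E p²≤n = ∣m+n∣m⇒∣n (divides (n ℕ.+ c) (trans (ℕ.+-cancelˡ-≡ E (p ℕ.* (2 ℕ.* q₀) ℕ.+ (n ℕ.∸ E)) (p ℕ.* (n ℕ.+ c))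
      (trans (r E (p ℕ.* (2 ℕ.* q₀)) (n ℕ.∸ E)) (trans (cong (ℕ._+ p ℕ.* (2 ℕ.* q₀)) (ℕ.m+[n∸m]≡n E≤n)) congruence))) (ℕ.*-comm p (n ℕ.+ c)))) (m∣m*n (2 ℕ.* q₀))
    where
    E≤n : E ℕ.≤ n
    E≤n = ℕ.≤-trans E≤h (ℕ.≤-trans (ℕ.<⇒≤ h<p²) p²≤n)
    r : ∀ e x y → e ℕ.+ (x ℕ.+ y) ≡ e ℕ.+ y ℕ.+ x
    r = ℕ-Solver.solve-∀

  below-4E : ∀ k → p ≡ 5 ℕ.+ k → k ℕ.* k ℕ.< 4 ℕ.* E
  below-4E k e = ℕ.<-≤-trans (ℕ.<-≤-trans (ℕ.m<m+n (k ℕ.* k) (s≤s z≤n)) (ℕ.≤-reflexive (trans (cong (λ z → z ℕ.* z ℕ.+ suc (11 ℕ.+ 4 ℕ.* b)) k≡) (gap b)))) (ℕ.*-monoʳ-≤ 4 E-large)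
    where
    k≡ : k ≡ 12 ℕ.+ 2 ℕ.* b
    k≡ = ℕ.+-cancelˡ-≡ 5 k (12 ℕ.+ 2 ℕ.* b) (trans (sym e) p≡)
    gap : ∀ b → (12 ℕ.+ 2 ℕ.* b) ℕ.* (12 ℕ.+ 2 ℕ.* b) ℕ.+ suc (11 ℕ.+ 4 ℕ.* b) ≡ 4 ℕ.* (39 ℕ.+ 13 ℕ.* b ℕ.+ b ℕ.* b)
    gap = ℕ-Solver.solve-∀

  -- This estimate is what starts the general argument at 17: the worst case E = h - (2p - 1) gives
  -- 12 · 39 > 21² for p = 17, but only 12 · 17 < 17² for p = 13.
  below-12E : (4 ℕ.+ p) ℕ.* (4 ℕ.+ p) ℕ.< 12 ℕ.* E
  below-12E = ℕ.<-≤-trans (ℕ.<-≤-trans (ℕ.m<m+n ((4 ℕ.+ p) ℕ.* (4 ℕ.+ p)) (s≤s z≤n)) (ℕ.≤-reflexive (trans (cong (λ z → (4 ℕ.+ z) ℕ.* (4 ℕ.+ z) ℕ.+ suc (26 ℕ.+ 72 ℕ.* b ℕ.+ 8 ℕ.* (b ℕ.* b))) p≡) (gap b)))) (ℕ.*-monoʳ-≤ 12 E-large)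
    where
    gap : ∀ b → (4 ℕ.+ (17 ℕ.+ 2 ℕ.* b)) ℕ.* (4 ℕ.+ (17 ℕ.+ 2 ℕ.* b)) ℕ.+ suc (26 ℕ.+ 72 ℕ.* b ℕ.+ 8 ℕ.* (b ℕ.* b)) ≡ 12 ℕ.* (39 ℕ.+ 13 ℕ.* b ℕ.+ b ℕ.* b)
    gap = ℕ-Solver.solve-∀

  E+4p<p² : E ℕ.+ 4 ℕ.* p ℕ.< p ℕ.* p
  E+4p<p² = ℕ.≤-<-trans (ℕ.+-monoˡ-≤ (4 ℕ.* p) E≤h) (ℕ.<-≤-trans (ℕ.m<m+n (h ℕ.+ 4 ℕ.* p) (s≤s z≤n))
    (ℕ.≤-reflexive (trans (cong₂ (λ x y → x ℕ.+ 4 ℕ.* y ℕ.+ suc (148 ℕ.+ 43 ℕ.* b ℕ.+ 3 ℕ.* (b ℕ.* b))) h≡ p≡) (trans (gap b) (cong (λ z → z ℕ.* z) (sym p≡))))))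
    where
    gap : ∀ b → 72 ℕ.+ 17 ℕ.* b ℕ.+ b ℕ.* b ℕ.+ 4 ℕ.* (17 ℕ.+ 2 ℕ.* b) ℕ.+ suc (148 ℕ.+ 43 ℕ.* b ℕ.+ 3 ℕ.* (b ℕ.* b)) ≡ (17 ℕ.+ 2 ℕ.* b) ℕ.* (17 ℕ.+ 2 ℕ.* b)
    gap = ℕ-Solver.solve-∀

module Choice (p k n E v u : ℕ) (p≡ : p ≡ 5 ℕ.+ k) (p∤1 : ¬ (p ∣ℕ 1)) (E-odd : odd E ≡ true) (small : 4 ℕ.* E ℕ.< p ℕ.* p)
  (below-4E : k ℕ.* k ℕ.< 4 ℕ.* E) (below-12E : (4 ℕ.+ p) ℕ.* (4 ℕ.+ p) ℕ.< 12 ℕ.* E) (E+4p<p² : E ℕ.+ 4 ℕ.* p ℕ.< p ℕ.* p)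
  (n≡ : n ≡ E ℕ.+ (v ℕ.+ u ℕ.* (2 ℕ.* p)) ℕ.* p) (v<2p : v ℕ.< 2 ℕ.* p) (p²≤n : p ℕ.* p ℕ.≤ n) where

  make : ∀ j l → odd j ≡ true → + v + + u * (+ 2 * + p) ≡ l + + p * + j → ∣ l ∣ ℕ.* ∣ l ∣ ℕ.< 4 ℕ.* (j ℕ.* E) → BinaryRep p n
  make j l j-odd eq def = record
    { E = E ; t = 1 ; j = j ; l = l ; E-odd = E-odd ; t-odd = refl ; j-odd = j-odd ; p∤t = p∤1
    ; value = trans (cong +_ n≡) (trans (cong (_+_ (+ E)) (trans (ℤ.pos-* (v ℕ.+ u ℕ.* (2 ℕ.* p)) p) (cong (λ z → (+ v + z) * + p) (trans (ℤ.pos-* u (2 ℕ.* p)) (cong (_*_ (+ u)) (ℤ.pos-* 2 p))))))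
        (trans (cong (λ z → + E + z * + p) eq) (ring (+ E) l (+ p) (+ j))))
    ; small = small ; definite = def }
    where
    ring : ∀ e l p j → e + (l + p * j) * p ≡ 1ℤ * 1ℤ * e + 1ℤ * p * l + p * p * j
    ring = solve-∀

  square-below : ∀ l k X Y → ∣ l ∣ ℕ.≤ k → k ℕ.* k ℕ.< X → X ℕ.≤ Y → ∣ l ∣ ℕ.* ∣ l ∣ ℕ.< Y
  square-below l k X Y h₁ h₂ h₃ = ℕ.<-≤-trans (ℕ.≤-<-trans (ℕ.*-mono-≤ h₁ h₁) h₂) h₃

  centre : ℤ
  centre = + v - + p

  three : 12 ℕ.* E ≡ 4 ℕ.* (3 ℕ.* E)
  three = ℕ.*-assoc 4 3 E

  v≤p+p : v ℕ.≤ p ℕ.+ p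
  v≤p+p = ℕ.≤-trans (ℕ.<⇒≤ v<2p) (ℕ.≤-reflexive (cong (p ℕ.+_) (ℕ.+-identityʳ p)))

  -- With t = 1 the condition is m = l + pj for the quotient m = v + 2pu of n - E by p. If u ≥ 1,
  -- take j = 1 + 2u ≥ 3 and l = v - p, so that l² ≤ p² < 12E. If u = 0, then j = 1 requires l² <
  -- 4E, which holds for 5 ≤ v ≤ 2p - 5, where the absolute value of l is at most p - 5. A smaller v
  -- contradicts n ≥ p²; for a larger v take j = 3 and l = v - 3p, of absolute value at most p + 4.
  select : BinaryRep p n
  select = by-u u refl
    where
    by-u : ∀ w → u ≡ w → BinaryRep p n
    by-u (suc w) eu = make (1 ℕ.+ 2 ℕ.* u) centre (odd-1+2* u)
        (trans (ring (+ v) (+ u) (+ p)) (cong (λ z → centre + + p * (1ℤ + z)) (sym (ℤ.pos-* 2 u))))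
        (square-below centre (4 ℕ.+ p) (12 ℕ.* E) (4 ℕ.* ((1 ℕ.+ 2 ℕ.* u) ℕ.* E))
          (ℕ.≤-trans (distance-≤ v p p v≤p+p (ℕ.m≤n+m p v)) (ℕ.m≤n+m p 4)) below-12E
          (ℕ.≤-trans (ℕ.≤-reflexive three) (ℕ.*-monoʳ-≤ 4 (ℕ.*-monoˡ-≤ E {3} {1 ℕ.+ 2 ℕ.* u} (subst (λ z → 3 ℕ.≤ 1 ℕ.+ 2 ℕ.* z) (sym eu) (s≤s (ℕ.*-monoʳ-≤ 2 {1} {suc w} (s≤s z≤n))))))))
      where
      ring : ∀ v u p → v + u * (+ 2 * p) ≡ v - p + p * (1ℤ + + 2 * u)
      ring = solve-∀
    by-u zero eu = by-v (5 ℕ.≤? v) (v ℕ.≤? p ℕ.+ k)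
      where
      u-gone : + v + + u * (+ 2 * + p) ≡ + v
      u-gone = trans (cong (λ z → + v + + z * (+ 2 * + p)) eu) (ℤ.+-identityʳ (+ v))
      by-v : Dec (5 ℕ.≤ v) → Dec (v ℕ.≤ p ℕ.+ k) → BinaryRep p n
      by-v (no v<5) _ = ⊥-elim (ℕ.<⇒≱ too-small p²≤n)
        where
        n≡' : n ≡ E ℕ.+ v ℕ.* p
        n≡' = trans n≡ (trans (cong (λ z → E ℕ.+ (v ℕ.+ z ℕ.* (2 ℕ.* p)) ℕ.* p) eu) (cong (λ z → E ℕ.+ z ℕ.* p) (ℕ.+-identityʳ v)))
        too-small : n ℕ.< p ℕ.* p
        too-small = ℕ.≤-<-trans (ℕ.≤-trans (ℕ.≤-reflexive n≡') (ℕ.+-monoʳ-≤ E (ℕ.*-monoˡ-≤ p (ℕ.≤-pred (ℕ.≰⇒> v<5))))) E+4p<p²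
      by-v (yes 5≤v) (yes v≤) = make 1 centre refl (trans u-gone (ring (+ v) (+ p)))
          (square-below centre k (4 ℕ.* E) (4 ℕ.* (1 ℕ.* E)) (distance-≤ v p k v≤ (ℕ.≤-trans (ℕ.≤-reflexive p≡) (ℕ.+-monoˡ-≤ k 5≤v))) below-4E
            (ℕ.*-monoʳ-≤ 4 (ℕ.≤-reflexive (sym (ℕ.*-identityˡ E)))))
        where
        ring : ∀ v p → v ≡ v - p + p * 1ℤ
        ring = solve-∀
      by-v (yes _) (no v≰) = make 3 (+ v - + (3 ℕ.* p)) refl (trans u-gone (trans (ring (+ v) (+ p)) (cong (λ z → + v - z + + p * + 3) (sym (ℤ.pos-* 3 p)))))
          (square-below (+ v - + (3 ℕ.* p)) (4 ℕ.+ p) (12 ℕ.* E) (4 ℕ.* (3 ℕ.* E))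
            (distance-≤ v (3 ℕ.* p) (4 ℕ.+ p) (ℕ.≤-trans v≤p+p (ℕ.≤-trans (ℕ.≤-reflexive (r₁ p)) (ℕ.≤-trans (ℕ.*-monoˡ-≤ p {2} {3} (s≤s (s≤s z≤n))) (ℕ.m≤m+n (3 ℕ.* p) (4 ℕ.+ p)))))
              (ℕ.≤-trans (ℕ.≤-reflexive (trans (cong (λ z → p ℕ.+ (p ℕ.+ (z ℕ.+ 0))) p≡) (r₂ p k))) (ℕ.+-monoˡ-≤ (4 ℕ.+ p) (ℕ.≰⇒> v≰))))
            below-12E (ℕ.≤-reflexive three))
        where
        ring : ∀ v p → v ≡ v - + 3 * p + p * + 3
        ring = solve-∀
        r₁ : ∀ p → p ℕ.+ p ≡ 2 ℕ.* p
        r₁ = ℕ-Solver.solve-∀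
        r₂ : ∀ p k → p ℕ.+ (p ℕ.+ (5 ℕ.+ k ℕ.+ 0)) ≡ suc (p ℕ.+ k) ℕ.+ (4 ℕ.+ p)
        r₂ = ℕ-Solver.solve-∀

large-prime : ∀ b p n → p ≡ 17 ℕ.+ 2 ℕ.* b → .{{_ : NonZero p}} → .{{_ : NonZero (2 ℕ.* p)}} → p ℕ.* p ℕ.≤ n → BinaryRep p n
large-prime b p n p≡ p²≤n = Choice.select p (12 ℕ.+ 2 ℕ.* b) n E v u p≡ p∤1 E-odd small (below-4E (12 ℕ.+ 2 ℕ.* b) p≡) below-12E E+4p<p² n≡ (ℕ.m%n<n m (2 ℕ.* p)) p²≤n
  where
  h c i q₀ : ℕ
  h = 72 ℕ.+ 17 ℕ.* b ℕ.+ b ℕ.* b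
  c = 71 ℕ.+ 17 ℕ.* b ℕ.+ b ℕ.* b ℕ.+ (16 ℕ.+ 2 ℕ.* b) ℕ.* n
  i = (c ℕ.* (9 ℕ.+ b)) ℕ.% p
  q₀ = (c ℕ.* (9 ℕ.+ b)) ℕ./ p
  open Residue b n p h c i q₀ p≡ refl refl (ℕ.m%n<n (c ℕ.* (9 ℕ.+ b)) p) (ℕ.m≡m%n+[m/n]*n (c ℕ.* (9 ℕ.+ b)) p)
  p∤1 : ¬ (p ∣ℕ 1)
  p∤1 d = ℕ.<⇒≱ (subst (1 ℕ.<_) (sym p≡) (s≤s (s≤s z≤n))) (∣⇒≤ d)
  m v u : ℕ
  m = _∣ℕ_.quotient (p∣n-E p²≤n)
  v = m ℕ.% (2 ℕ.* p)
  u = m ℕ./ (2 ℕ.* p)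
  n≡ : n ≡ E ℕ.+ (v ℕ.+ u ℕ.* (2 ℕ.* p)) ℕ.* p
  n≡ = trans (sym (ℕ.m+[n∸m]≡n (ℕ.≤-trans E≤h (ℕ.≤-trans (ℕ.<⇒≤ h<p²) p²≤n))))
    (cong (E ℕ.+_) (trans (_∣ℕ_.equality (p∣n-E p²≤n)) (cong (ℕ._* p) (ℕ.m≡m%n+[m/n]*n m (2 ℕ.* p)))))

-- Finite search for the primes below 17.

true⇒T : ∀ {b} → b ≡ true → Bool.T b
true⇒T = Equivalence.from Bool.T-≡

anyℕ : (ℕ → Bool) → List ℕ → Bool
anyℕ f []       = false
anyℕ f (x ∷ xs) = f x ∨ anyℕ f xs

anyℕ-sound : ∀ f xs → anyℕ f xs ≡ true → ∃ λ x → f x ≡ true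
anyℕ-sound f (x ∷ xs) h with f x in e
... | true  = x , e
... | false = anyℕ-sound f xs h

allFrom : ℕ → ℕ → (ℕ → Bool) → Bool
allFrom lo zero    f = true
allFrom lo (suc k) f = f lo ∧ allFrom (suc lo) k f

allFrom-sound : ∀ lo k f → allFrom lo k f ≡ true → ∀ n → lo ℕ.≤ n → n ℕ.< lo ℕ.+ k → f n ≡ true
allFrom-sound lo zero    f h n lo≤n n< = ⊥-elim (ℕ.<⇒≱ n< (ℕ.≤-trans (ℕ.≤-reflexive (ℕ.+-identityʳ lo)) lo≤n))
allFrom-sound lo (suc k) f h n lo≤n n< with lo ℕ.≟ n
... | yes refl = ∧ˡ (f lo) h
... | no  lo≢n = allFrom-sound (suc lo) k f (∧ʳ (f lo) h) n (ℕ.≤∧≢⇒< lo≤n lo≢n) (subst (n ℕ.<_) (ℕ.+-suc lo k) n<)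

-- The divisor s is positive in all uses; the shape suc (s ∸ 1) spares a NonZero argument.
quot rem : ℕ → ℕ → ℕ
quot d s = d ℕ./ suc (s ℕ.∸ 1)
rem  d s = d ℕ.% suc (s ℕ.∸ 1)

module Search (p n : ℕ) where

  -- Here d is the distance of n from t²E + p²j, so the absolute value of l can only be d/(tp). The
  -- sign of l is settled in `valid` by which of the two numbers is larger.
  linear : (E t j d : ℕ) → Bool
  linear E t j d = let q = quot d (t ℕ.* p) in (t ℕ.* p ℕ.* q ℕ.≡ᵇ d) ∧ (q ℕ.* q ℕ.<ᵇ 4 ℕ.* (j ℕ.* E))

  base : (E t j : ℕ) → ℕ
  base E t j = t ℕ.* t ℕ.* E ℕ.+ p ℕ.* p ℕ.* j

  valid : (E t j : ℕ) → Bool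
  valid E t j = odd E ∧ (odd t ∧ (odd j ∧ ((t ℕ.<ᵇ p) ∧ ((4 ℕ.* E ℕ.<ᵇ p ℕ.* p) ∧
    (if base E t j ℕ.≤ᵇ n then linear E t j (n ℕ.∸ base E t j) else linear E t j (base E t j ℕ.∸ n))))))

  -- `Es` contains every odd E with 4E < 13², the largest case searched; the lengths of `js` and
  -- `ts` suffice for the windows below.
  js Es ts : List ℕ
  js = 1 ∷ 3 ∷ 5 ∷ 7 ∷ 9 ∷ 11 ∷ 13 ∷ 15 ∷ []
  Es = 1 ∷ 3 ∷ 5 ∷ 7 ∷ 9 ∷ 11 ∷ 13 ∷ 15 ∷ 17 ∷ 19 ∷ 21 ∷ 23 ∷ 25 ∷ 27 ∷ 29 ∷ 31 ∷ 33 ∷ 35 ∷ 37 ∷ 39 ∷ 41 ∷ []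
  ts = 1 ∷ 3 ∷ []

  -- A representation needs n ≡ t²E (mod p). Testing this before trying any j keeps the evaluation
  -- over whole windows feasible.
  searchE : (t E : ℕ) → Bool
  searchE t E = (4 ℕ.* E ℕ.<ᵇ p ℕ.* p) ∧ ((rem n p ℕ.≡ᵇ rem (t ℕ.* t ℕ.* E) p) ∧ anyℕ (valid E t) js)

  searchT : ℕ → Bool
  searchT t = anyℕ (searchE t) Es

  search : Bool
  search = anyℕ searchT ts

  casts : ∀ E t j → + base E t j ≡ + t * + t * + E + + p * + p * + j
  casts E t j = cong₂ _+_ (trans (ℤ.pos-* (t ℕ.* t) E) (cong (_* + E) (ℤ.pos-* t t))) (trans (ℤ.pos-* (p ℕ.* p) j) (cong (_* + j) (ℤ.pos-* p p)))

  valid-sound : ∀ E t j → valid E t j ≡ true → BinaryRep p n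
  valid-sound E t j h = record
    { E = E ; t = t ; j = j ; l = proj₁ linear-part ; E-odd = h₁ ; t-odd = h₂ ; j-odd = h₃
    ; p∤t = λ p∣t → ℕ.<⇒≱ (ℕ.<ᵇ⇒< t p (true⇒T h₄)) (divisor-≤ t h₂ p∣t)
    ; value = proj₁ (proj₂ linear-part) ; small = ℕ.<ᵇ⇒< (4 ℕ.* E) (p ℕ.* p) (true⇒T h₅) ; definite = proj₂ (proj₂ linear-part) }
    where
    r₁ = ∧ʳ (odd E) h
    r₂ = ∧ʳ (odd t) r₁
    r₃ = ∧ʳ (odd j) r₂
    r₄ = ∧ʳ (t ℕ.<ᵇ p) r₃
    h₁ = ∧ˡ (odd E) h
    h₂ = ∧ˡ (odd t) r₁
    h₃ = ∧ˡ (odd j) r₂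
    h₄ = ∧ˡ (t ℕ.<ᵇ p) r₃
    h₅ = ∧ˡ (4 ℕ.* E ℕ.<ᵇ p ℕ.* p) r₄
    h₆ = ∧ʳ (4 ℕ.* E ℕ.<ᵇ p ℕ.* p) r₄
    divisor-≤ : ∀ t → odd t ≡ true → p ∣ℕ t → p ℕ.≤ t
    divisor-≤ (suc t) _ = ∣⇒≤
    Linear : Set
    Linear = ∃ λ l → (+ n ≡ + t * + t * + E + + t * + p * l + + p * + p * + j) × (∣ l ∣ ℕ.* ∣ l ∣ ℕ.< 4 ℕ.* (j ℕ.* E))
    linear-sound : ∀ d → linear E t j d ≡ true → ∃ λ q → d ≡ t ℕ.* p ℕ.* q × q ℕ.* q ℕ.< 4 ℕ.* (j ℕ.* E)
    linear-sound d e = quot d (t ℕ.* p) , sym (ℕ.≡ᵇ⇒≡ (t ℕ.* p ℕ.* quot d (t ℕ.* p)) d (true⇒T (∧ˡ (t ℕ.* p ℕ.* quot d (t ℕ.* p) ℕ.≡ᵇ d) e)))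
      , ℕ.<ᵇ⇒< (quot d (t ℕ.* p) ℕ.* quot d (t ℕ.* p)) (4 ℕ.* (j ℕ.* E)) (true⇒T (∧ʳ (t ℕ.* p ℕ.* quot d (t ℕ.* p) ℕ.≡ᵇ d) e))
    cast₃ : ∀ q → + (t ℕ.* p ℕ.* q) ≡ + t * + p * + q
    cast₃ q = trans (ℤ.pos-* (t ℕ.* p) q) (cong (_* + q) (ℤ.pos-* t p))
    linear-part : Linear
    linear-part = by-sign (base E t j ℕ.≤ᵇ n) refl h₆
      where
      by-sign : ∀ b → (base E t j ℕ.≤ᵇ n) ≡ b → (if b then linear E t j (n ℕ.∸ base E t j) else linear E t j (base E t j ℕ.∸ n)) ≡ true → Linear
      by-sign true e h = let (q , d≡ , q²<) = linear-sound (n ℕ.∸ base E t j) h in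
        + q , trans (cong +_ (trans (sym (ℕ.m+[n∸m]≡n (ℕ.≤ᵇ⇒≤ (base E t j) n (true⇒T e)))) (cong (base E t j ℕ.+_) d≡)))
                (trans (cong₂ _+_ (casts E t j) (cast₃ q)) (ring (+ t * + t * + E) (+ p * + p * + j) (+ t * + p * + q))) , q²<
        where
        ring : ∀ a b c → a + b + c ≡ a + c + b
        ring = solve-∀
      by-sign false e h = let (q , d≡ , q²<) = linear-sound (base E t j ℕ.∸ n) h
                              total : base E t j ≡ n ℕ.+ t ℕ.* p ℕ.* q
                              total = trans (sym (ℕ.m+[n∸m]≡n (n≤ e))) (cong (n ℕ.+_) d≡)
                          in - (+ q) , trans (r₀ (+ n) (+ t * + p * + q)) (trans (cong (_- + t * + p * + q) (trans (cong (_+_ (+ n)) (sym (cast₃ q))) (trans (cong +_ (sym total)) (casts E t j)))) (ring (+ t * + t * + E) (+ p * + p * + j) (+ t) (+ p) (+ q)))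
                             , subst (λ z → z ℕ.* z ℕ.< 4 ℕ.* (j ℕ.* E)) (sym (ℤ.∣-i∣≡∣i∣ (+ q))) q²<
        where
        n≤ : (base E t j ℕ.≤ᵇ n) ≡ false → n ℕ.≤ base E t j
        n≤ e with ℕ.≤-total n (base E t j)
        ... | inj₁ le = le
        ... | inj₂ ge with trans (sym (Equivalence.to Bool.T-≡ (ℕ.≤⇒≤ᵇ ge))) e
        ...   | ()
        r₀ : ∀ n x → n ≡ n + x - x
        r₀ = solve-∀
        ring : ∀ a b t p q → a + b - t * p * q ≡ a + t * p * - q + b
        ring = solve-∀

  searchE-sound : ∀ t E → searchE t E ≡ true → BinaryRep p n
  searchE-sound t E h = finish (anyℕ-sound (valid E t) js (∧ʳ (rem n p ℕ.≡ᵇ rem (t ℕ.* t ℕ.* E) p) (∧ʳ (4 ℕ.* E ℕ.<ᵇ p ℕ.* p) h)))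
    where
    finish : (∃ λ j → valid E t j ≡ true) → BinaryRep p n
    finish (j , v) = valid-sound E t j v

  search-sound : search ≡ true → BinaryRep p n
  search-sound h = fromAny (anyℕ-sound searchT ts h)
    where
    fromT : ∀ t → (∃ λ E → searchE t E ≡ true) → BinaryRep p n
    fromT t (E , v) = searchE-sound t E v
    fromAny : (∃ λ t → searchT t ≡ true) → BinaryRep p n
    fromAny (t , v) = fromT t (anyℕ-sound (searchE t) Es v)

  admissible : ℕ → Bool
  admissible x = (x ℕ.≡ᵇ 0) ∨ not (rem x p ℕ.≡ᵇ 0)

  Quadruple : Set
  Quadruple = ℕ × ℕ × ℕ × ℕ

  fits : Quadruple → Bool
  fits (x , y , z , w) = (x ℕ.* x ℕ.+ (y ℕ.* y ℕ.+ (z ℕ.* z ℕ.+ w ℕ.* w)) ℕ.≡ᵇ n) ∧ (admissible x ∧ (admissible y ∧ (admissible z ∧ admissible w)))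

  anyFits : List Quadruple → Bool
  anyFits []       = false
  anyFits (q ∷ qs) = fits q ∨ anyFits qs

  fits-sound : 1 ℕ.≤ p → ∀ q → fits q ≡ true → Rep p n
  fits-sound 1≤p (x , y , z , w) e =
    + x , + y , + z , + w , trans (of-naturals x y z w) (cong +_ (ℕ.≡ᵇ⇒≡ s n (true⇒T (∧ˡ (s ℕ.≡ᵇ n) e))))
      , ok x (∧ˡ (admissible x) e₁) , ok y (∧ˡ (admissible y) e₂) , ok z (∧ˡ (admissible z) e₃) , ok w (∧ʳ (admissible z) e₃)
    where
    s : ℕ
    s = x ℕ.* x ℕ.+ (y ℕ.* y ℕ.+ (z ℕ.* z ℕ.+ w ℕ.* w))
    e₁ : (admissible x ∧ (admissible y ∧ (admissible z ∧ admissible w))) ≡ true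
    e₁ = ∧ʳ (s ℕ.≡ᵇ n) e
    e₂ : (admissible y ∧ (admissible z ∧ admissible w)) ≡ true
    e₂ = ∧ʳ (admissible x) e₁
    e₃ : (admissible z ∧ admissible w) ≡ true
    e₃ = ∧ʳ (admissible y) e₂
    nonzero-rem : ∀ y → not (rem y p ℕ.≡ᵇ 0) ≡ true → 1 ℕ.≤ p → ¬ (p ∣ℕ y)
    nonzero-rem y h (s≤s _) p∣y with trans (sym h) (cong (λ r → not (r ℕ.≡ᵇ 0)) (n∣m⇒m%n≡0 y p p∣y))
    ... | ()
    ok : ∀ x → admissible x ≡ true → Admissible p (+ x)
    ok zero    _ = inj₁ refl
    ok (suc x) h = inj₂ (nonzero-rem (suc x) h 1≤p)

  anyFits-sound : 1 ℕ.≤ p → ∀ qs → anyFits qs ≡ true → Rep p n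
  anyFits-sound 1≤p (q ∷ qs) h = split (fits q) refl h
    where
    split : ∀ b → fits q ≡ b → (b ∨ anyFits qs) ≡ true → Rep p n
    split true  e _ = fits-sound 1≤p q e
    split false _ h = anyFits-sound 1≤p qs h

-- Squares for the n between p² and the search window at which the search below fails (p = 5, 7, 11).
exceptions : List (ℕ × ℕ × ℕ × ℕ)
exceptions = (4 , 3 , 2 , 0) ∷ (6 , 2 , 1 , 0) ∷ (6 , 3 , 1 , 0) ∷ (7 , 1 , 1 , 0) ∷ (7 , 3 , 1 , 0) ∷ (9 , 3 , 2 , 0) ∷ (9 , 4 , 2 , 0)
  ∷ (6 , 5 , 1 , 0) ∷ (9 , 1 , 1 , 0) ∷ (9 , 2 , 2 , 0) ∷ (14 , 3 , 2 , 0) ∷ []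

-- Multiples of 4 pass because they are treated by doubling. For primes other than 5 the excluded
-- value is set to 0, which no n with n % 4 ≠ 0 equals.
test : (p exc n : ℕ) → Bool
test p exc n = (n ℕ.% 4 ℕ.≡ᵇ 0) ∨ ((n ℕ.≡ᵇ exc) ∨ (Search.anyFits p n exceptions ∨ Search.search p n))

-- Adding 2p² to n raises j by 2 and keeps it odd, so a window of length 2p² suffices.
shift : ∀ p m q → BinaryRep p m → BinaryRep p (m ℕ.+ q ℕ.* (2 ℕ.* (p ℕ.* p)))
shift p m q r = record
  { E = E ; t = t ; j = j ℕ.+ 2 ℕ.* q ; l = l ; E-odd = E-odd ; t-odd = t-odd
  ; j-odd = trans (odd-+ j (2 ℕ.* q)) (trans (cong₂ _xor_ j-odd (odd-2* q)) refl) ; p∤t = p∤t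
  ; value = trans (cong₂ _+_ value (trans (ℤ.pos-* q (2 ℕ.* (p ℕ.* p))) (cong (_*_ (+ q)) (trans (ℤ.pos-* 2 (p ℕ.* p)) (cong (_*_ (+ 2)) (ℤ.pos-* p p))))))
      (trans (ring (+ t * + t * + E + + t * + p * l) (+ p) (+ j) (+ q)) (cong (λ z → + t * + t * + E + + t * + p * l + + p * + p * (+ j + z)) (sym (ℤ.pos-* 2 q))))
  ; small = small ; definite = ℕ.<-≤-trans definite (ℕ.*-monoʳ-≤ 4 (ℕ.*-monoˡ-≤ E (ℕ.m≤m+n j (2 ℕ.* q)))) }
  where
  open BinaryRep r
  ring : ∀ x p j q → x + p * p * j + q * (+ 2 * (p * p)) ≡ x + p * p * (j + + 2 * q)
  ring = solve-∀

∨-split : ∀ {A : Set} a {b} → (a ≡ true → A) → (b ≡ true → A) → (a ∨ b) ≡ true → A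
∨-split true  f g _ = f refl
∨-split false f g h = g h

test-sound : ∀ p exc n → 1 ℕ.≤ p → (BinaryRep p n → Rep p n) → n ℕ.% 4 ≢ 0 → n ≢ exc → test p exc n ≡ true → Rep p n
test-sound p exc n 1≤p rep n%4 n≢ =
  ∨-split (n ℕ.% 4 ℕ.≡ᵇ 0) {(n ℕ.≡ᵇ exc) ∨ (Search.anyFits p n exceptions ∨ Search.search p n)} (λ e → ⊥-elim (n%4 (ℕ.≡ᵇ⇒≡ (n ℕ.% 4) 0 (true⇒T e))))
    (∨-split (n ℕ.≡ᵇ exc) {Search.anyFits p n exceptions ∨ Search.search p n} (λ e → ⊥-elim (n≢ (ℕ.≡ᵇ⇒≡ n exc (true⇒T e))))
      (∨-split (Search.anyFits p n exceptions) {Search.search p n} (Search.anyFits-sound p n 1≤p exceptions)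
        (λ e → rep (Search.search-sound p n e))))

-- Between p² and `N₀` the weaker test `f` is enough. From `N₀` on, `g` must succeed on a full
-- period 2p², multiples of 4 included: for odd p the shift by 2p² ≡ 2 (mod 4) carries some of them
-- to numbers that are not multiples of 4.
module Window (p : ℕ) (5≤p : 5 ℕ.≤ p) (N₀ : ℕ) (A : ℕ → Set) (f g : ℕ → Bool)
  (f-sound : ∀ n → f n ≡ true → A n) (g-sound : ∀ n → g n ≡ true → BinaryRep p n) (rep : ∀ n → BinaryRep p n → A n)
  (check₁ : allFrom (p ℕ.* p) (N₀ ℕ.∸ p ℕ.* p) f ≡ true) (check₂ : allFrom N₀ (2 ℕ.* (p ℕ.* p)) g ≡ true) where

  w : ℕ
  w = 2 ℕ.* (p ℕ.* p)

  instance
    w≢0 : NonZero w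
    w≢0 = ℕ.>-nonZero (ℕ.*-mono-≤ {1} {2} (s≤s z≤n) (ℕ.*-mono-≤ {1} {p} (ℕ.≤-trans (s≤s z≤n) 5≤p) (ℕ.≤-trans (s≤s z≤n) 5≤p)))

  below : ∀ n → p ℕ.* p ℕ.≤ n → n ℕ.< N₀ → A n
  below n p²≤n n<N₀ = f-sound n (allFrom-sound (p ℕ.* p) (N₀ ℕ.∸ p ℕ.* p) f check₁ n p²≤n
    (subst (n ℕ.<_) (sym (ℕ.m+[n∸m]≡n (ℕ.≤-trans p²≤n (ℕ.<⇒≤ n<N₀)))) n<N₀))

  above : ∀ n → N₀ ℕ.≤ n → A n
  above n N₀≤n = rep n (subst (BinaryRep p) n≡ (shift p (N₀ ℕ.+ (n ℕ.∸ N₀) ℕ.% w) ((n ℕ.∸ N₀) ℕ./ w) (g-sound (N₀ ℕ.+ (n ℕ.∸ N₀) ℕ.% w)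
    (allFrom-sound N₀ w g check₂ (N₀ ℕ.+ (n ℕ.∸ N₀) ℕ.% w) (ℕ.m≤m+n N₀ ((n ℕ.∸ N₀) ℕ.% w)) (ℕ.+-monoʳ-< N₀ (ℕ.m%n<n (n ℕ.∸ N₀) w))))))
    where
    n≡ : N₀ ℕ.+ (n ℕ.∸ N₀) ℕ.% w ℕ.+ (n ℕ.∸ N₀) ℕ./ w ℕ.* w ≡ n
    n≡ = trans (ℕ.+-assoc N₀ ((n ℕ.∸ N₀) ℕ.% w) ((n ℕ.∸ N₀) ℕ./ w ℕ.* w)) (trans (cong (N₀ ℕ.+_) (sym (ℕ.m≡m%n+[m/n]*n (n ℕ.∸ N₀) w))) (ℕ.m+[n∸m]≡n N₀≤n))

  everywhere : ∀ n → p ℕ.* p ℕ.≤ n → A n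
  everywhere n p²≤n = by-size (ℕ.<-≤-connex n N₀)
    where
    by-size : n ℕ.< N₀ ⊎ N₀ ℕ.≤ n → A n
    by-size (inj₁ n<N₀) = below n p²≤n n<N₀
    by-size (inj₂ N₀≤n) = above n N₀≤n

module Window-5 (rep : ∀ n → BinaryRep 5 n → n ℕ.% 4 ≢ 0 → Rep 5 n) where
  A : ℕ → Set
  A n = n ℕ.% 4 ≢ 0 → n ≢ 79 → Rep 5 n
  open Window 5 (ℕ.m≤m+n 5 0) 150 A (test 5 79) (Search.search 5)
    (λ n h n%4 n≢ → test-sound 5 79 n (s≤s z≤n) (λ r → rep n r n%4) n%4 n≢ h) (λ n → Search.search-sound 5 n) (λ n r n%4 _ → rep n r n%4)
    refl refl public using (everywhere)

module Window-other (p : ℕ) (5≤p : 5 ℕ.≤ p) (rep : ∀ n → BinaryRep p n → n ℕ.% 4 ≢ 0 → Rep p n) (N₀ : ℕ)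
  (check₁ : allFrom (p ℕ.* p) (N₀ ℕ.∸ p ℕ.* p) (test p 0) ≡ true) (check₂ : allFrom N₀ (2 ℕ.* (p ℕ.* p)) (Search.search p) ≡ true) where
  A : ℕ → Set
  A n = n ℕ.% 4 ≢ 0 → Rep p n
  nonzero : ∀ n → n ℕ.% 4 ≢ 0 → n ≢ 0
  nonzero n n%4 refl = n%4 refl
  open Window p 5≤p N₀ A (test p 0) (Search.search p)
    (λ n h n%4 → test-sound p 0 n (ℕ.≤-trans (s≤s z≤n) 5≤p) (λ r → rep n r n%4) n%4 (nonzero n n%4) h) (λ n → Search.search-sound p n) rep
    check₁ check₂ public using (everywhere)

primes-below-17 : ∀ p → p ℕ.< 17 → Prime p → 5 ℕ.≤ p → p ≡ 5 ⊎ (p ≡ 7 ⊎ (p ≡ 11 ⊎ p ≡ 13))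
primes-below-17 p p<17 = subst P (Fin.toℕ-fromℕ< p<17) (from-yes (Fin.all? {17} {P = λ i → P (Fin.toℕ i)} λ i →
  prime? (Fin.toℕ i) →-dec ((5 ℕ.≤? Fin.toℕ i) →-dec ((Fin.toℕ i ℕ.≟ 5) ⊎-dec ((Fin.toℕ i ℕ.≟ 7) ⊎-dec ((Fin.toℕ i ℕ.≟ 11) ⊎-dec (Fin.toℕ i ℕ.≟ 13)))))) (Fin.fromℕ< p<17))
  where
  P : ℕ → Set
  P p = Prime p → 5 ℕ.≤ p → p ≡ 5 ⊎ (p ≡ 7 ⊎ (p ≡ 11 ⊎ p ≡ 13))

prime-odd : ∀ p → Prime p → 5 ℕ.≤ p → odd p ≡ true
prime-odd p p-prime 5≤p = by-parity (odd p) refl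
  where
  no-divisor : 2 ≡ 1 ⊎ 2 ≡ p → ⊥
  no-divisor (inj₁ ())
  no-divisor (inj₂ 2≡p) = ℕ.<⇒≱ (ℕ.≤-trans (ℕ.m≤m+n 3 2) 5≤p) (ℕ.≤-reflexive (sym 2≡p))
  by-parity : ∀ b → odd p ≡ b → odd p ≡ true
  by-parity true  e = e
  by-parity false e = let (k , p≡) = even⇒2k p e in ⊥-elim (no-divisor (prime⇒irreducible p-prime (divides k (trans p≡ (ℕ.*-comm 2 k)))))

-- Every n except the exceptional one.

module Representations (p : ℕ) (p-prime : Prime p) (5≤p : 5 ℕ.≤ p) where

  1≤p : 1 ℕ.≤ p
  1≤p = ℕ.≤-trans (s≤s z≤n) 5≤p

  rep : ∀ n → BinaryRep p n → n ℕ.% 4 ≢ 0 → Rep p n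
  rep n r = Core.represented p p-prime 5≤p (odd⇒Odd p (prime-odd p p-prime 5≤p)) r

  from-p² : ∀ n → p ℕ.* p ℕ.≤ n → n ℕ.% 4 ≢ 0 → ¬ (p ≡ 5 × n ≡ 79) → Rep p n
  from-p² n p²≤n n%4 n≢ = by-size (ℕ.<-≤-connex p 17)
    where
    small : ∀ q → p ≡ q → q ℕ.* q ℕ.≤ n
    small q refl = p²≤n
    transfer : ∀ q → p ≡ q → ∀ n → BinaryRep q n → n ℕ.% 4 ≢ 0 → Rep q n
    transfer q refl = rep
    back : ∀ q → p ≡ q → Rep q n → Rep p n
    back q refl r = r
    by-prime : p ≡ 5 ⊎ (p ≡ 7 ⊎ (p ≡ 11 ⊎ p ≡ 13)) → Rep p n
    by-prime (inj₁ e) = back 5 e (Window-5.everywhere (transfer 5 e) n (small 5 e) n%4 (λ n≡ → n≢ (e , n≡)))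
    by-prime (inj₂ (inj₁ e)) = back 7 e (Window-other.everywhere 7 (ℕ.m≤m+n 5 2) (transfer 7 e) 196 refl refl n (small 7 e) n%4)
    by-prime (inj₂ (inj₂ (inj₁ e))) = back 11 e (Window-other.everywhere 11 (ℕ.m≤m+n 5 6) (transfer 11 e) 242 refl refl n (small 11 e) n%4)
    by-prime (inj₂ (inj₂ (inj₂ e))) = back 13 e (Window-other.everywhere 13 (ℕ.m≤m+n 5 8) (transfer 13 e) 169 refl refl n (small 13 e) n%4)
    large : 17 ℕ.≤ p → (∃ λ k → p ≡ 1 ℕ.+ 2 ℕ.* k) → Rep p n
    large 17≤p (k , p≡) = rep n (large-prime (k ℕ.∸ 8) p n p≡17+2b {{prime⇒nonZero p-prime}} {{ℕ.>-nonZero (ℕ.*-mono-≤ {1} {2} (s≤s z≤n) 1≤p)}} p²≤n) n%4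
      where
      8≤k : 8 ℕ.≤ k
      8≤k = ℕ.*-cancelˡ-≤ 2 (ℕ.s≤s⁻¹ (subst (17 ℕ.≤_) p≡ 17≤p))
      ring : ∀ b → 1 ℕ.+ 2 ℕ.* (8 ℕ.+ b) ≡ 17 ℕ.+ 2 ℕ.* b
      ring = ℕ-Solver.solve-∀
      p≡17+2b : p ≡ 17 ℕ.+ 2 ℕ.* (k ℕ.∸ 8)
      p≡17+2b = trans p≡ (trans (cong (λ z → 1 ℕ.+ 2 ℕ.* z) (sym (ℕ.m+[n∸m]≡n 8≤k))) (ring (k ℕ.∸ 8)))
    by-size : p ℕ.< 17 ⊎ 17 ℕ.≤ p → Rep p n
    by-size (inj₁ p<17) = by-prime (primes-below-17 p p<17 p-prime 5≤p)
    by-size (inj₂ 17≤p) = large 17≤p (odd⇒1+2k p (prime-odd p p-prime 5≤p))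

  below-p² : ∀ n → n ℕ.< p ℕ.* p → n ℕ.% 4 ≢ 0 → Rep p n
  below-p² n n<p² n%4 = from-quaternion (four-squares n n%4)
    where
    admissible : ∀ x → ∣ x ∣ ℕ.* ∣ x ∣ ℕ.≤ n → Admissible p x
    admissible x x²≤n = by-zero (∣ x ∣ ℕ.≟ 0)
      where
      by-zero : Dec (∣ x ∣ ≡ 0) → Admissible p x
      by-zero (yes e) = inj₁ (ℤ.∣i∣≡0⇒i≡0 e)
      by-zero (no ≢0) = inj₂ λ p∣x → let p≤x = ∣⇒≤ {{ℕ.≢-nonZero ≢0}} p∣x in ℕ.<⇒≱ n<p² (ℕ.≤-trans (ℕ.*-mono-≤ p≤x p≤x) x²≤n)
    from-quaternion : (∃ λ q → norm q ≡ + n) → Rep p n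
    from-quaternion (q@(quat x y z w) , e) =
      let (bx , by , bz , bw) = component-bounds q e
      in x , y , z , w , e , admissible x bx , admissible y by , admissible z bz , admissible w bw

  double : ∀ n → Rep p n → Rep p (n ℕ.* 4)
  double n (x , y , z , w , e , ax , ay , az , aw) =
    + 2 * x , + 2 * y , + 2 * z , + 2 * w , trans (ring x y z w) (trans (cong (_* + 4) e) (sym (ℤ.pos-* n 4))) , ok x ax , ok y ay , ok z az , ok w aw
    where
    ring : ∀ x y z w → + 2 * x * (+ 2 * x) + (+ 2 * y * (+ 2 * y) + (+ 2 * z * (+ 2 * z) + + 2 * w * (+ 2 * w))) ≡ (x * x + (y * y + (z * z + w * w))) * + 4
    ring = solve-∀
    ok : ∀ x → Admissible p x → Admissible p (+ 2 * x)
    ok x (inj₁ refl) = inj₁ refl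
    ok x (inj₂ p∤x)  = inj₂ λ p∣2x → split (euclidsLemma 2 ∣ x ∣ p-prime (subst (p ∣ℕ_) (ℤ.abs-* (+ 2) x) p∣2x))
      where
      split : p ∣ℕ 2 ⊎ p ∣ℕ ∣ x ∣ → ⊥
      split (inj₁ p∣2) = ℕ.<⇒≱ (ℕ.≤-trans (ℕ.m≤m+n 3 2) 5≤p) (∣⇒≤ p∣2)
      split (inj₂ p∣x) = p∤x p∣x

  all : ∀ n → 1 ℕ.≤ n → ¬ (p ≡ 5 × n ≡ 79) → Rep p n
  all = <-rec (λ n → 1 ℕ.≤ n → ¬ (p ≡ 5 × n ≡ 79) → Rep p n) step
    where
    step : ∀ n → (∀ {m} → m ℕ.< n → 1 ℕ.≤ m → ¬ (p ≡ 5 × m ≡ 79) → Rep p m) → 1 ℕ.≤ n → ¬ (p ≡ 5 × n ≡ 79) → Rep p n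
    step n rec 1≤n n≢ = by-4 (n ℕ.% 4 ℕ.≟ 0)
      where
      quarter : ∀ m → n ≡ m ℕ.* 4 → Dec (p ≡ 5) → Dec (m ≡ 79) → Rep p n
      -- Doubling is blocked since 79 has no representation; instead 4 · 79 = 316 = 17² + 3² + 3² +
      -- 3².
      quarter m n≡ (yes refl) (yes refl) = subst (Rep 5) (sym n≡) (Search.anyFits-sound 5 316 (s≤s z≤n) ((17 , 3 , 3 , 3) ∷ []) refl)
      quarter zero    n≡ _ _ = ⊥-elim (ℕ.<⇒≱ 1≤n (ℕ.≤-reflexive n≡))
      quarter (suc m) n≡ (no p≢5) _ = subst (Rep p) (sym n≡) (double (suc m) (rec (subst (suc m ℕ.<_) (sym n≡) (ℕ.m<m*n (suc m) 4 (s≤s (s≤s z≤n)))) (s≤s z≤n) (λ (e , _) → p≢5 e)))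
      quarter (suc m) n≡ _ (no m≢79) = subst (Rep p) (sym n≡) (double (suc m) (rec (subst (suc m ℕ.<_) (sym n≡) (ℕ.m<m*n (suc m) 4 (s≤s (s≤s z≤n)))) (s≤s z≤n) (λ (_ , e) → m≢79 e)))
      by-size : n ℕ.% 4 ≢ 0 → n ℕ.< p ℕ.* p ⊎ p ℕ.* p ℕ.≤ n → Rep p n
      by-size n%4 (inj₁ n<p²) = below-p² n n<p² n%4
      by-size n%4 (inj₂ p²≤n) = from-p² n p²≤n n%4 n≢
      from-multiple : 4 ∣ℕ n → Rep p n
      from-multiple (divides m n≡) = quarter m n≡ (p ℕ.≟ 5) (m ℕ.≟ 79)
      by-4 : Dec (n ℕ.% 4 ≡ 0) → Rep p n
      by-4 (yes e)  = from-multiple (m%n≡0⇒n∣m n 4 e)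
      by-4 (no n%4) = by-size n%4 (ℕ.<-≤-connex n (p ℕ.* p))

  -- Dropping the zeros leaves the sum of squares unchanged, and the product of the remaining
  -- coordinates is prime to p by Euclid's lemma.
  prune : ∀ {k} (xs : Vec ℤ k) → All (Admissible p) xs → ∃ λ m → m ℕ.≤ k × ∃ λ (ys : Vec ℤ m) → sumSq ys ≡ sumSq xs × ¬ (p ∣ℕ ∣ prod ys ∣)
  prune [] [] = 0 , z≤n , [] , refl , λ p∣1 → ℕ.<⇒≱ (ℕ.≤-trans (ℕ.m≤m+n 2 3) 5≤p) (ℕ.≤-reflexive (∣1⇒≡1 p∣1))
  prune (x ∷ xs) (inj₁ refl ∷ as) = let (m , m≤k , ys , e , p∤) = prune xs as in m , ℕ.m≤n⇒m≤1+n m≤k , ys , trans e (sym (ℤ.+-identityˡ (sumSq xs))) , p∤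
  prune (x ∷ xs) (inj₂ p∤x ∷ as) = let (m , m≤k , ys , e , p∤) = prune xs as in suc m , s≤s m≤k , x ∷ ys , cong (_+_ (x * x)) e
    , λ p∣ → either p∤ (euclidsLemma ∣ x ∣ ∣ prod ys ∣ p-prime (subst (p ∣ℕ_) (ℤ.abs-* x (prod ys)) p∣))
    where
    either : ∀ {m} → ¬ (p ∣ℕ m) → p ∣ℕ ∣ x ∣ ⊎ p ∣ℕ m → ⊥
    either p∤ (inj₁ p∣x) = p∤x p∣x
    either p∤ (inj₂ p∣m) = p∤ p∣m

  coprime : ∀ m → ¬ (p ∣ℕ m) → ℕ.gcd p m ≡ 1
  coprime m p∤m = by-divisor (prime⇒irreducible p-prime (ℕ.gcd[m,n]∣m p m))
    where
    by-divisor : ℕ.gcd p m ≡ 1 ⊎ ℕ.gcd p m ≡ p → ℕ.gcd p m ≡ 1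
    by-divisor (inj₁ e) = e
    by-divisor (inj₂ e) = ⊥-elim (p∤m (subst (_∣ℕ m) e (ℕ.gcd[m,n]∣n p m)))

  sum-of-at-most-four : ∀ n → 1 ℕ.≤ n → ¬ (p ≡ 5 × n ≡ 79) → ∃ λ k → 1 ℕ.≤ k × k ℕ.≤ 4 × SumSqNotDiv p k (+ n)
  sum-of-at-most-four n 1≤n n≢ = from-rep (all n 1≤n n≢)
    where
    from-vector : ∀ {m} (ys : Vec ℤ m) → + n ≡ sumSq ys → ¬ (p ∣ℕ ∣ prod ys ∣) → 1 ℕ.≤ m × SumSqNotDiv p m (+ n)
    from-vector []       e p∤ = ⊥-elim (ℕ.<⇒≱ 1≤n (ℕ.≤-reflexive (ℤ.+-injective e)))
    from-vector (y ∷ ys) e p∤ = s≤s z≤n , y ∷ ys , e , cong +_ (coprime ∣ prod (y ∷ ys) ∣ p∤)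
    from-rep : Rep p n → ∃ λ k → 1 ℕ.≤ k × k ℕ.≤ 4 × SumSqNotDiv p k (+ n)
    from-rep (x , y , z , w , e , ax , ay , az , aw) =
      let (m , m≤4 , ys , s , p∤) = prune (x ∷ y ∷ z ∷ w ∷ []) (ax ∷ ay ∷ az ∷ aw ∷ [])
          (1≤m , r) = from-vector ys (trans (sym e) (trans (cong (λ t → x * x + (y * y + (z * z + t))) (sym (ℤ.+-identityʳ (w * w)))) (sym s))) p∤
      in m , 1≤m , m≤4 , r

-- The number 79 and the prime 5.

anyBelow : ℕ → (ℕ → Bool) → Bool
anyBelow zero    f = false
anyBelow (suc b) f = f b ∨ anyBelow b f

anyBelow-complete : ∀ b f a → a ℕ.< b → f a ≡ true → anyBelow b f ≡ true
anyBelow-complete (suc b) f a a<b h = by-case (a ℕ.≟ b)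
  where
  ∨-true : ∀ x {y} → y ≡ true → (x ∨ y) ≡ true
  ∨-true true  _ = refl
  ∨-true false e = e
  by-case : Dec (a ≡ b) → (f b ∨ anyBelow b f) ≡ true
  by-case (yes refl) = cong (_∨ anyBelow b f) h
  by-case (no a≢b)   = ∨-true (f b) (anyBelow-complete b f a (ℕ.≤∧≢⇒< (ℕ.s≤s⁻¹ a<b) a≢b) h)

-- Sums of k squares prime to 5; roots below 9 suffice for s ≤ 79.
sumOfSquares? : ℕ → ℕ → Bool
sumOfSquares? zero    s = s ℕ.≡ᵇ 0
sumOfSquares? (suc k) s = anyBelow 9 λ a → not (a ℕ.% 5 ℕ.≡ᵇ 0) ∧ ((a ℕ.* a ℕ.≤ᵇ s) ∧ sumOfSquares? k (s ℕ.∸ a ℕ.* a))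

absSumSq : ∀ {k} → Vec ℤ k → ℕ
absSumSq []       = 0
absSumSq (x ∷ xs) = ∣ x ∣ ℕ.* ∣ x ∣ ℕ.+ absSumSq xs

sumSq-abs : ∀ {k} (xs : Vec ℤ k) → sumSq xs ≡ + absSumSq xs
sumSq-abs []       = refl
sumSq-abs (x ∷ xs) = cong₂ _+_ (square-abs x) (sumSq-abs xs)

sumOfSquares?-complete : ∀ {k} (xs : Vec ℤ k) → All (λ x → ¬ (5 ∣ℕ ∣ x ∣)) xs → absSumSq xs ℕ.< 81 → sumOfSquares? k (absSumSq xs) ≡ true
sumOfSquares?-complete [] _ _ = refl
sumOfSquares?-complete {suc k} (x ∷ xs) (5∤x ∷ 5∤) s<81 =
  anyBelow-complete 9 (λ a → not (a ℕ.% 5 ℕ.≡ᵇ 0) ∧ ((a ℕ.* a ℕ.≤ᵇ s) ∧ sumOfSquares? k (s ℕ.∸ a ℕ.* a))) ∣ x ∣ x<9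
    (cong₂ _∧_ (by-rem (∣ x ∣ ℕ.% 5 ℕ.≡ᵇ 0) refl) (cong₂ _∧_ (Equivalence.to Bool.T-≡ (ℕ.≤⇒≤ᵇ (ℕ.m≤m+n X r)))
      (trans (cong (sumOfSquares? k) (ℕ.m+n∸m≡n X r)) (sumOfSquares?-complete xs 5∤ (ℕ.≤-<-trans (ℕ.m≤n+m r X) s<81)))))
  where
  X r s : ℕ
  X = ∣ x ∣ ℕ.* ∣ x ∣
  r = absSumSq xs
  s = X ℕ.+ r
  x<9 : ∣ x ∣ ℕ.< 9
  x<9 = ℕ.≰⇒> λ 9≤x → ℕ.<⇒≱ s<81 (ℕ.≤-trans (ℕ.*-mono-≤ 9≤x 9≤x) (ℕ.m≤m+n X r))
  by-rem : ∀ b → (∣ x ∣ ℕ.% 5 ℕ.≡ᵇ 0) ≡ b → not b ≡ true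
  by-rem true  e = ⊥-elim (5∤x (m%n≡0⇒n∣m ∣ x ∣ 5 (ℕ.≡ᵇ⇒≡ (∣ x ∣ ℕ.% 5) 0 (true⇒T e))))
  by-rem false _ = refl

factors-∤ : ∀ {k} (xs : Vec ℤ k) → ¬ (5 ∣ℕ ∣ prod xs ∣) → All (λ x → ¬ (5 ∣ℕ ∣ x ∣)) xs
factors-∤ []       _   = []
factors-∤ (x ∷ xs) 5∤ = (λ 5∣x → 5∤ (subst (5 ∣ℕ_) (sym (ℤ.abs-* x (prod xs))) (∣m⇒∣m*n ∣ prod xs ∣ 5∣x)))
  ∷ factors-∤ xs (λ 5∣xs → 5∤ (subst (5 ∣ℕ_) (sym (ℤ.abs-* x (prod xs))) (∣n⇒∣m*n ∣ x ∣ 5∣xs)))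

-- The search is complete below 81 = 9², so a representation would make it succeed. A coordinate
-- divisible by 5 is excluded because 5 would then divide the gcd, which is 1.
exceptional : ∀ k → sumOfSquares? k 79 ≡ false → ¬ SumSqNotDiv 5 k (+ 79)
exceptional k none (xs , 79≡ , g) = impossible (trans (sym none) (trans (cong (sumOfSquares? k) s≡) (sumOfSquares?-complete xs (factors-∤ xs 5∤) (subst (ℕ._< 81) s≡ (ℕ.m≤m+n 80 1)))))
  where
  impossible : false ≡ true → ⊥
  impossible ()
  s≡ : 79 ≡ absSumSq xs
  s≡ = ℤ.+-injective (trans 79≡ (sumSq-abs xs))
  5∤ : ¬ (5 ∣ℕ ∣ prod xs ∣)
  5∤ 5∣ = from-no (5 ∣? 1) (subst (5 ∣ℕ_) (ℤ.+-injective g) (ℕ.gcd-greatest ∣-refl 5∣))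

theorem4p4 : ∀ (p : ℕ) → Prime p → 5 ≤ p →
    ((n : ℕ) → 1 ≤ n → ¬ (p ≡ 5 × n ≡ 79) →
    ∃ λ k → 1 ≤ k × k ≤ 4 × SumSqNotDiv p k (+ n))
    × (p ≡ 5 →
    (¬ ∃ λ k → 1 ≤ k × k ≤ 4 × SumSqNotDiv p k (+ 79))
    × SumSqNotDiv p 5 (+ 79))
theorem4p4 p p-prime 5≤p = Representations.sum-of-at-most-four p p-prime 5≤p
  , λ { refl → (λ (k , _ , k≤4 , r) → at-most-four k k≤4 r) , + 8 ∷ + 3 ∷ + 2 ∷ + 1 ∷ + 1 ∷ [] , refl , refl }
  where
  at-most-four : ∀ k → k ≤ 4 → ¬ SumSqNotDiv 5 k (+ 79)
  at-most-four 0 _ = exceptional 0 refl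
  at-most-four 1 _ = exceptional 1 refl
  at-most-four 2 _ = exceptional 2 refl
  at-most-four 3 _ = exceptional 3 refl
  at-most-four 4 _ = exceptional 4 refl
  at-most-four (suc (suc (suc (suc (suc k))))) (s≤s (s≤s (s≤s (s≤s ()))))
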